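{- Let $n$ be a positive integer. For every pair of random variables $\mathbf{A},\mathbf{B}$ taking values in $\mathbb{F}_2^n$, there exists a linear subspace $V\subseteq\mathbb{F}_2^n$ such that $$\mathrm{d}[\mathbf{A};\mathbf{U}_V]+\mathrm{d}[\mathbf{B};\mathbf{U}_V]\le 10\,\mathrm{d}[\mathbf{A};\mathbf{B}],$$ where $\mathbf{U}_V$ denotes a random variable uniformly distributed on $V$.
   Context: All logarithms are base $2$. For a random variable $\mathbf{X}$ on a finite set, its Shannon entropy is $\mathrm{H}(\mathbf{X})=\sum_{x\in\mathrm{Supp}(\mathbf{X})}-\Pr[\mathbf{X}=x]\log \Pr[\mathbf{X}=x]$. The entropic Ruzsa distance between random variables $\mathbf{X},\mathbf{Y}$ on $\mathbb{F}_2^n$ is $$\mathrm{d}[\mathbf{X};\mathbf{Y}]:=\mathrm{H}(\mathbf{X}'-\mathbf{Y}')-\tfrac12\left(\mathrm{H}(\mathbf{X})+\mathrm{H}(\mathbf{Y})\right),$$ where $\mathbf{X}',\mathbf{Y}'$ are independent copies of $\mathbf{X},\mathbf{Y}$ (i.e. $\mathbf{X}'$ has the distribution of $\mathbf{X}$, $\mathbf{Y}'$ has the distribution of $\mathbf{Y}$, and $\mathbf{X}',\mathbf{Y}'$ are independent). It depends only on the individual distributions of $\mathbf{X}$ and $\mathbf{Y}$, even if $\mathbf{X}$ and $\mathbf{Y}$ are correlated. -}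

module Defs where

open import Algebra.Bundles using (CommutativeRing; Semiring)
import Algebra.Definitions.RawSemiring
import Algebra.Properties.Ring
open import Axiom.ExcludedMiddle using (ExcludedMiddle)
open import Data.Bool.Base using (Bool; true; false; if_then_else_)
open import Data.Bool.Properties using (xor-∧-commutativeRing)
open import Data.Empty using (⊥-elim)
open import Data.Nat.Base using (ℕ; zero; suc)
open import Data.Product.Base using (_,_; proj₁; proj₂; ∃; _×_)
open import Data.Sum.Base using (_⊎_; inj₁; inj₂)
open import Data.Vec.Base using (Vec; []; _∷_; zipWith; map; replicate)
import Data.Vec.Properties as Vec
import Data.Bool.Properties as Bool
open import Level using (0ℓ)
open import Relation.Binary.Core using (Rel)
open import Relation.Binary.Definitions using (DecidableEquality)
open import Relation.Binary.PropositionalEquality.Core using (_≡_; cong)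
import Relation.Binary.Reasoning.Setoid
open import Relation.Binary.Structures using (IsDecTotalOrder)
open import Relation.Nullary.Decidable using (Dec; yes; no; does; dec-true)
open import Relation.Nullary.Negation.Core using (¬_)
open import Relation.Unary using (Pred; Decidable)

-- The real numbers, given by their characterisation as the Dedekind-complete
-- ordered field, which is unique up to isomorphism.
--
-- The theory intended is the classical one: the order is decidable, and a
-- supremum is approximated by actual elements of the set.  Together these imply
-- excluded middle (see `excludedMiddle`), and excluded middle in turn yields a model.
-- `_⁻¹` and `sup` are total functions, unspecified outside their usual domains.
record RealField : Set₁ where
  field
    commutativeRing : CommutativeRing 0ℓ 0ℓ

  open CommutativeRing commutativeRing public
  open Algebra.Definitions.RawSemiring (Semiring.rawSemiring semiring) public
    using (_^_) renaming (_×_ to _×ℕ_)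

  infix  4 _≤_ _<_
  infixl 8 _⁻¹

  field
    _≤_             : Rel Carrier 0ℓ
    isDecTotalOrder : IsDecTotalOrder _≈_ _≤_
    0≉1             : ¬ (0# ≈ 1#)
    +-monoˡ-≤       : ∀ z {x y} → x ≤ y → x + z ≤ y + z
    *-nonneg        : ∀ {x y} → 0# ≤ x → 0# ≤ y → 0# ≤ x * y
    _⁻¹             : Carrier → Carrier
    *-inverseʳ      : ∀ {x} → ¬ (x ≈ 0#) → x * x ⁻¹ ≈ 1#

  module ≤ = IsDecTotalOrder isDecTotalOrder
  open ≤ public using (_≟_; _≤?_)

  _<_ : Rel Carrier 0ℓ
  x < y = ¬ (y ≤ x)

  IsUpperBound : Pred Carrier 0ℓ → Carrier → Set
  IsUpperBound S b = ∀ x → S x → x ≤ b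

  IsSup : Pred Carrier 0ℓ → Carrier → Set
  IsSup S s = IsUpperBound S s × (∀ x → x < s → ∃ λ y → S y × x < y)

  field
    sup          : Pred Carrier 0ℓ → Carrier
    completeness : ∀ S → ∃ S → ∃ (IsUpperBound S) → IsSup S (sup S)

  fromℕ : ℕ → Carrier
  fromℕ m = m ×ℕ 1#

  ½ : Carrier
  ½ = fromℕ 2 ⁻¹

  -- y = (a − b) / (k + 1) and 2^y ≤ x, with denominators cleared.
  RationalBelowLog₂ : Carrier → Pred Carrier 0ℓ
  RationalBelowLog₂ x y = ∃ λ a → ∃ λ b → ∃ λ k →
    (y * fromℕ (suc k) ≈ fromℕ a - fromℕ b) ×
    (fromℕ 2 ^ a ≤ x ^ suc k * fromℕ 2 ^ b)

  -- For 0 < x this is the base-2 logarithm: the supremum of the rationals y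
  -- with 2^y ≤ x.  For other x the value is unspecified.
  log₂ : Carrier → Carrier
  log₂ x = sup (RationalBelowLog₂ x)

  private
    open module RingProperties = Algebra.Properties.Ring ring
      using (-1*x≈-x; -‿involutive)
    open module R = Relation.Binary.Reasoning.Setoid setoid

    ≤-respʳ : ∀ {x y z} → y ≈ z → x ≤ y → x ≤ z
    ≤-respʳ y≈z x≤y = ≤.trans x≤y (≤.reflexive y≈z)

    ≤-respˡ : ∀ {x y z} → x ≈ y → x ≤ z → y ≤ z
    ≤-respˡ x≈y x≤z = ≤.trans (≤.reflexive (sym x≈y)) x≤z

  neg-nonneg : ∀ {x} → x ≤ 0# → 0# ≤ - x
  neg-nonneg {x} x≤0 =
    ≤-respˡ (-‿inverseʳ x) (≤-respʳ (+-identityˡ (- x)) (+-monoˡ-≤ (- x) x≤0))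

  neg-square : ∀ x → - x * - x ≈ x * x
  neg-square x = begin
    - x * - x            ≈⟨ *-congʳ (-1*x≈-x x) ⟨
    (- 1# * x) * - x     ≈⟨ *-congʳ (*-comm (- 1#) x) ⟩
    (x * - 1#) * - x     ≈⟨ *-assoc x (- 1#) (- x) ⟩
    x * (- 1# * - x)     ≈⟨ *-congˡ (-1*x≈-x (- x)) ⟩
    x * - (- x)          ≈⟨ *-congˡ (-‿involutive x) ⟩
    x * x                ∎

  square-nonneg : ∀ x → 0# ≤ x * x
  square-nonneg x with ≤.total 0# x
  ... | inj₁ 0≤x = *-nonneg 0≤x 0≤x
  ... | inj₂ x≤0 = ≤-respʳ (neg-square x) (*-nonneg (neg-nonneg x≤0) (neg-nonneg x≤0))

  0≤1 : 0# ≤ 1#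
  0≤1 = ≤-respʳ (*-identityˡ 1#) (square-nonneg 1#)

  x≤x+y : ∀ x {y} → 0# ≤ y → x ≤ x + y
  x≤x+y x {y} 0≤y =
    ≤-respˡ (+-identityˡ x) (≤-respʳ (+-comm y x) (+-monoˡ-≤ x 0≤y))

  +-nonneg : ∀ {x y} → 0# ≤ x → 0# ≤ y → 0# ≤ x + y
  +-nonneg {x} 0≤x 0≤y = ≤.trans 0≤x (x≤x+y x 0≤y)

  ⁻¹-nonneg : ∀ {x} → ¬ (x ≈ 0#) → 0# ≤ x → 0# ≤ x ⁻¹
  ⁻¹-nonneg {x} x≉0 0≤x = ≤-respʳ eq (*-nonneg 0≤x (square-nonneg (x ⁻¹)))
    where
    eq : x * (x ⁻¹ * x ⁻¹) ≈ x ⁻¹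
    eq = begin
      x * (x ⁻¹ * x ⁻¹) ≈⟨ *-assoc x (x ⁻¹) (x ⁻¹) ⟨
      x * x ⁻¹ * x ⁻¹   ≈⟨ *-congʳ (*-inverseʳ x≉0) ⟩
      1# * x ⁻¹         ≈⟨ *-identityˡ (x ⁻¹) ⟩
      x ⁻¹              ∎

  excludedMiddle : ExcludedMiddle 0ℓ
  excludedMiddle {P} = decide (sup S ≤? 0#)
    where
    S : Pred Carrier 0ℓ
    S x = x ≈ 0# ⊎ (x ≈ 1# × P)

    bounded : IsUpperBound S 1#
    bounded x (inj₁ x≈0)       = ≤-respˡ (sym x≈0) 0≤1
    bounded x (inj₂ (x≈1 , _)) = ≤.reflexive x≈1

    S-sup : IsSup S (sup S)
    S-sup = completeness S (0# , inj₁ refl) (1# , bounded)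

    decide : Dec (sup S ≤ 0#) → Dec P
    decide (yes s≤0) = no λ p →
      0≉1 (≤.antisym 0≤1 (≤.trans (proj₁ S-sup 1# (inj₂ (refl , p))) s≤0))
    decide (no  0<s) with proj₂ S-sup 0# 0<s
    ... | y , inj₁ y≈0       , 0<y = ⊥-elim (0<y (≤.reflexive y≈0))
    ... | y , inj₂ (_ , p)   , _   = yes p

module F₂ = CommutativeRing xor-∧-commutativeRing

F₂^ : ℕ → Set
F₂^ n = Vec F₂.Carrier n

module _ {n : ℕ} where

  infixl 6 _⊕_ _⊖_
  infixr 7 _•_

  _⊕_ _⊖_ : F₂^ n → F₂^ n → F₂^ n
  _⊕_ = zipWith F₂._+_
  _⊖_ = zipWith F₂._-_

  _•_ : F₂.Carrier → F₂^ n → F₂^ n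
  c • v = map (c F₂.*_) v

  𝟎 : F₂^ n
  𝟎 = replicate n F₂.0#

  infix 4 _≟ᵛ_
  _≟ᵛ_ : DecidableEquality (F₂^ n)
  _≟ᵛ_ = Vec.≡-dec Bool._≟_

record Subspace (n : ℕ) : Set₁ where
  field
    Member   : Pred (F₂^ n) 0ℓ
    member?  : Decidable Member
    𝟎-mem    : Member 𝟎
    ⊕-closed : ∀ {u v} → Member u → Member v → Member (u ⊕ v)
    •-closed : ∀ c {v} → Member v → Member (c • v)

module Entropy (ℝ : RealField) where

  open RealField ℝ
  private
    open module R = Relation.Binary.Reasoning.Setoid setoid

  ∑ : ∀ n → (F₂^ n → Carrier) → Carrier
  ∑ zero    f = f []
  ∑ (suc n) f = ∑ n (λ v → f (false ∷ v)) + ∑ n (λ v → f (true ∷ v))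

  syntax ∑ n (λ x → t) = ∑[ x ∈F₂^ n ] t

  𝟙 : {P : Set} → Dec P → Carrier
  𝟙 P? = if does P? then 1# else 0#

  𝟙-nonneg : {P : Set} (P? : Dec P) → 0# ≤ 𝟙 P?
  𝟙-nonneg (yes _) = 0≤1
  𝟙-nonneg (no _)  = ≤.refl

  𝟙-yes : {P : Set} (P? : Dec P) → P → 𝟙 P? ≈ 1#
  𝟙-yes P? p = reflexive (cong (if_then 1# else 0#) (dec-true P? p))

  ∑-cong : ∀ n {f g : F₂^ n → Carrier} → (∀ v → f v ≈ g v) → ∑ n f ≈ ∑ n g
  ∑-cong zero    f≈g = f≈g []
  ∑-cong (suc n) f≈g =
    +-cong (∑-cong n (λ v → f≈g (false ∷ v))) (∑-cong n (λ v → f≈g (true ∷ v)))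

  ∑-nonneg : ∀ n {f : F₂^ n → Carrier} → (∀ v → 0# ≤ f v) → 0# ≤ ∑ n f
  ∑-nonneg zero    0≤f = 0≤f []
  ∑-nonneg (suc n) 0≤f =
    +-nonneg (∑-nonneg n (λ v → 0≤f (false ∷ v))) (∑-nonneg n (λ v → 0≤f (true ∷ v)))

  ∑-zero : ∀ n → ∑ n (λ _ → 0#) ≈ 0#
  ∑-zero zero    = refl
  ∑-zero (suc n) = trans (+-cong (∑-zero n) (∑-zero n)) (+-identityˡ 0#)

  ∑-distrib-+ : ∀ n (f g : F₂^ n → Carrier) →
                ∑ n (λ v → f v + g v) ≈ ∑ n f + ∑ n g
  ∑-distrib-+ zero    f g = refl
  ∑-distrib-+ (suc n) f g = begin
    ∑ n (λ v → f (false ∷ v) + g (false ∷ v)) + ∑ n (λ v → f (true ∷ v) + g (true ∷ v))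
      ≈⟨ +-cong (∑-distrib-+ n _ _) (∑-distrib-+ n _ _) ⟩
    (a + b) + (c + d)   ≈⟨ +-assoc a b (c + d) ⟩
    a + (b + (c + d))   ≈⟨ +-congˡ (+-assoc b c d) ⟨
    a + ((b + c) + d)   ≈⟨ +-congˡ (+-congʳ (+-comm b c)) ⟩
    a + ((c + b) + d)   ≈⟨ +-congˡ (+-assoc c b d) ⟩
    a + (c + (b + d))   ≈⟨ +-assoc a c (b + d) ⟨
    (a + c) + (b + d)   ∎
    where
    a b c d : Carrier
    a = ∑ n (λ v → f (false ∷ v))
    b = ∑ n (λ v → g (false ∷ v))
    c = ∑ n (λ v → f (true ∷ v))
    d = ∑ n (λ v → g (true ∷ v))

  *-distribˡ-∑ : ∀ n x (f : F₂^ n → Carrier) → ∑ n (λ v → x * f v) ≈ x * ∑ n f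
  *-distribˡ-∑ zero    x f = refl
  *-distribˡ-∑ (suc n) x f =
    trans (+-cong (*-distribˡ-∑ n x _) (*-distribˡ-∑ n x _)) (sym (distribˡ x _ _))

  ∑-comm : ∀ m n (f : F₂^ m → F₂^ n → Carrier) →
           ∑ m (λ u → ∑ n (λ v → f u v)) ≈ ∑ n (λ v → ∑ m (λ u → f u v))
  ∑-comm zero    n f = refl
  ∑-comm (suc m) n f =
    trans (+-cong (∑-comm m n _) (∑-comm m n _)) (sym (∑-distrib-+ n _ _))

  ∑-𝟙≡ : ∀ n (w : F₂^ n) → ∑ n (λ v → 𝟙 (w ≟ᵛ v)) ≈ 1#
  ∑-𝟙≡ zero    []          = 𝟙-yes ([] ≟ᵛ []) _≡_.refl
  ∑-𝟙≡ (suc n) (false ∷ w) =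
    trans (+-cong (∑-𝟙≡ n w) (∑-zero n)) (+-identityʳ 1#)
  ∑-𝟙≡ (suc n) (true ∷ w)  =
    trans (+-cong (∑-zero n) (∑-𝟙≡ n w)) (+-identityˡ 1#)

  -- A random variable on F₂^n is represented by its law (all that H and d depend
  -- on, correlated variables included): Pr v is the
  -- probability that it takes the value v.
  record RandomVariable (n : ℕ) : Set where
    field
      Pr        : F₂^ n → Carrier
      Pr-nonneg : ∀ v → 0# ≤ Pr v
      Pr-total  : ∑[ v ∈F₂^ n ] Pr v ≈ 1#

  open RandomVariable public

  -- The test restricts the sum to the support.
  H : ∀ {n} → RandomVariable n → Carrier
  H {n} X = ∑[ x ∈F₂^ n ]
    (if does (Pr X x ≟ 0#) then 0# else - (Pr X x * log₂ (Pr X x)))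

  -- The law of X′ − Y′ for independent copies X′, Y′ of X, Y:
  -- Pr[X′ − Y′ = z] is the sum of Pr[X = x] Pr[Y = y] over pairs with x − y = z.
  _⊟_ : ∀ {n} → RandomVariable n → RandomVariable n → RandomVariable n
  _⊟_ {n} X Y = record
    { Pr        = λ z → ∑[ x ∈F₂^ n ] ∑[ y ∈F₂^ n ] (w x y * 𝟙 (x ⊖ y ≟ᵛ z))
    ; Pr-nonneg = λ z → ∑-nonneg n λ x → ∑-nonneg n λ y →
        *-nonneg (*-nonneg (Pr-nonneg X x) (Pr-nonneg Y y)) (𝟙-nonneg (x ⊖ y ≟ᵛ z))
    ; Pr-total  = begin
        ∑ n (λ z → ∑ n λ x → ∑ n λ y → w x y * 𝟙 (x ⊖ y ≟ᵛ z))
          ≈⟨ ∑-comm n n _ ⟩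
        ∑ n (λ x → ∑ n λ z → ∑ n λ y → w x y * 𝟙 (x ⊖ y ≟ᵛ z))
          ≈⟨ ∑-cong n (λ x → ∑-comm n n _) ⟩
        ∑ n (λ x → ∑ n λ y → ∑ n λ z → w x y * 𝟙 (x ⊖ y ≟ᵛ z))
          ≈⟨ ∑-cong n (λ x → ∑-cong n λ y → trans (*-distribˡ-∑ n (w x y) _)
               (trans (*-congˡ (∑-𝟙≡ n (x ⊖ y))) (*-identityʳ (w x y)))) ⟩
        ∑ n (λ x → ∑ n λ y → Pr X x * Pr Y y)
          ≈⟨ ∑-cong n (λ x → trans (*-distribˡ-∑ n (Pr X x) (Pr Y))
               (trans (*-congˡ (Pr-total Y)) (*-identityʳ (Pr X x)))) ⟩
        ∑ n (Pr X)
          ≈⟨ Pr-total X ⟩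
        1# ∎
    }
    where
    w : F₂^ n → F₂^ n → Carrier
    w x y = Pr X x * Pr Y y

  d[_⨾_] : ∀ {n} → RandomVariable n → RandomVariable n → Carrier
  d[ X ⨾ Y ] = H (X ⊟ Y) - ½ * (H X + H Y)

  module _ {n : ℕ} (V : Subspace n) where

    open Subspace V

    card : Carrier
    card = ∑[ v ∈F₂^ n ] 𝟙 (member? v)

    private
      term≤∑ : ∀ m {f : F₂^ m → Carrier} → (∀ v → 0# ≤ f v) → ∀ v → f v ≤ ∑ m f
      term≤∑ zero    0≤f []          = ≤.refl
      term≤∑ (suc m) 0≤f (false ∷ v) = ≤.trans
        (term≤∑ m (λ u → 0≤f (false ∷ u)) v)
        (x≤x+y _ (∑-nonneg m (λ u → 0≤f (true ∷ u))))
      term≤∑ (suc m) 0≤f (true ∷ v)  = ≤.trans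
        (term≤∑ m (λ u → 0≤f (true ∷ u)) v)
        (≤.trans (x≤x+y _ (∑-nonneg m (λ u → 0≤f (false ∷ u)))) (≤.reflexive (+-comm _ _)))

    1≤card : 1# ≤ card
    1≤card = ≤.trans (≤.reflexive (sym (𝟙-yes (member? 𝟎) 𝟎-mem)))
                     (term≤∑ n (λ v → 𝟙-nonneg (member? v)) 𝟎)

    card≉0 : ¬ (card ≈ 0#)
    card≉0 card≈0 = 0≉1 (≤.antisym 0≤1 (≤.trans 1≤card (≤.reflexive card≈0)))

    -- Pr[U = v] is 1/|V| for v in V and 0 otherwise.
    U : RandomVariable n
    U = record
      { Pr        = λ v → card ⁻¹ * 𝟙 (member? v)
      ; Pr-nonneg = λ v → *-nonneg (⁻¹-nonneg card≉0 (≤.trans 0≤1 1≤card)) (𝟙-nonneg (member? v))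
      ; Pr-total  = trans (*-distribˡ-∑ n (card ⁻¹) _)
                      (trans (*-comm (card ⁻¹) card) (*-inverseʳ card≉0))
      }

-- Fix K slightly above 8 and let (P , Q) nearly minimise K d[P ⨾ Q] + d[A ⨾ P] + d[B ⨾ Q].
-- Let X₁, X₃ ~ P and X₂, X₄ ~ Q be independent, with sum S.  The minimum is compared with
-- seven pairs: (X₁ + X₄ , X₂ + X₃) and (X₁ + X₃ , X₂ + X₄); the summands (X₁ , X₂),
-- conditioned on either of these pairs of sums; and, as in the Balog–Szemerédi–Gowers theorem,
-- two of U = X₁ + X₂, V = X₂ + X₃ and W = X₁ + X₃, made independent conditionally on the
-- third and S.  Shannon's inequalities bound the values of these pairs, and in a suitable
-- positive combination the joint entropies cancel, leaving (K − 8) d[P ⨾ Q] = O(ε) when (P , Q)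
-- is within ε of the minimum.  Since (B , A) has the value (K + 2) d[A ⨾ B], letting K → 8 gives
-- by compactness a pair with d[X ⨾ Y] = 0 and d[A ⨾ X] + d[B ⨾ Y] ≤ 10 d[A ⨾ B].  The equality
-- case of submodularity shows that X and Y are uniform on translates of one subspace V.
module Submission where

open import Defs
open import Algebra.Bundles using (RawRing)
import Algebra.Properties.CommutativeSemiring.Exp
import Algebra.Properties.Ring
import Algebra.Properties.Semiring.Mult
import Algebra.Solver.Ring
open import Algebra.Solver.Ring.AlmostCommutativeRing using (fromCommutativeRing; _-Raw-AlmostCommutative⟶_)
open import Data.Bool.Base using (Bool; true; false; _∧_; _∨_; not; T; if_then_else_)
import Data.Bool.Properties as Bool
open import Data.Empty using (⊥-elim)
open import Data.Integer.Base as ℤ using (ℤ; -[1+_]) renaming (+_ to pos)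
import Data.Integer.Properties as ℤ
open import Data.List.Base as List using (List; []; _∷_; _++_; map)
import Data.List.Properties as List
import Data.Maybe.Base as Maybe
open import Data.Nat.Base as ℕ using (ℕ; zero; suc; NonZero)
import Data.Nat.Properties as ℕ
open import Data.Product.Base using (_,_; proj₁; proj₂; ∃; _×_)
import Data.Sign.Base as Sign
open import Data.Sum.Base using (_⊎_; inj₁; inj₂)
open import Data.Unit.Base using (tt)
open import Data.Vec.Base as Vec using (Vec; []; _∷_; replicate)
import Data.Vec.Properties as Vec
open import Function.Base using (_∘_; id)
open import Function.Bundles using (Equivalence)
open import Relation.Binary.Bundles using (Poset)
import Relation.Binary.PropositionalEquality as ≡
open import Relation.Binary.PropositionalEquality using (_≡_)
import Relation.Binary.Reasoning.PartialOrder
import Relation.Binary.Reasoning.Setoid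
open import Relation.Nullary.Decidable using (Dec; does; yes; no; dec⇒maybe)
open import Relation.Nullary.Negation.Core using (¬_)

module OrderedField (ℝ : RealField) where

  open RealField ℝ

  module Solver where

    open Algebra.Properties.Ring ring
    open Algebra.Properties.Semiring.Mult semiring
    open import Relation.Binary.Reasoning.Setoid setoid

    embedℕ : ℕ → Carrier
    embedℕ 0             = 0#
    embedℕ 1             = 1#
    embedℕ (suc (suc n)) = 1# + embedℕ (suc n)

    embed : ℤ → Carrier
    embed (pos n)  = embedℕ n
    embed -[1+ n ] = - embedℕ (suc n)

    embedℕ-× : ∀ n → embedℕ n ≈ n ×ℕ 1#
    embedℕ-× 0             = refl
    embedℕ-× 1             = sym (+-identityʳ 1#)
    embedℕ-× (suc (suc n)) = +-congˡ (embedℕ-× (suc n))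

    embedℕ-+ : ∀ m n → embedℕ (m ℕ.+ n) ≈ embedℕ m + embedℕ n
    embedℕ-+ m n = trans (embedℕ-× (m ℕ.+ n)) (trans (×-homo-+ 1# m n)
      (sym (+-cong (embedℕ-× m) (embedℕ-× n))))

    embedℕ-* : ∀ m n → embedℕ (m ℕ.* n) ≈ embedℕ m * embedℕ n
    embedℕ-* m n = trans (embedℕ-× (m ℕ.* n)) (trans (×1-homo-* m n)
      (sym (*-cong (embedℕ-× m) (embedℕ-× n))))

    embed-neg : ∀ i → embed (ℤ.- i) ≈ - embed i
    embed-neg (pos zero)    = sym -0#≈0#
    embed-neg (pos (suc n)) = refl
    embed-neg -[1+ n ]      = sym (-‿involutive _)

    embed-⊖ : ∀ m n → embed (m ℤ.⊖ n) ≈ embedℕ m - embedℕ n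
    embed-⊖ m zero = begin
      embed (m ℤ.⊖ 0)          ≡⟨ ≡.cong embed (ℤ.⊖-≥ {m} {0} ℕ.z≤n) ⟩
      embedℕ m               ≈⟨ +-identityʳ _ ⟨
      embedℕ m + 0#          ≈⟨ +-congˡ -0#≈0# ⟨
      embedℕ m - embedℕ 0    ∎
    embed-⊖ zero    (suc n) = sym (+-identityˡ _)
    embed-⊖ (suc m) (suc n) = begin
      embed (suc m ℤ.⊖ suc n)                ≡⟨ ≡.cong embed (ℤ.[1+m]⊖[1+n]≡m⊖n m n) ⟩
      embed (m ℤ.⊖ n)                        ≈⟨ embed-⊖ m n ⟩
      embedℕ m - embedℕ n                  ≈⟨ +-congˡ (+-identityˡ _) ⟨
      embedℕ m + (0# - embedℕ n)           ≈⟨ +-congˡ (+-congʳ (-‿inverseʳ 1#)) ⟨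
      embedℕ m + (1# - 1# - embedℕ n)      ≈⟨ +-congˡ (+-assoc 1# (- 1#) _) ⟩
      embedℕ m + (1# + (- 1# - embedℕ n))  ≈⟨ +-assoc (embedℕ m) 1# _ ⟨
      embedℕ m + 1# + (- 1# - embedℕ n)    ≈⟨ +-cong (+-comm (embedℕ m) 1#) (-‿+-comm 1# (embedℕ n)) ⟩
      1# + embedℕ m - (1# + embedℕ n)      ≈⟨ +-cong (embedℕ-+ 1 m) (-‿cong (embedℕ-+ 1 n)) ⟨
      embedℕ (suc m) - embedℕ (suc n)      ∎

    embed-+ : ∀ i j → embed (i ℤ.+ j) ≈ embed i + embed j
    embed-+ (pos m)  (pos n)  = embedℕ-+ m n
    embed-+ (pos m)  -[1+ n ] = embed-⊖ m (suc n)
    embed-+ -[1+ m ] (pos n)  = trans (embed-⊖ n (suc m)) (+-comm _ _)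
    embed-+ -[1+ m ] -[1+ n ] = begin
      - embedℕ (suc (suc (m ℕ.+ n)))           ≡⟨ ≡.cong (λ k → - embedℕ (suc k)) (ℕ.+-suc m n) ⟨
      - embedℕ (suc m ℕ.+ suc n)               ≈⟨ -‿cong (embedℕ-+ (suc m) (suc n)) ⟩
      - (embedℕ (suc m) + embedℕ (suc n))      ≈⟨ -‿+-comm _ _ ⟨
      - embedℕ (suc m) - embedℕ (suc n)        ∎

    embed-◃⁻ : ∀ n → embed (Sign.- ℤ.◃ n) ≈ - embedℕ n
    embed-◃⁻ n = trans (reflexive (≡.cong embed (ℤ.-◃n≡-n n))) (embed-neg (pos n))

    embed-◃⁺ : ∀ n → embed (Sign.+ ℤ.◃ n) ≈ embedℕ n
    embed-◃⁺ n = reflexive (≡.cong embed (ℤ.+◃n≡+n n))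

    embed-* : ∀ i j → embed (i ℤ.* j) ≈ embed i * embed j
    embed-* (pos m)  (pos n)  = trans (embed-◃⁺ (m ℕ.* n)) (embedℕ-* m n)
    embed-* (pos m)  -[1+ n ] = trans (embed-◃⁻ (m ℕ.* suc n))
      (trans (-‿cong (embedℕ-* m (suc n))) (-‿distribʳ-* _ _))
    embed-* -[1+ m ] (pos n)  = trans (embed-◃⁻ (suc m ℕ.* n))
      (trans (-‿cong (embedℕ-* (suc m) n)) (-‿distribˡ-* _ _))
    embed-* -[1+ m ] -[1+ n ] = trans (embed-◃⁺ (suc m ℕ.* suc n))
      (trans (embedℕ-* (suc m) (suc n)) (trans (sym (-‿involutive _))
        (trans (-‿cong (-‿distribˡ-* _ _)) (-‿distribʳ-* _ _))))

    integerRing : RawRing _ _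
    integerRing = ℤ.+-*-rawRing

    morphism : integerRing -Raw-AlmostCommutative⟶ fromCommutativeRing commutativeRing
    morphism = record
      { ⟦_⟧    = embed
      ; +-homo = embed-+
      ; *-homo = embed-*
      ; -‿homo = embed-neg
      ; 0-homo = refl
      ; 1-homo = refl
      }

    open Algebra.Solver.Ring integerRing (fromCommutativeRing commutativeRing) morphism
      (λ i j → Maybe.map (λ i≡j → reflexive (≡.cong embed i≡j)) (dec⇒maybe (i ℤ.≟ j))) public

  open Solver public using (solve; _:+_; _:*_; _:-_; :-_; _:=_)

  :0 :1 : ∀ {n} → Solver.Polynomial n
  :0 = Solver.con (pos 0)
  :1 = Solver.con (pos 1)

  -- Numerals, unfolding to the value that the solver gives to its constants.
  # : ℕ → Carrier
  # = Solver.embedℕ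

  :# : ∀ {n} → ℕ → Solver.Polynomial n
  :# k = Solver.con (pos k)

  poset : Poset _ _ _
  poset = record { isPartialOrder = ≤.isPartialOrder }

  module ≤-Reasoning = Relation.Binary.Reasoning.PartialOrder poset

  infixl 6 _⟨+⟩_
  infixl 7 _⟨*⟩_

  _⟨+⟩_ : ∀ {a b c d} → a ≤ b → c ≤ d → a + c ≤ b + d
  _⟨+⟩_ {a} {b} {c} {d} a≤b c≤d = begin
    a + c  ≤⟨ +-monoˡ-≤ c a≤b ⟩
    b + c  ≈⟨ +-comm b c ⟩
    c + b  ≤⟨ +-monoˡ-≤ b c≤d ⟩
    d + b  ≈⟨ +-comm d b ⟩
    b + d  ∎
    where open ≤-Reasoning

  ≤-via : ∀ {a b c d} → b + c ≈ a + d → c ≤ d → a ≤ b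
  ≤-via {a} {b} {c} {d} eq c≤d = begin
    a              ≈⟨ solve 2 (λ a d → a := (a :+ d) :- d) refl a d ⟩
    (a + d) - d    ≈⟨ +-congʳ eq ⟨
    (b + c) - d    ≤⟨ ≤.refl {b} ⟨+⟩ c≤d ⟨+⟩ ≤.refl { - d} ⟩
    (b + d) - d    ≈⟨ solve 2 (λ b d → (b :+ d) :- d := b) refl b d ⟩
    b              ∎
    where open ≤-Reasoning

  ≤⇒0≤- : ∀ {x y} → x ≤ y → 0# ≤ y - x
  ≤⇒0≤- = ≤-via (solve 2 (λ x y → (y :- x) :+ x := :0 :+ y) refl _ _)

  -≤0⇒≤ : ∀ {x y} → x - y ≤ 0# → x ≤ y
  -≤0⇒≤ = ≤-via (solve 2 (λ x y → y :+ (x :- y) := x :+ :0) refl _ _)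

  neg-mono-≤ : ∀ {x y} → x ≤ y → - y ≤ - x
  neg-mono-≤ = ≤-via (solve 2 (λ x y → :- x :+ x := :- y :+ y) refl _ _)

  _⟨*⟩_ : ∀ {c a b} → 0# ≤ c → a ≤ b → c * a ≤ c * b
  _⟨*⟩_ 0≤c a≤b = ≤-via
    (solve 3 (λ c a b → c :* b :+ :0 := c :* a :+ c :* (b :- a)) refl _ _ _)
    (*-nonneg 0≤c (≤⇒0≤- a≤b))

  *-mono-≤ : ∀ {a b c d} → 0# ≤ a → 0# ≤ d → a ≤ b → c ≤ d → a * c ≤ b * d
  *-mono-≤ {a} {b} {c} {d} 0≤a 0≤d a≤b c≤d = begin
    a * c ≤⟨ 0≤a ⟨*⟩ c≤d ⟩
    a * d ≈⟨ *-comm a d ⟩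
    d * a ≤⟨ 0≤d ⟨*⟩ a≤b ⟩
    d * b ≈⟨ *-comm d b ⟩
    b * d ∎
    where open ≤-Reasoning

  <⇒≤ : ∀ {x y} → x < y → x ≤ y
  <⇒≤ {x} {y} x<y with ≤.total x y
  ... | inj₁ x≤y = x≤y
  ... | inj₂ y≤x = ⊥-elim (x<y y≤x)

  ≮⇒≥ : ∀ {x y} → ¬ (x < y) → y ≤ x
  ≮⇒≥ {x} {y} x≮y with y ≤? x
  ... | yes y≤x = y≤x
  ... | no x<y  = ⊥-elim (x≮y x<y)

  <-≤-trans : ∀ {x y z} → x < y → y ≤ z → x < z
  <-≤-trans x<y y≤z z≤x = x<y (≤.trans y≤z z≤x)

  <⇒≉ : ∀ {x} → 0# < x → ¬ (x ≈ 0#)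
  <⇒≉ 0<x x≈0 = 0<x (≤.reflexive x≈0)

  ≤∧≉⇒< : ∀ {x} → 0# ≤ x → ¬ (x ≈ 0#) → 0# < x
  ≤∧≉⇒< 0≤x x≉0 x≤0 = x≉0 (≤.antisym x≤0 0≤x)

  0<1 : 0# < 1#
  0<1 1≤0 = 0≉1 (≤.antisym 0≤1 1≤0)

  *-inverseˡ : ∀ {x} → ¬ (x ≈ 0#) → x ⁻¹ * x ≈ 1#
  *-inverseˡ {x} x≉0 = trans (*-comm (x ⁻¹) x) (*-inverseʳ x≉0)

  x*[x⁻¹*y]≈y : ∀ {x} → ¬ (x ≈ 0#) → ∀ {y} → x * (x ⁻¹ * y) ≈ y
  x*[x⁻¹*y]≈y x≉0 = trans (sym (*-assoc _ _ _)) (trans (*-congʳ (*-inverseʳ x≉0)) (*-identityˡ _))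

  y*x⁻¹*x≈y : ∀ {x} → ¬ (x ≈ 0#) → ∀ {y} → y * x ⁻¹ * x ≈ y
  y*x⁻¹*x≈y x≉0 = trans (*-assoc _ _ _) (trans (*-congˡ (*-inverseˡ x≉0)) (*-identityʳ _))

  x*[y*x⁻¹]≈y : ∀ {x} → ¬ (x ≈ 0#) → ∀ {y} → x * (y * x ⁻¹) ≈ y
  x*[y*x⁻¹]≈y x≉0 = trans (*-comm _ _) (y*x⁻¹*x≈y x≉0)

  ⁻¹-nonneg′ : ∀ {x} → 0# < x → 0# ≤ x ⁻¹
  ⁻¹-nonneg′ 0<x = ⁻¹-nonneg (<⇒≉ 0<x) (<⇒≤ 0<x)

  *-cancelˡ-≤ : ∀ {c a b} → 0# < c → c * a ≤ c * b → a ≤ b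
  *-cancelˡ-≤ {c} {a} {b} 0<c ca≤cb = begin
    a               ≈⟨ eq a ⟨
    c ⁻¹ * (c * a)  ≤⟨ ⁻¹-nonneg′ 0<c ⟨*⟩ ca≤cb ⟩
    c ⁻¹ * (c * b)  ≈⟨ eq b ⟩
    b               ∎
    where
    open ≤-Reasoning
    eq : ∀ x → c ⁻¹ * (c * x) ≈ x
    eq x = trans (sym (*-assoc _ _ _)) (trans (*-congʳ (*-inverseˡ (<⇒≉ 0<c))) (*-identityˡ x))

  *-pos : ∀ {x y} → 0# < x → 0# < y → 0# < x * y
  *-pos {x} {y} 0<x 0<y xy≤0 = 0<y (*-cancelˡ-≤ 0<x (≤.trans xy≤0 (≤.reflexive (sym (zeroʳ x)))))

  ⁻¹-pos : ∀ {x} → 0# < x → 0# < x ⁻¹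
  ⁻¹-pos {x} 0<x x⁻¹≤0 = 0<1 (begin
    1#         ≈⟨ *-inverseʳ (<⇒≉ 0<x) ⟨
    x * x ⁻¹   ≤⟨ <⇒≤ 0<x ⟨*⟩ x⁻¹≤0 ⟩
    x * 0#     ≈⟨ zeroʳ x ⟩
    0#         ∎)
    where open ≤-Reasoning

  +-pos : ∀ {x y} → 0# < x → 0# ≤ y → 0# < x + y
  +-pos 0<x 0≤y = <-≤-trans 0<x (x≤x+y _ 0≤y)

  fromℕ-nonneg : ∀ n → 0# ≤ fromℕ n
  fromℕ-nonneg zero    = ≤.refl
  fromℕ-nonneg (suc n) = +-nonneg 0≤1 (fromℕ-nonneg n)

  #-nonneg : ∀ n → 0# ≤ # n
  #-nonneg n = ≤.trans (fromℕ-nonneg n) (≤.reflexive (sym (Solver.embedℕ-× n)))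

  fromℕ-pos : ∀ n → 0# < fromℕ (suc n)
  fromℕ-pos n = +-pos 0<1 (fromℕ-nonneg n)

  open Algebra.Properties.Semiring.Mult semiring public using ()
    renaming (×-homo-+ to fromℕ-+′; ×1-homo-* to fromℕ-*)

  fromℕ-+ : ∀ m n → fromℕ (m ℕ.+ n) ≈ fromℕ m + fromℕ n
  fromℕ-+ = fromℕ-+′ 1#

  fromℕ-mono-≤ : ∀ {m n} → m ℕ.≤ n → fromℕ m ≤ fromℕ n
  fromℕ-mono-≤ {n = n} ℕ.z≤n = fromℕ-nonneg n
  fromℕ-mono-≤ (ℕ.s≤s m≤n)   = ≤.refl ⟨+⟩ fromℕ-mono-≤ m≤n

  archimedean : ∀ x → ∃ λ n → x ≤ fromℕ n
  archimedean x with excludedMiddle {∃ λ n → x ≤ fromℕ n}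
  ... | yes p = p
  ... | no ¬p = ⊥-elim (unbounded (proj₂ isSup (s - 1#) (λ s≤s-1 → 0<1
            (≤-via (solve 1 (λ s → :0 :+ s := :1 :+ (s :- :1)) refl s) s≤s-1))))
    where
    S : Carrier → Set
    S y = ∃ λ n → y ≈ fromℕ n
    s = sup S
    isSup : IsSup S s
    isSup = completeness S (0# , 0 , refl)
      (x , λ { y (n , y≈n) → ≤.trans (≤.reflexive y≈n) (<⇒≤ (λ x≤n → ¬p (n , x≤n))) })
    unbounded : ¬ ∃ λ y → S y × s - 1# < y
    unbounded (y , (n , y≈n) , s-1<y) = s-1<y (≤-via
      (solve 3 (λ s n y → (s :- :1) :+ (:1 :+ n :+ y) := y :+ (s :+ n)) refl _ _ _)
      (proj₁ isSup (fromℕ (suc n)) (suc n , refl) ⟨+⟩ ≤.reflexive y≈n))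

  ≤0-by-multiples : ∀ {x c} → (∀ n → fromℕ (suc n) * x ≤ c) → x ≤ 0#
  ≤0-by-multiples {x} {c} bound = ≮⇒≥ λ 0<x → let n , c/x≤n = archimedean (c * x ⁻¹) in
    0<x (≤-via (solve 2 (λ x n → :0 :+ (:1 :+ n) :* x := x :+ n :* x) refl x (fromℕ n))
      (≤.trans (bound n) (begin
        c               ≈⟨ *-identityʳ c ⟨
        c * 1#          ≈⟨ *-congˡ (*-inverseˡ (<⇒≉ 0<x)) ⟨
        c * (x ⁻¹ * x)  ≈⟨ *-assoc c (x ⁻¹) x ⟨
        c * x ⁻¹ * x    ≈⟨ *-comm _ x ⟩
        x * (c * x ⁻¹)  ≤⟨ <⇒≤ 0<x ⟨*⟩ c/x≤n ⟩
        x * fromℕ n     ≈⟨ *-comm x _ ⟩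
        fromℕ n * x     ∎)))
    where open ≤-Reasoning

  ≤0-by-small : ∀ {x c} → 0# ≤ c → (∀ ε → 0# < ε → x ≤ ε * c) → x ≤ 0#
  ≤0-by-small {x} {c} 0≤c bound = ≤0-by-multiples {c = c} λ n → let m = fromℕ (suc n) in begin
    m * x             ≤⟨ fromℕ-nonneg (suc n) ⟨*⟩ bound (m ⁻¹) (⁻¹-pos (fromℕ-pos n)) ⟩
    m * (m ⁻¹ * c)    ≈⟨ *-assoc m (m ⁻¹) c ⟨
    m * m ⁻¹ * c      ≈⟨ *-congʳ (*-inverseʳ (<⇒≉ (fromℕ-pos n))) ⟩
    1# * c            ≈⟨ *-identityˡ c ⟩
    c                 ∎
    where open ≤-Reasoning

module Logarithm (ℝ : RealField) where

  open RealField ℝ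
  open OrderedField ℝ
  open Algebra.Properties.CommutativeSemiring.Exp commutativeSemiring
    using (^-congˡ; ^-homo-*; ^-assocʳ; ^-distrib-*)

  module ≈-Reasoning = Relation.Binary.Reasoning.Setoid setoid

  2# : Carrier
  2# = fromℕ 2

  ^-pos : ∀ {x} n → 0# < x → 0# < x ^ n
  ^-pos zero    0<x = 0<1
  ^-pos (suc n) 0<x = *-pos 0<x (^-pos n 0<x)

  ^-nonneg : ∀ {x} n → 0# ≤ x → 0# ≤ x ^ n
  ^-nonneg zero    0≤x = 0≤1
  ^-nonneg (suc n) 0≤x = *-nonneg 0≤x (^-nonneg n 0≤x)

  ^-mono-≤ : ∀ {x y} n → 0# ≤ x → x ≤ y → x ^ n ≤ y ^ n
  ^-mono-≤ zero    0≤x x≤y = ≤.refl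
  ^-mono-≤ (suc n) 0≤x x≤y =
    *-mono-≤ 0≤x (^-nonneg n (≤.trans 0≤x x≤y)) x≤y (^-mono-≤ n 0≤x x≤y)

  1^n≈1 : ∀ n → 1# ^ n ≈ 1#
  1^n≈1 zero    = refl
  1^n≈1 (suc n) = trans (*-identityˡ _) (1^n≈1 n)

  bernoulli : ∀ {t} n → 0# ≤ t → 1# + fromℕ n * t ≤ (1# + t) ^ n
  bernoulli {t} zero 0≤t =
    ≤.reflexive (solve 1 (λ t → :1 :+ :0 :* t := :1) refl t)
  bernoulli {t} (suc n) 0≤t = begin
    1# + (1# + fromℕ n) * t
      ≤⟨ ≤-via (solve 2 (λ t n → ((:1 :+ t) :* (:1 :+ n :* t)) :+ :0
           := :1 :+ (:1 :+ n) :* t :+ n :* (t :* t)) refl t (fromℕ n))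
           (*-nonneg (fromℕ-nonneg n) (square-nonneg t)) ⟩
    (1# + t) * (1# + fromℕ n * t)
      ≤⟨ +-nonneg 0≤1 0≤t ⟨*⟩ bernoulli n 0≤t ⟩
    (1# + t) * (1# + t) ^ n ∎
    where open ≤-Reasoning

  0<2 : 0# < 2#
  0<2 = fromℕ-pos 1

  1≤2 : 1# ≤ 2#
  1≤2 = ≤-via (solve 0 (:1 :+ (:1 :+ :0) :+ :0 := :1 :+ :1) refl) 0≤1

  2^-mono : ∀ {m n} → m ℕ.≤ n → 2# ^ m ≤ 2# ^ n
  2^-mono {n = zero}  ℕ.z≤n = ≤.refl
  2^-mono {n = suc n} ℕ.z≤n = ≤.trans (2^-mono {n = n} ℕ.z≤n) (begin
    2# ^ n       ≈⟨ *-identityˡ _ ⟨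
    1# * 2# ^ n  ≤⟨ *-mono-≤ 0≤1 (^-nonneg n (<⇒≤ 0<2)) 1≤2 ≤.refl ⟩
    2# * 2# ^ n  ∎)
    where open ≤-Reasoning
  2^-mono (ℕ.s≤s m≤n) = <⇒≤ 0<2 ⟨*⟩ 2^-mono m≤n

  2^-reflects-≤ : ∀ {m n} → 2# ^ m ≤ 2# ^ n → m ℕ.≤ n
  2^-reflects-≤ {m} {n} le with m ℕ.≤? n
  ... | yes m≤n = m≤n
  ... | no m≰n  = ⊥-elim (^-pos n 0<2 (≤-via
          (solve 1 (λ x → :0 :+ (:1 :+ (:1 :+ :0)) :* x := x :+ x) refl _)
          (≤.trans (2^-mono (ℕ.≰⇒> m≰n)) le)))

  n≤2^n : ∀ n → fromℕ n ≤ 2# ^ n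
  n≤2^n n = begin
    fromℕ n            ≤⟨ ≤-via (solve 1 (λ n → (:1 :+ n :* :1) :+ :0 := n :+ :1) refl (fromℕ n)) 0≤1 ⟩
    1# + fromℕ n * 1#  ≤⟨ bernoulli n 0≤1 ⟩
    (1# + 1#) ^ n      ≈⟨ ^-congˡ n (+-congˡ (sym (+-identityʳ 1#))) ⟩
    2# ^ n             ∎
    where open ≤-Reasoning

  ≤2^ : ∀ x → ∃ λ n → x ≤ 2# ^ n
  ≤2^ x = let n , x≤n = archimedean x in n , ≤.trans x≤n (n≤2^n n)

  ≤2^*x : ∀ {x} → 0# < x → ∃ λ n → 1# ≤ x * 2# ^ n
  ≤2^*x {x} 0<x = let n , x⁻¹≤2^n = ≤2^ (x ⁻¹) in n , (begin
    1#          ≈⟨ *-inverseʳ (<⇒≉ 0<x) ⟨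
    x * x ⁻¹    ≤⟨ <⇒≤ 0<x ⟨*⟩ x⁻¹≤2^n ⟩
    x * 2# ^ n  ∎)
    where open ≤-Reasoning

  bracket : ∀ {z} → 0# < z → ∃ λ a → ∃ λ b → 2# ^ a ≤ z * 2# ^ b × z * 2# ^ b ≤ 2# ^ suc a
  bracket {z} 0<z = let b , lo = ≤2^*x 0<z ; c , hi = ≤2^ (z * 2# ^ b) ; a , p = descend b c lo hi in a , b , p
    where
    descend : ∀ b c → 1# ≤ z * 2# ^ b → z * 2# ^ b ≤ 2# ^ c →
              ∃ λ a → 2# ^ a ≤ z * 2# ^ b × z * 2# ^ b ≤ 2# ^ suc a
    descend b zero    lo hi = 0 , lo , ≤.trans hi (2^-mono {0} {1} ℕ.z≤n)
    descend b (suc c) lo hi with ≤.total (2# ^ c) (z * 2# ^ b)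
    ... | inj₁ le = c , le , hi
    ... | inj₂ ge = descend b c lo ge

  module _ {x : Carrier} (0<x : 0# < x) where

    private
      element-≤ : ∀ N a b → x ^ suc N * 2# ^ b ≤ 2# ^ a →
                  ∀ y → RationalBelowLog₂ x y → fromℕ (suc N) * y ≤ fromℕ a - fromℕ b
      element-≤ N a b hi y (a′ , b′ , k , y≈ , lo) = *-cancelˡ-≤ (fromℕ-pos k) (begin
        K * (M * y)                                ≈⟨ solve 3 (λ k m y → k :* (m :* y) := m :* (y :* k)) refl
            K M y ⟩
        M * (y * K)                                ≈⟨ *-congˡ y≈ ⟩
        M * (fromℕ a′ - fromℕ b′)                  ≤⟨ ≤-via
          (solve 6 (λ m k a b a′ b′ → k :* (a :- b) :+ (a′ :* m :+ b :* k) := m :* (a′ :- b′) :+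
              (a :* k :+ b′ :* m)) refl _ _ _ _ _ _)
          cleared ⟩
        K * (fromℕ a - fromℕ b)                    ∎)
        where
        open ≤-Reasoning
        K = fromℕ (suc k)
        M = fromℕ (suc N)
        nat : a′ ℕ.* suc N ℕ.+ b ℕ.* suc k ℕ.≤ a ℕ.* suc k ℕ.+ b′ ℕ.* suc N
        nat = 2^-reflects-≤ (begin
          2# ^ (a′ ℕ.* suc N ℕ.+ b ℕ.* suc k)
            ≈⟨ trans (^-homo-* 2# (a′ ℕ.* suc N) _)
                (sym (*-cong (^-assocʳ 2# a′ (suc N)) (^-assocʳ 2# b (suc k)))) ⟩
          (2# ^ a′) ^ suc N * (2# ^ b) ^ suc k
            ≤⟨ *-mono-≤ (^-nonneg (suc N) (^-nonneg a′ (<⇒≤ 0<2))) (^-nonneg (suc k) (^-nonneg b (<⇒≤ 0<2)))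
                 (^-mono-≤ (suc N) (^-nonneg a′ (<⇒≤ 0<2)) lo) ≤.refl ⟩
          (x ^ suc k * 2# ^ b′) ^ suc N * (2# ^ b) ^ suc k
            ≈⟨ *-congʳ (trans (^-distrib-* _ _ (suc N)) (*-congʳ (trans (^-assocʳ x (suc k) (suc N))
                 (trans (reflexive (≡.cong (x ^_) (ℕ.*-comm (suc k) (suc N))))
                     (sym (^-assocʳ x (suc N) (suc k))))))) ⟩
          (x ^ suc N) ^ suc k * (2# ^ b′) ^ suc N * (2# ^ b) ^ suc k
            ≈⟨ solve 3 (λ x y z → x :* y :* z := (x :* z) :* y) refl _ _ _ ⟩
          (x ^ suc N) ^ suc k * (2# ^ b) ^ suc k * (2# ^ b′) ^ suc N
            ≈⟨ *-congʳ (^-distrib-* _ _ (suc k)) ⟨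
          (x ^ suc N * 2# ^ b) ^ suc k * (2# ^ b′) ^ suc N
            ≤⟨ *-mono-≤ (^-nonneg (suc k) (*-nonneg (^-nonneg (suc N) (<⇒≤ 0<x)) (^-nonneg b (<⇒≤ 0<2))))
                 (^-nonneg (suc N) (^-nonneg b′ (<⇒≤ 0<2)))
                 (^-mono-≤ (suc k) (*-nonneg (^-nonneg (suc N) (<⇒≤ 0<x)) (^-nonneg b (<⇒≤ 0<2))) hi) ≤.refl ⟩
          (2# ^ a) ^ suc k * (2# ^ b′) ^ suc N
            ≈⟨ trans (^-homo-* 2# (a ℕ.* suc k) _) (sym (*-cong (^-assocʳ 2# a (suc k)) (^-assocʳ 2# b′ (suc N)))) ⟨
          2# ^ (a ℕ.* suc k ℕ.+ b′ ℕ.* suc N) ∎)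
        cleared : fromℕ a′ * M + fromℕ b * K ≤ fromℕ a * K + fromℕ b′ * M
        cleared = begin
          fromℕ a′ * M + fromℕ b * K                  ≈⟨ +-cong (fromℕ-* a′ (suc N)) (fromℕ-* b (suc k)) ⟨
          fromℕ (a′ ℕ.* suc N) + fromℕ (b ℕ.* suc k)  ≈⟨ fromℕ-+ (a′ ℕ.* suc N) _ ⟨
          fromℕ (a′ ℕ.* suc N ℕ.+ b ℕ.* suc k)        ≤⟨ fromℕ-mono-≤ nat ⟩
          fromℕ (a ℕ.* suc k ℕ.+ b′ ℕ.* suc N)        ≈⟨ fromℕ-+ (a ℕ.* suc k) _ ⟩
          fromℕ (a ℕ.* suc k) + fromℕ (b′ ℕ.* suc N)  ≈⟨ +-cong (fromℕ-* a (suc k)) (fromℕ-* b′ (suc N)) ⟩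
          fromℕ a * K + fromℕ b′ * M                  ∎

      element : ∀ N a b → 2# ^ a ≤ x ^ suc N * 2# ^ b →
                RationalBelowLog₂ x ((fromℕ a - fromℕ b) * fromℕ (suc N) ⁻¹)
      element N a b lo = a , b , N ,
        y*x⁻¹*x≈y (<⇒≉ (fromℕ-pos N)) , lo

      inhabited : ∃ (RationalBelowLog₂ x)
      inhabited = let a , b , lo , _ = bracket (^-pos 1 0<x) in _ , element 0 a b lo

      divide : ∀ N {y z} → fromℕ (suc N) * y ≤ z → y ≤ z * fromℕ (suc N) ⁻¹
      divide N {y} {z} My≤z = *-cancelˡ-≤ (fromℕ-pos N) (≤.trans My≤z (≤.reflexive (sym
        (x*[y*x⁻¹]≈y (<⇒≉ (fromℕ-pos N))))))

      log-isSup : IsSup (RationalBelowLog₂ x) (log₂ x)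
      log-isSup = let a , b , _ , hi = bracket (^-pos 1 0<x) in
        completeness _ inhabited (_ , λ y y∈ → divide 0 (element-≤ 0 (suc a) b hi y y∈))

    log-≤ : ∀ N a b → x ^ suc N * 2# ^ b ≤ 2# ^ a → fromℕ (suc N) * log₂ x ≤ fromℕ a - fromℕ b
    log-≤ N a b hi = ≮⇒≥ λ lt →
      let y , y∈ , q<y = proj₂ log-isSup ((fromℕ a - fromℕ b) * fromℕ (suc N) ⁻¹)
            (λ le → lt (≤.trans (fromℕ-nonneg (suc N) ⟨*⟩ le) (≤.reflexive
              (x*[y*x⁻¹]≈y (<⇒≉ (fromℕ-pos N))))))
      in q<y (divide N (element-≤ N a b hi y y∈))

    ≤-log : ∀ N a b → 2# ^ a ≤ x ^ suc N * 2# ^ b → fromℕ a - fromℕ b ≤ fromℕ (suc N) * log₂ x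
    ≤-log N a b lo = ≤.trans (≤.reflexive (sym
        (x*[y*x⁻¹]≈y (<⇒≉ (fromℕ-pos N)))))
      (fromℕ-nonneg (suc N) ⟨*⟩ proj₁ log-isSup _ (element N a b lo))

  log-mono-≤ : ∀ {x y} → 0# < x → x ≤ y → log₂ x ≤ log₂ y
  log-mono-≤ {x} {y} 0<x x≤y = -≤0⇒≤ ((≤0-by-multiples {c = 1#} λ N → let a , b , lo , hi = bracket (^-pos (suc N) 0<x) in
      ≤-via (solve 5 (λ m x y a b → :1 :+ (m :* x :+ (a :- b)) :=
                 m :* (x :- y) :+ ((:1 :+ a :- b) :+ m :* y)) refl _ _ _ (fromℕ a) (fromℕ b))
        (log-≤ 0<x N (suc a) b hi ⟨+⟩ ≤-log (<-≤-trans 0<x x≤y) N a b (begin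
          2# ^ a               ≤⟨ lo ⟩
          x ^ suc N * 2# ^ b   ≤⟨ *-mono-≤ (^-nonneg (suc N) (<⇒≤ 0<x)) (^-nonneg b (<⇒≤ 0<2))
                                    (^-mono-≤ (suc N) (<⇒≤ 0<x) x≤y) ≤.refl ⟩
          y ^ suc N * 2# ^ b   ∎))))
    where open ≤-Reasoning

  log-cong : ∀ {x y} → 0# < x → x ≈ y → log₂ x ≈ log₂ y
  log-cong 0<x x≈y = ≤.antisym (log-mono-≤ 0<x (≤.reflexive x≈y))
    (log-mono-≤ (<-≤-trans 0<x (≤.reflexive x≈y)) (≤.reflexive (sym x≈y)))

  log-* : ∀ {x y} → 0# < x → 0# < y → log₂ (x * y) ≈ log₂ x + log₂ y
  log-* {x} {y} 0<x 0<y = ≤.antisym (-≤0⇒≤ upper)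
                                    (-≤0⇒≤ lower)
    where
    open ≤-Reasoning
    0<xy = *-pos 0<x 0<y
    rearrange : ∀ N b b′ → (x ^ suc N * 2# ^ b) * (y ^ suc N * 2# ^ b′) ≈ (x * y) ^ suc N * 2# ^ (b ℕ.+ b′)
    rearrange N b b′ = trans (solve 4 (λ x y b b′ → (x :* b) :* (y :* b′) := (x :* y) :* (b :* b′)) refl _ _ _ _)
      (sym (*-cong (^-distrib-* x y (suc N)) (^-homo-* 2# b b′)))
    module Brackets (N : ℕ) where
      xs = bracket (^-pos (suc N) 0<x)
      ys = bracket (^-pos (suc N) 0<y)
      a  = proj₁ xs
      b  = proj₁ (proj₂ xs)
      a′ = proj₁ ys
      b′ = proj₁ (proj₂ ys)
      x-lo = proj₁ (proj₂ (proj₂ xs))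
      x-hi = proj₂ (proj₂ (proj₂ xs))
      y-lo = proj₁ (proj₂ (proj₂ ys))
      y-hi = proj₂ (proj₂ (proj₂ ys))
      xy-lo : 2# ^ (a ℕ.+ a′) ≤ (x * y) ^ suc N * 2# ^ (b ℕ.+ b′)
      xy-lo = begin
        2# ^ (a ℕ.+ a′)   ≈⟨ ^-homo-* 2# a a′ ⟩
        2# ^ a * 2# ^ a′  ≤⟨ *-mono-≤ (^-nonneg a (<⇒≤ 0<2))
          (*-nonneg (^-nonneg (suc N) (<⇒≤ 0<y)) (^-nonneg b′ (<⇒≤ 0<2))) x-lo y-lo ⟩
        _                 ≈⟨ rearrange N b b′ ⟩
        (x * y) ^ suc N * 2# ^ (b ℕ.+ b′) ∎
      xy-hi : (x * y) ^ suc N * 2# ^ (b ℕ.+ b′) ≤ 2# ^ (suc a ℕ.+ suc a′)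
      xy-hi = begin
        (x * y) ^ suc N * 2# ^ (b ℕ.+ b′)  ≈⟨ rearrange N b b′ ⟨
        _ ≤⟨ *-mono-≤ (*-nonneg (^-nonneg (suc N) (<⇒≤ 0<x)) (^-nonneg b (<⇒≤ 0<2)))
                (^-nonneg (suc a′) (<⇒≤ 0<2)) x-hi y-hi ⟩
        2# ^ suc a * 2# ^ suc a′   ≈⟨ ^-homo-* 2# (suc a) (suc a′) ⟨
        2# ^ (suc a ℕ.+ suc a′)    ∎
    upper : log₂ (x * y) - (log₂ x + log₂ y) ≤ 0#
    upper = ≤0-by-multiples {c = 2#} λ N → let open Brackets N in
      ≤-via (solve 8 (λ m p q r a b a′ b′ → (:1 :+ (:1 :+ :0)) :+ ((m :* p :+ (a :- b)) :+ (a′ :- b′))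
                 := m :* (p :- (q :+ r)) :+ ((((:1 :+ a) :+ (:1 :+ a′) :- (b :+ b′)) :+ m :* q) :+ m :* r))
               refl _ _ _ _ (fromℕ a) (fromℕ b) (fromℕ a′) (fromℕ b′))
        (≤.trans (log-≤ 0<xy N (suc a ℕ.+ suc a′) (b ℕ.+ b′) xy-hi)
           (≤.reflexive (+-cong (fromℕ-+ (suc a) (suc a′)) (-‿cong (fromℕ-+ b b′))))
         ⟨+⟩ ≤-log 0<x N a b x-lo ⟨+⟩ ≤-log 0<y N a′ b′ y-lo)
    lower : (log₂ x + log₂ y) - log₂ (x * y) ≤ 0#
    lower = ≤0-by-multiples {c = 2#} λ N → let open Brackets N in
      ≤-via (solve 8 (λ m p q r a b a′ b′ → (:1 :+ (:1 :+ :0)) :+ ((((a :+ a′) :- (b :+ b′)) :+ m :* q) :+ m :* r)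
                 := m :* ((q :+ r) :- p) :+ ((m :* p :+ ((:1 :+ a) :- b)) :+ ((:1 :+ a′) :- b′)))
               refl _ _ _ _ (fromℕ a) (fromℕ b) (fromℕ a′) (fromℕ b′))
        (≤.trans (≤.reflexive (sym (+-cong (fromℕ-+ a a′) (-‿cong (fromℕ-+ b b′)))))
           (≤-log 0<xy N (a ℕ.+ a′) (b ℕ.+ b′) xy-lo)
         ⟨+⟩ log-≤ 0<x N (suc a) b x-hi ⟨+⟩ log-≤ 0<y N (suc a′) b′ y-hi)

  log-1 : log₂ 1# ≈ 0#
  log-1 = begin
    log₂ 1#                            ≈⟨ solve 1 (λ x → x := (x :+ x) :- x) refl _ ⟩
    (log₂ 1# + log₂ 1#) - log₂ 1#      ≈⟨ +-congʳ (log-* 0<1 0<1) ⟨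
    log₂ (1# * 1#) - log₂ 1#           ≈⟨ +-congʳ (log-cong (*-pos 0<1 0<1) (*-identityˡ 1#)) ⟩
    log₂ 1# - log₂ 1#                  ≈⟨ -‿inverseʳ _ ⟩
    0#                                 ∎
    where open ≈-Reasoning

  log-⁻¹ : ∀ {x} → 0# < x → log₂ (x ⁻¹) ≈ - log₂ x
  log-⁻¹ {x} 0<x = begin
    log₂ (x ⁻¹)                        ≈⟨ solve 2 (λ x y → y := (x :+ y) :- x) refl (log₂ x) _ ⟩
    (log₂ x + log₂ (x ⁻¹)) - log₂ x    ≈⟨ +-congʳ (log-* 0<x (⁻¹-pos 0<x)) ⟨
    log₂ (x * x ⁻¹) - log₂ x           ≈⟨ +-congʳ (log-cong (*-pos 0<x (⁻¹-pos 0<x)) (*-inverseʳ (<⇒≉ 0<x))) ⟩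
    log₂ 1# - log₂ x                   ≈⟨ +-congʳ log-1 ⟩
    0# - log₂ x                        ≈⟨ +-identityˡ _ ⟩
    - log₂ x                           ∎
    where open ≈-Reasoning

  log-^ : ∀ {x} n → 0# < x → log₂ (x ^ n) ≈ fromℕ n * log₂ x
  log-^ zero 0<x = trans log-1 (sym (zeroˡ _))
  log-^ {x} (suc n) 0<x = begin
    log₂ (x * x ^ n)                ≈⟨ log-* 0<x (^-pos n 0<x) ⟩
    log₂ x + log₂ (x ^ n)           ≈⟨ +-congˡ (log-^ n 0<x) ⟩
    log₂ x + fromℕ n * log₂ x       ≈⟨ solve 2 (λ x n → x :+ n :* x := (:1 :+ n) :* x) refl _ _ ⟩
    fromℕ (suc n) * log₂ x          ∎
    where open ≈-Reasoning

  log-nonneg : ∀ {x} → 1# ≤ x → 0# ≤ log₂ x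
  log-nonneg 1≤x = ≤.trans (≤.reflexive (sym log-1)) (log-mono-≤ 0<1 1≤x)

  log-pos : ∀ {s} → 0# < s → 0# < log₂ (1# + s)
  log-pos {s} 0<s L≤0 with archimedean (s ⁻¹)
  ... | n , s⁻¹≤n = 0<1 (begin
    1#                              ≈⟨ solve 0 (:1 := :1 :+ :0 :- :0) refl ⟩
    fromℕ 1 - fromℕ 0               ≤⟨ ≤-log 0<1+s n 1 0 (begin
      2# ^ 1                          ≈⟨ solve 0 ((:1 :+ (:1 :+ :0)) :* :1 := :1 :+ :1) refl ⟩
      1# + 1#                         ≈⟨ +-congˡ (*-inverseˡ (<⇒≉ 0<s)) ⟨
      1# + s ⁻¹ * s                   ≤⟨ ≤.refl ⟨+⟩ *-mono-≤ (⁻¹-nonneg′ 0<s) (<⇒≤ 0<s)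
                                           (≤.trans s⁻¹≤n (fromℕ-mono-≤ (ℕ.n≤1+n n))) ≤.refl ⟩
      1# + fromℕ (suc n) * s          ≤⟨ bernoulli (suc n) (<⇒≤ 0<s) ⟩
      (1# + s) ^ suc n                ≈⟨ *-identityʳ _ ⟨
      (1# + s) ^ suc n * 2# ^ 0       ∎) ⟩
    fromℕ (suc n) * log₂ (1# + s)   ≤⟨ fromℕ-nonneg (suc n) ⟨*⟩ L≤0 ⟩
    fromℕ (suc n) * 0#              ≈⟨ zeroʳ _ ⟩
    0#                              ∎)
    where
    open ≤-Reasoning
    0<1+s = +-pos 0<1 (<⇒≤ 0<s)

  young : ∀ {m m′} n → 0# ≤ m → 0# ≤ m′ →
          fromℕ (suc n) * (m * m′ ^ n) ≤ m ^ suc n + fromℕ n * m′ ^ suc n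
  young {m} {m′} zero 0≤m 0≤m′ = ≤.reflexive
    (solve 2 (λ m m′ → (:1 :+ :0) :* (m :* :1) := m :* :1 :+ :0 :* (m′ :* :1)) refl m m′)
  young {m} {m′} (suc n) 0≤m 0≤m′ = ≤-via
    (solve 5 (λ m m′ a b n → (m :* a :+ (:1 :+ n) :* (m′ :* (m′ :* b))) :+ (m :* ((:1 :+ n) :* (m :* b)) :+ :0)
              := (:1 :+ (:1 :+ n)) :* (m :* (m′ :* b)) :+
                  (m :* (a :+ n :* (m′ :* b)) :+ (:1 :+ n) :* (b :* ((m :- m′) :* (m :- m′)))))
      refl m m′ (m ^ suc n) (m′ ^ n) (fromℕ n))
    ((0≤m ⟨*⟩ young n 0≤m 0≤m′) ⟨+⟩ *-nonneg (fromℕ-nonneg (suc n))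
        (*-nonneg (^-nonneg n 0≤m′) (square-nonneg (m - m′))))

  amgm : ∀ {a b m} p q → 0# ≤ a → 0# ≤ b → 0# ≤ m →
         fromℕ (p ℕ.+ suc q) * m ≈ fromℕ p * a + fromℕ (suc q) * b →
         a ^ p * b ^ suc q ≤ m ^ (p ℕ.+ suc q)
  amgm {a} {b} {m} zero q 0≤a 0≤b 0≤m mean = begin
    1# * b ^ suc q  ≈⟨ *-identityˡ _ ⟩
    b ^ suc q       ≤⟨ ^-mono-≤ (suc q) 0≤b (*-cancelˡ-≤ (fromℕ-pos q) (≤.reflexive
      (trans (solve 3 (λ a q b → q :* b := :0 :* a :+ q :* b) refl a _ b) (sym mean)))) ⟩
    m ^ suc q       ∎
    where open ≤-Reasoning
  amgm {a} {b} {m} (suc p) q 0≤a 0≤b 0≤m mean = begin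
    a * a ^ p * b ^ suc q        ≈⟨ *-assoc _ _ _ ⟩
    a * (a ^ p * b ^ suc q)      ≤⟨ 0≤a ⟨*⟩ amgm p q 0≤a 0≤b 0≤m′ mean′ ⟩
    a * m′ ^ N                   ≤⟨ ≤-via rearrange (young N 0≤m 0≤m′) ⟩
    m ^ suc N                    ∎
    where
    open ≤-Reasoning
    N = p ℕ.+ suc q
    0<N : 0# < fromℕ N
    0<N = ≡.subst (λ k → 0# < fromℕ k) (≡.sym (ℕ.+-suc p q)) (fromℕ-pos (p ℕ.+ q))
    sum = fromℕ p * a + fromℕ (suc q) * b
    m′ = fromℕ N ⁻¹ * sum
    0≤m′ : 0# ≤ m′
    0≤m′ = *-nonneg (⁻¹-nonneg′ 0<N) (+-nonneg (*-nonneg (fromℕ-nonneg p) 0≤a)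
        (*-nonneg (fromℕ-nonneg (suc q)) 0≤b))
    mean′ : fromℕ N * m′ ≈ sum
    mean′ = x*[x⁻¹*y]≈y (<⇒≉ 0<N)
    total : fromℕ (suc N) * m ≈ a + fromℕ N * m′
    total = trans mean (trans (solve 3 (λ a p s → (:1 :+ p) :* a :+ s := a :+ (p :* a :+ s)) refl a (fromℕ p) _)
      (+-congˡ (sym mean′)))
    rearrange : m ^ suc N + fromℕ (suc N) * (m * m′ ^ N) ≈ a * m′ ^ N + (m ^ suc N + fromℕ N * m′ ^ suc N)
    rearrange = trans (+-congˡ (trans (sym (*-assoc _ _ _)) (*-congʳ total)))
      (solve 5 (λ a n m′ x M → M :+ (a :+ n :* m′) :* x := a :* x :+ (M :+ n :* (m′ :* x))) refl a (fromℕ N)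
          m′ (m′ ^ N) (m ^ suc N))

  ceiling : ∀ {x} → 0# ≤ x → ∃ λ q → x ≤ fromℕ q × fromℕ q ≤ x + 1#
  ceiling {x} 0≤x = let n , x≤n = archimedean x in descend n x≤n
    where
    descend : ∀ n → x ≤ fromℕ n → ∃ λ q → x ≤ fromℕ q × fromℕ q ≤ x + 1#
    descend zero    x≤0 = 0 , x≤0 , +-nonneg 0≤x 0≤1
    descend (suc n) x≤1+n with ≤.total (fromℕ n) x
    ... | inj₁ n≤x = suc n , x≤1+n , ≤-via (solve 2 (λ x n → (x :+ :1) :+ n := (:1 :+ n) :+ x) refl _ _) n≤x
    ... | inj₂ x≤n = descend n x≤n

  -- Concavity of the logarithm across 1, from the weighted AM-GM inequality with
  -- weights P and Q for the points 1 + t and 1 / (1 + u).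
  secant-slopes : ∀ {t u} → 0# < t → 0# < u → u * log₂ (1# + t) ≤ t * ((1# + u) * log₂ (1# + u))
  secant-slopes {t} {u} 0<t 0<u = -≤0⇒≤ ((≤0-by-multiples {c = (1# + 1#) * u * L₂} bound))
    where
    open ≤-Reasoning
    0<1+t = +-pos 0<1 (<⇒≤ 0<t)
    0<1+u = +-pos 0<1 (<⇒≤ 0<u)
    L₁ = log₂ (1# + t)
    L₂ = log₂ (1# + u)
    0≤L₂ : 0# ≤ L₂
    0≤L₂ = <⇒≤ (log-pos 0<u)
    b = (1# + u) ⁻¹
    0<b = ⁻¹-pos 0<1+u
    bound : ∀ n → fromℕ (suc n) * (u * L₁ - t * ((1# + u) * L₂)) ≤ (1# + 1#) * u * L₂
    bound n = ≤-via
      (solve 7 (λ P Q u L₁ L₂ x y → (:1 :+ :1) :* u :* L₂ :+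
          (u :* (P :* L₁ :+ Q :* (:- L₂)) :+ L₂ :* (u :* Q) :+ L₂ :* (u :* x))
                 := P :* (u :* L₁ :- y) :+ (u :* :0 :+ L₂ :* (u :* ((:1 :+ :1) :+ x)) :+ P :* y))
             refl P Q u L₁ L₂ x (t * ((1# + u) * L₂)))
      ((<⇒≤ 0<u ⟨*⟩ logs) ⟨+⟩ (0≤L₂ ⟨*⟩ (<⇒≤ 0<u ⟨*⟩ Q≤x+2)) ⟨+⟩ ≤.reflexive (begin-equality
        L₂ * (u * x)                    ≈⟨ *-congˡ ux≈ ⟩
        L₂ * (P * (t * (1# + u)))       ≈⟨ solve 4 (λ L₂ P t u → L₂ :* (P :* (t :* (:1 :+ u))) := P :*
            (t :* ((:1 :+ u) :* L₂))) refl L₂ P t u ⟩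
        P * (t * ((1# + u) * L₂))       ∎))
      where
      P = fromℕ (suc n)
      x = u ⁻¹ * (P * (t * (1# + u)))
      ux≈ : u * x ≈ P * (t * (1# + u))
      ux≈ = x*[x⁻¹*y]≈y (<⇒≉ 0<u)
      0≤x : 0# ≤ x
      0≤x = *-nonneg (⁻¹-nonneg′ 0<u) (*-nonneg (fromℕ-nonneg (suc n)) (*-nonneg (<⇒≤ 0<t) (<⇒≤ 0<1+u)))
      ceil = ceiling 0≤x
      q = proj₁ ceil
      Q = fromℕ (suc q)
      x≤Q : x ≤ Q
      x≤Q = ≤.trans (proj₁ (proj₂ ceil)) (fromℕ-mono-≤ (ℕ.n≤1+n q))
      Q≤x+2 : Q ≤ (1# + 1#) + x
      Q≤x+2 = ≤-via (solve 2 (λ x q → ((:1 :+ :1) :+ x) :+ q := (:1 :+ q) :+ (x :+ :1)) refl x (fromℕ q))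
          (proj₂ (proj₂ ceil))
      N = suc n ℕ.+ suc q
      0<N : 0# < fromℕ N
      0<N = fromℕ-pos (n ℕ.+ suc q)
      sum = P * (1# + t) + Q * b
      m = fromℕ N ⁻¹ * sum
      mean : fromℕ N * m ≈ sum
      mean = x*[x⁻¹*y]≈y (<⇒≉ 0<N)
      sum≤N : sum ≤ fromℕ N
      sum≤N = *-cancelˡ-≤ 0<1+u (begin
        (1# + u) * sum                                   ≈⟨ solve 5
            (λ P t Q b u → (:1 :+ u) :* (P :* (:1 :+ t) :+ Q :* b)
             := (:1 :+ u) :* P :+ P :* (t :* (:1 :+ u)) :+ Q :* ((:1 :+ u) :* b)) refl P t Q b u ⟩
        (1# + u) * P + P * (t * (1# + u)) + Q * ((1# + u) * b) ≈⟨ +-cong (+-congˡ (sym ux≈))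
            (*-congˡ (*-inverseʳ (<⇒≉ 0<1+u))) ⟩
        (1# + u) * P + u * x + Q * 1#                    ≤⟨ ≤.refl ⟨+⟩ (<⇒≤ 0<u ⟨*⟩ x≤Q) ⟨+⟩ ≤.refl ⟩
        (1# + u) * P + u * Q + Q * 1#                    ≈⟨ solve 3
            (λ u P Q → (:1 :+ u) :* P :+ u :* Q :+ Q :* :1 := (:1 :+ u) :* (P :+ Q)) refl u P Q ⟩
        (1# + u) * (P + Q)                               ≈⟨ *-congˡ (fromℕ-+ (suc n) (suc q)) ⟨
        (1# + u) * fromℕ N ∎)
      m≤1 : m ≤ 1#
      m≤1 = *-cancelˡ-≤ 0<N (≤.trans (≤.reflexive mean) (≤.trans sum≤N (≤.reflexive (sym (*-identityʳ _)))))
      0≤m : 0# ≤ m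
      0≤m = *-nonneg (⁻¹-nonneg′ 0<N) (+-nonneg (*-nonneg (fromℕ-nonneg (suc n)) (<⇒≤ 0<1+t))
          (*-nonneg (fromℕ-nonneg (suc q)) (<⇒≤ 0<b)))
      logs : P * L₁ + Q * (- L₂) ≤ 0#
      logs = begin
        P * L₁ + Q * (- L₂)   ≈⟨ +-cong (log-^ (suc n) 0<1+t) (trans (log-^ (suc q) 0<b) (*-congˡ (log-⁻¹ 0<1+u))) ⟨
        log₂ ((1# + t) ^ suc n) + log₂ (b ^ suc q)   ≈⟨ log-* (^-pos (suc n) 0<1+t) (^-pos (suc q) 0<b) ⟨
        log₂ ((1# + t) ^ suc n * b ^ suc q)          ≤⟨ log-mono-≤ (*-pos (^-pos (suc n) 0<1+t) (^-pos (suc q) 0<b))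
           (≤.trans (amgm (suc n) q (<⇒≤ 0<1+t) (<⇒≤ 0<b) 0≤m mean)
               (≤.trans (^-mono-≤ N 0≤m m≤1) (≤.reflexive (1^n≈1 N)))) ⟩
        log₂ 1#   ≈⟨ log-1 ⟩
        0#        ∎

  private
    Slope : Carrier → Set
    Slope s = ∃ λ t → 0# < t × s * t ≈ log₂ (1# + t)

    slope-≤ : ∀ {u} → 0# < u → ∀ s → Slope s → u * s ≤ (1# + u) * log₂ (1# + u)
    slope-≤ {u} 0<u s (t , 0<t , st≈) = *-cancelˡ-≤ 0<t (begin
      t * (u * s)            ≈⟨ solve 3 (λ t u s → t :* (u :* s) := u :* (s :* t)) refl t u s ⟩
      u * (s * t)            ≈⟨ *-congˡ st≈ ⟩
      u * log₂ (1# + t)      ≤⟨ secant-slopes 0<t 0<u ⟩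
      t * ((1# + u) * log₂ (1# + u)) ∎)
      where open ≤-Reasoning

    slope-at : ∀ {t} → 0# < t → Slope (log₂ (1# + t) * t ⁻¹)
    slope-at 0<t = _ , 0<t , y*x⁻¹*x≈y (<⇒≉ 0<t)

  log₂e : Carrier
  log₂e = sup Slope

  private
    log₂e-isSup : IsSup Slope log₂e
    log₂e-isSup = completeness Slope (_ , slope-at 0<1)
      ((1# + 1#) * log₂ (1# + 1#) , λ s s∈ → ≤.trans (≤.reflexive (sym (*-identityˡ s))) (slope-≤ 0<1 s s∈))

    tangent-above : ∀ {t} → 0# < t → log₂ (1# + t) ≤ log₂e * t
    tangent-above {t} 0<t = begin
      log₂ (1# + t)                  ≈⟨ proj₂ (proj₂ (slope-at 0<t)) ⟨
      (log₂ (1# + t) * t ⁻¹) * t     ≤⟨ *-mono-≤ (*-nonneg (<⇒≤ (log-pos 0<t)) (⁻¹-nonneg′ 0<t)) (<⇒≤ 0<t)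
          (proj₁ log₂e-isSup _ (slope-at 0<t)) ≤.refl ⟩
      log₂e * t  ∎
      where open ≤-Reasoning

    tangent-below : ∀ {u} → 0# < u → u * log₂e ≤ (1# + u) * log₂ (1# + u)
    tangent-below {u} 0<u = ≮⇒≥ λ lt →
      let s , s∈ , r<s = proj₂ log₂e-isSup (u ⁻¹ * R) (λ le → lt (≤.trans (<⇒≤ 0<u ⟨*⟩ le) (≤.reflexive uu⁻¹R≈R)))
      in r<s (*-cancelˡ-≤ 0<u (≤.trans (slope-≤ 0<u s s∈) (≤.reflexive (sym uu⁻¹R≈R))))
      where
      R = (1# + u) * log₂ (1# + u)
      uu⁻¹R≈R : u * (u ⁻¹ * R) ≈ R
      uu⁻¹R≈R = x*[x⁻¹*y]≈y (<⇒≉ 0<u)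

  log₂e-nonneg : 0# ≤ log₂e
  log₂e-nonneg = ≤.trans (<⇒≤ (log-pos 0<1)) (≤.trans (tangent-above 0<1) (≤.reflexive (*-identityʳ _)))

  log-tangent : ∀ {x} → 0# < x → log₂ x ≤ log₂e * (x - 1#)
  log-tangent {x} 0<x with x ≤? 1#
  ... | no 1<x = ≤.trans (≤.reflexive (log-cong 0<x x≈)) (tangent-above 0<x-1)
    where
    x≈ : x ≈ 1# + (x - 1#)
    x≈ = solve 1 (λ x → x := :1 :+ (x :- :1)) refl x
    0<x-1 : 0# < x - 1#
    0<x-1 le = 1<x (≤-via (solve 1 (λ x → :1 :+ (x :- :1) := x :+ :0) refl x) le)
  ... | yes x≤1 with x ≟ 1#
  ...   | yes x≈1 = ≤.reflexive (trans (log-cong 0<x x≈1)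
      (trans log-1 (sym (trans (*-congˡ (trans (+-congʳ x≈1) (-‿inverseʳ _))) (zeroʳ _)))))
  ...   | no x≉1 = ≤-via (solve 3 (λ c L x → c :* (x :- :1) :+ (:1 :- x) :* c := L :+ :- L) refl log₂e
      (log₂ x) x) (begin
    (1# - x) * log₂e                         ≈⟨ *-congʳ (+-congʳ (*-inverseʳ (<⇒≉ 0<x))) ⟨
    (x * x ⁻¹ - x) * log₂e                   ≈⟨ solve 3
        (λ x y c → (x :* y :- x) :* c := x :* ((y :- :1) :* c)) refl x (x ⁻¹) log₂e ⟩
    x * ((x ⁻¹ - 1#) * log₂e)                ≤⟨ <⇒≤ 0<x ⟨*⟩ tangent-below 0<u ⟩
    x * ((1# + u) * log₂ (1# + u))           ≈⟨ *-congˡ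
        (*-cong 1+u≈ (trans (log-cong (+-pos 0<1 (<⇒≤ 0<u)) 1+u≈) (log-⁻¹ 0<x))) ⟩
    x * (x ⁻¹ * - log₂ x)                    ≈⟨ x*[x⁻¹*y]≈y (<⇒≉ 0<x) ⟩
    - log₂ x                                 ∎)
    where
    open ≤-Reasoning
    u = x ⁻¹ - 1#
    1+u≈ : 1# + u ≈ x ⁻¹
    1+u≈ = solve 1 (λ y → :1 :+ (y :- :1) := y) refl _
    0<u : 0# < u
    0<u u≤0 = x≉1 (≤.antisym x≤1 (begin
      1#         ≈⟨ *-inverseʳ (<⇒≉ 0<x) ⟨
      x * x ⁻¹   ≤⟨ <⇒≤ 0<x ⟨*⟩ ≤-via (solve 1 (λ y → :1 :+ (y :- :1) := y :+ :0) refl _) u≤0 ⟩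
      x * 1#     ≈⟨ *-identityʳ x ⟩
      x          ∎))

  -- The tangent at the midpoint z of 1 and x; z² exceeds x by the factor 1 + s.
  log-tangent-strict : ∀ {x} → 0# < x → ¬ (x ≈ 1#) → log₂ x < log₂e * (x - 1#)
  log-tangent-strict {x} 0<x x≉1 le = log-pos 0<s (≤-via
      (solve 5 (λ S L Z c x → :0 :+ (c :* (x :- :1) :+ (L :+ S :+ (Z :+ Z)))
                  := S :+ (L :+ (Z :+ Z :+ c :* (x :- :1)))) refl (log₂ (1# + s)) (log₂ x) (log₂ z) log₂e x)
      (le ⟨+⟩ (≤.reflexive (sym logs) ⟨+⟩ bound)))
    where
    open ≤-Reasoning
    z = ½ * (1# + x)
    w = ½ * (x - 1#)
    s = w * w * x ⁻¹
    2½≈1 : 2# * ½ ≈ 1#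
    2½≈1 = *-inverseʳ (<⇒≉ 0<2)
    0<½ = ⁻¹-pos 0<2
    0<z : 0# < z
    0<z = *-pos 0<½ (+-pos 0<1 (<⇒≤ 0<x))
    w≉0 : ¬ (w ≈ 0#)
    w≉0 w≈0 = x≉1 (trans (solve 1 (λ x → x := :1 :* (x :- :1) :+ :1) refl x)
      (trans (+-congʳ (trans (*-congʳ (sym 2½≈1)) (trans (*-assoc _ _ _) (trans (*-congˡ w≈0) (zeroʳ _)))))
          (+-identityˡ _)))
    0<w² : 0# < w * w
    0<w² = ≤∧≉⇒< (square-nonneg w) w²≉0
      where
      w²≉0 : ¬ (w * w ≈ 0#)
      w²≉0 w²≈0 = w≉0 (trans (sym (trans (*-congʳ (*-inverseʳ w≉0)) (*-identityˡ w)))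
        (trans (solve 2 (λ w v → w :* v :* w := v :* (w :* w)) refl w (w ⁻¹)) (trans (*-congˡ w²≈0) (zeroʳ _))))
    0<s : 0# < s
    0<s = *-pos 0<w² (⁻¹-pos 0<x)
    z²≈ : z * z ≈ x * (1# + s)
    z²≈ = begin-equality
      z * z                              ≈⟨ solve 2 (λ h x → h :* (:1 :+ x) :* (h :* (:1 :+ x))
          := ((:1 :+ (:1 :+ :0)) :* h) :* ((:1 :+ (:1 :+ :0)) :* h) :* x :+ h :* (x :- :1) :*
              (h :* (x :- :1))) refl ½ x ⟩
      (2# * ½) * (2# * ½) * x + w * w    ≈⟨ +-congʳ
          (trans (*-congʳ (trans (*-cong 2½≈1 2½≈1) (*-identityˡ 1#))) (*-identityˡ x)) ⟩
      x + w * w                          ≈⟨ +-congˡ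
          (trans (sym (*-identityʳ _)) (trans (*-congˡ (sym (*-inverseʳ (<⇒≉ 0<x))))
                                              (solve 3 (λ v x y → v :* (x :* y) := x :* (v :* y)) refl (w * w)
                                                  x (x ⁻¹)))) ⟩
      x + x * s                          ≈⟨ solve 2 (λ x s → x :+ x :* s := x :* (:1 :+ s)) refl x s ⟩
      x * (1# + s)                       ∎
    logs : log₂ z + log₂ z ≈ log₂ x + log₂ (1# + s)
    logs = trans (sym (log-* 0<z 0<z)) (trans (log-cong (*-pos 0<z 0<z) z²≈) (log-* 0<x (+-pos 0<1 (<⇒≤ 0<s))))
    bound : log₂ z + log₂ z ≤ log₂e * (x - 1#)
    bound = begin
      log₂ z + log₂ z                                ≤⟨ log-tangent 0<z ⟨+⟩ log-tangent 0<z ⟩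
      log₂e * (z - 1#) + log₂e * (z - 1#)            ≈⟨ solve 3
          (λ c h x → c :* (h :* (:1 :+ x) :- :1) :+ c :* (h :* (:1 :+ x) :- :1)
           := c :* (((:1 :+ (:1 :+ :0)) :* h) :* (:1 :+ x) :- (:1 :+ :1))) refl log₂e ½ x ⟩
      log₂e * ((2# * ½) * (1# + x) - (1# + 1#))      ≈⟨ *-congˡ (+-congʳ (trans (*-congʳ 2½≈1) (*-identityˡ _))) ⟩
      log₂e * ((1# + x) - (1# + 1#))                 ≈⟨ *-congˡ
          (solve 1 (λ x → (:1 :+ x) :- (:1 :+ :1) := x :- :1) refl x) ⟩
      log₂e * (x - 1#)                               ∎

module FiniteProbability (ℝ : RealField) where

  open RealField ℝ
  open OrderedField ℝ
  open Logarithm ℝ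
  open Entropy ℝ hiding (H)

  𝟏[_] : Set → Carrier
  𝟏[ P ] = 𝟙 (excludedMiddle {P})

  module _ {P : Set} where

    𝟏-nonneg : 0# ≤ 𝟏[ P ]
    𝟏-nonneg = 𝟙-nonneg (excludedMiddle {P})

    𝟏-yes : P → 𝟏[ P ] ≈ 1#
    𝟏-yes p with excludedMiddle {P}
    ... | yes _ = refl
    ... | no ¬p = ⊥-elim (¬p p)

    𝟏-no : ¬ P → 𝟏[ P ] ≈ 0#
    𝟏-no ¬p with excludedMiddle {P}
    ... | yes p = ⊥-elim (¬p p)
    ... | no _  = refl

    𝟏≈𝟙 : (P? : Dec P) → 𝟏[ P ] ≈ 𝟙 P?
    𝟏≈𝟙 (yes p) = 𝟏-yes p
    𝟏≈𝟙 (no ¬p) = 𝟏-no ¬p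

    𝟏-*-cong : ∀ {x y} → (P → x ≈ y) → 𝟏[ P ] * x ≈ 𝟏[ P ] * y
    𝟏-*-cong x≈y with excludedMiddle {P}
    ... | yes p = *-congˡ (x≈y p)
    ... | no _  = trans (zeroˡ _) (sym (zeroˡ _))

    𝟏≤1 : 𝟏[ P ] ≤ 1#
    𝟏≤1 with excludedMiddle {P}
    ... | yes _ = ≤.refl
    ... | no _  = 0≤1

  𝟏-mono : ∀ {P Q : Set} → (P → Q) → 𝟏[ P ] ≤ 𝟏[ Q ]
  𝟏-mono {P} p⇒q with excludedMiddle {P}
  ... | yes p = ≤.reflexive (sym (𝟏-yes (p⇒q p)))
  ... | no _  = 𝟏-nonneg

  𝟏-cong : ∀ {P Q : Set} → (P → Q) → (Q → P) → 𝟏[ P ] ≈ 𝟏[ Q ]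
  𝟏-cong p⇒q q⇒p = ≤.antisym (𝟏-mono p⇒q) (𝟏-mono q⇒p)

  𝟏-× : ∀ {P Q : Set} → 𝟏[ P × Q ] ≈ 𝟏[ P ] * 𝟏[ Q ]
  𝟏-× {P} {Q} = by-cases (excludedMiddle {P})
    where
    by-cases : Dec P → 𝟏[ P × Q ] ≈ 𝟏[ P ] * 𝟏[ Q ]
    by-cases (yes p) = trans (𝟏-cong proj₂ (p ,_)) (trans (sym (*-identityˡ _)) (*-congʳ (sym (𝟏-yes p))))
    by-cases (no ¬p) = trans (𝟏-no (¬p ∘ proj₁)) (trans (sym (zeroˡ _)) (*-congʳ (sym (𝟏-no ¬p))))

  infixr 6 _▵_
  _▵_ : {S T U : Set} → (S → T) → (S → U) → S → T × U
  (f ▵ g) s = f s , g s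

  -- A finite set, given by its summation functional.
  record Finite : Set₁ where
    field
      Element   : Set
      sum       : (Element → Carrier) → Carrier
      sum-cong  : ∀ {f g} → (∀ t → f t ≈ g t) → sum f ≈ sum g
      sum-+     : ∀ f g → sum (λ t → f t + g t) ≈ sum f + sum g
      sum-*ˡ    : ∀ c f → sum (λ t → c * f t) ≈ c * sum f
      sum-≥0    : ∀ {f} → (∀ t → 0# ≤ f t) → 0# ≤ sum f
      sum-δ     : ∀ u → sum (λ t → 𝟏[ u ≡ t ]) ≈ 1#
      sum-swap  : ∀ {I : Set} (L : (I → Carrier) → Carrier) →
                  (∀ {f g} → (∀ i → f i ≈ g i) → L f ≈ L g) →
                  (∀ f g → L (λ i → f i + g i) ≈ L f + L g) →
                  ∀ (f : Element → I → Carrier) → sum (λ t → L (f t)) ≈ L (λ i → sum (λ t → f t i))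

    sum-*ʳ : ∀ f c → sum (λ t → f t * c) ≈ sum f * c
    sum-*ʳ f c = trans (sum-cong (λ t → *-comm (f t) c)) (trans (sum-*ˡ c f) (*-comm c _))

    sum-zero : ∀ {f} → (∀ t → f t ≈ 0#) → sum f ≈ 0#
    sum-zero {f} f≈0 = trans (sum-cong (λ t → trans (f≈0 t) (sym (zeroˡ 0#))))
        (trans (sum-*ˡ 0# (λ _ → 0#)) (zeroˡ _))

    sum-mono : ∀ {f g} → (∀ t → f t ≤ g t) → sum f ≤ sum g
    sum-mono {f} {g} f≤g = ≤.trans (x≤x+y _ (sum-≥0 (λ t → ≤⇒0≤- (f≤g t))))
      (≤.reflexive (trans (sym (sum-+ f _)) (sum-cong
          (λ t → solve 2 (λ f g → f :+ (g :- f) := g) refl (f t) (g t)))))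

    sum-pick : ∀ u f → sum (λ t → 𝟏[ u ≡ t ] * f t) ≈ f u
    sum-pick u f = trans (sum-cong (λ t → 𝟏-*-cong {u ≡ t} {f t} {f u} λ { ≡.refl → refl }))
      (trans (sum-*ʳ _ (f u)) (trans (*-congʳ (sum-δ u)) (*-identityˡ _)))

    term≤sum : ∀ {f} → (∀ t → 0# ≤ f t) → ∀ u → f u ≤ sum f
    term≤sum {f} 0≤f u = ≤.trans (≤.reflexive (sym (sum-pick u f)))
      (sum-mono λ t → ≤.trans (*-mono-≤ (𝟏-nonneg {u ≡ t}) (0≤f t) (𝟏≤1 {u ≡ t}) ≤.refl)
          (≤.reflexive (*-identityˡ _)))

    sum≤0⇒≈0 : ∀ {f} → (∀ t → 0# ≤ f t) → sum f ≤ 0# → ∀ u → f u ≈ 0#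
    sum≤0⇒≈0 0≤f sum≤0 u = ≤.antisym (≤.trans (term≤sum 0≤f u) sum≤0) (0≤f u)

    sum-pos⇒∃ : ∀ {f} → (∀ t → 0# ≤ f t) → 0# < sum f → ∃ λ t → 0# < f t
    sum-pos⇒∃ {f} 0≤f 0<sum with excludedMiddle {∃ λ t → 0# < f t}
    ... | yes p = p
    ... | no ¬p = ⊥-elim (0<sum (≤.reflexive (sum-zero λ t →
                    ≤.antisym (≮⇒≥ λ 0<ft → ¬p (t , 0<ft)) (0≤f t))))

  open Finite using (Element)

  sum-comm : ∀ (S T : Finite) (f : Element S → Element T → Carrier) →
             Finite.sum S (λ s → Finite.sum T (f s)) ≈ Finite.sum T (λ t → Finite.sum S (λ s → f s t))
  sum-comm S T f = Finite.sum-swap S (Finite.sum T) (Finite.sum-cong T) (Finite.sum-+ T) f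

  vectors : ℕ → Finite
  vectors n = record
    { Element  = F₂^ n
    ; sum      = ∑ n
    ; sum-cong = ∑-cong n
    ; sum-+    = ∑-distrib-+ n
    ; sum-*ˡ   = *-distribˡ-∑ n
    ; sum-≥0   = ∑-nonneg n
    ; sum-δ    = λ u → trans (∑-cong n (λ v → 𝟏≈𝟙 (u ≟ᵛ v))) (∑-𝟙≡ n u)
    ; sum-swap = λ L → swap n L
    }
    where
    swap : ∀ n {I : Set} (L : (I → Carrier) → Carrier) →
           (∀ {f g} → (∀ i → f i ≈ g i) → L f ≈ L g) →
           (∀ f g → L (λ i → f i + g i) ≈ L f + L g) →
           ∀ (f : F₂^ n → I → Carrier) → ∑ n (λ t → L (f t)) ≈ L (λ i → ∑ n (λ t → f t i))
    swap zero    L L-cong L-+ f = refl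
    swap (suc n) L L-cong L-+ f = trans (+-cong (swap n L L-cong L-+ _) (swap n L L-cong L-+ _)) (sym (L-+ _ _))

  infixr 5 _⊗_

  _⊗_ : Finite → Finite → Finite
  S ⊗ T = record
    { Element  = Element S × Element T
    ; sum      = λ f → S.sum (λ s → T.sum (λ t → f (s , t)))
    ; sum-cong = λ f≈g → S.sum-cong (λ s → T.sum-cong (λ t → f≈g (s , t)))
    ; sum-+    = λ f g → trans (S.sum-cong (λ s → T.sum-+ _ _)) (S.sum-+ _ _)
    ; sum-*ˡ   = λ c f → trans (S.sum-cong (λ s → T.sum-*ˡ c _)) (S.sum-*ˡ c _)
    ; sum-≥0   = λ 0≤f → S.sum-≥0 (λ s → T.sum-≥0 (λ t → 0≤f (s , t)))
    ; sum-δ    = λ { (u , v) → trans (S.sum-cong λ s → trans (T.sum-cong λ t →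
                   trans (𝟏-cong {(u , v) ≡ (s , t)} {(u ≡ s) × (v ≡ t)} (λ { ≡.refl → ≡.refl , ≡.refl })
                       (λ { (≡.refl , ≡.refl) → ≡.refl })) 𝟏-×)
                   (trans (T.sum-*ˡ 𝟏[ u ≡ s ] _) (trans (*-congˡ (T.sum-δ v)) (*-identityʳ _)))) (S.sum-δ u) }
    ; sum-swap = λ L L-cong L-+ f → trans (S.sum-cong (λ s → T.sum-swap L L-cong L-+ _))
                   (S.sum-swap L L-cong L-+ _)
    }
    where
    module S = Finite S
    module T = Finite T

  record Law (Ω : Finite) : Set where
    open Finite Ω using (sum)
    field
      pr        : Element Ω → Carrier
      pr-nonneg : ∀ ω → 0# ≤ pr ω
      pr-total  : sum pr ≈ 1#

    Likely : Element Ω → Set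
    Likely ω = 0# < pr ω

  open Law using (pr; pr-nonneg; pr-total; Likely)

  module _ {Ω : Finite} (p : Law Ω) where

    open Finite Ω using (sum; sum-cong; sum-+; sum-*ˡ; sum-*ʳ; sum-zero; sum-mono; sum-≥0; term≤sum)

    𝔼 : (Element Ω → Carrier) → Carrier
    𝔼 f = sum (λ ω → pr p ω * f ω)

    weigh : ∀ ω {x y} → (Likely p ω → x ≤ y) → pr p ω * x ≤ pr p ω * y
    weigh ω {x} {y} x≤y with pr p ω ≤? 0#
    ... | no 0<p   = <⇒≤ 0<p ⟨*⟩ x≤y 0<p
    ... | yes p≤0 = ≤.reflexive (trans (trans (*-congʳ p≈0) (zeroˡ x)) (sym (trans (*-congʳ p≈0) (zeroˡ y))))
      where p≈0 = ≤.antisym p≤0 (pr-nonneg p ω)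

    weigh-cong : ∀ ω {x y} → (Likely p ω → x ≈ y) → pr p ω * x ≈ pr p ω * y
    weigh-cong ω x≈y = ≤.antisym (weigh ω (≤.reflexive ∘ x≈y)) (weigh ω (≤.reflexive ∘ sym ∘ x≈y))

    𝔼-mono : ∀ {f g} → (∀ ω → Likely p ω → f ω ≤ g ω) → 𝔼 f ≤ 𝔼 g
    𝔼-mono f≤g = sum-mono (λ ω → weigh ω (f≤g ω))

    𝔼-cong : ∀ {f g} → (∀ ω → Likely p ω → f ω ≈ g ω) → 𝔼 f ≈ 𝔼 g
    𝔼-cong f≈g = sum-cong (λ ω → weigh-cong ω (f≈g ω))

    𝔼-+ : ∀ f g → 𝔼 (λ ω → f ω + g ω) ≈ 𝔼 f + 𝔼 g
    𝔼-+ f g = trans (sum-cong (λ ω → distribˡ _ _ _)) (sum-+ _ _)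

    𝔼-*ˡ : ∀ c f → 𝔼 (λ ω → c * f ω) ≈ c * 𝔼 f
    𝔼-*ˡ c f = trans (sum-cong (λ ω → solve 3 (λ p c f → p :* (c :* f) := c :* (p :* f)) refl _ _ _)) (sum-*ˡ c _)

    𝔼-const : ∀ c → 𝔼 (λ _ → c) ≈ c
    𝔼-const c = trans (sum-*ʳ _ c) (trans (*-congʳ (pr-total p)) (*-identityˡ c))

    𝔼-neg : ∀ f → 𝔼 (λ ω → - f ω) ≈ - 𝔼 f
    𝔼-neg f = trans (sum-cong λ ω → solve 2 (λ p f → p :* :- f := (:- :1) :* (p :* f)) refl _ _)
      (trans (sum-*ˡ (- 1#) _) (solve 1 (λ x → (:- :1) :* x := :- x) refl _))

    ℙ : {T : Set} → (Element Ω → T) → T → Carrier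
    ℙ f t = 𝔼 (λ ω → 𝟏[ f ω ≡ t ])

    ℙ-nonneg : ∀ {T : Set} (f : Element Ω → T) t → 0# ≤ ℙ f t
    ℙ-nonneg f t = sum-≥0 λ ω → *-nonneg (pr-nonneg p ω) (𝟏-nonneg {f ω ≡ t})

    ℙ-pos : ∀ {T : Set} (f : Element Ω → T) {ω} → Likely p ω → 0# < ℙ f (f ω)
    ℙ-pos f {ω} 0<p = <-≤-trans 0<p (≤.trans (≤.reflexive
        (trans (sym (*-identityʳ _)) (*-congˡ (sym (𝟏-yes {f ω ≡ f ω} ≡.refl)))))
      (term≤sum (λ ω′ → *-nonneg (pr-nonneg p ω′) (𝟏-nonneg {f ω′ ≡ f ω})) ω))

    ℙ-pos⇒∃ : ∀ {T : Set} (f : Element Ω → T) {t} → 0# < ℙ f t → ∃ λ ω → Likely p ω × f ω ≡ t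
    ℙ-pos⇒∃ f {t} 0<ℙ with Finite.sum-pos⇒∃ Ω (λ ω → *-nonneg (pr-nonneg p ω) (𝟏-nonneg {f ω ≡ t})) 0<ℙ
    ... | ω , 0<term with pr p ω ≤? 0#
    ...   | yes p≤0 = ⊥-elim (0<term (≤.reflexive (trans (*-congʳ (≤.antisym p≤0 (pr-nonneg p ω))) (zeroˡ _))))
    ...   | no 0<p with excludedMiddle {f ω ≡ t}
    ...     | yes eq = ω , 0<p , eq
    ...     | no ¬eq = ⊥-elim (0<term (≤.reflexive (zeroʳ _)))

    ℙ-mono : ∀ {T U : Set} {f : Element Ω → T} {g : Element Ω → U} {t u} →
             (∀ ω → Likely p ω → f ω ≡ t → g ω ≡ u) → ℙ f t ≤ ℙ g u
    ℙ-mono f⇒g = 𝔼-mono (λ ω 0<p → 𝟏-mono (f⇒g ω 0<p))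

    ℙ-cong : ∀ {T U : Set} {f : Element Ω → T} {g : Element Ω → U} {t u} →
             (∀ ω → Likely p ω → f ω ≡ t → g ω ≡ u) → (∀ ω → Likely p ω → g ω ≡ u → f ω ≡ t) → ℙ f t ≈ ℙ g u
    ℙ-cong f⇒g g⇒f = ≤.antisym (ℙ-mono f⇒g) (ℙ-mono g⇒f)

    H : {T : Set} → (Element Ω → T) → Carrier
    H f = 𝔼 (λ ω → - log₂ (ℙ f (f ω)))

    infix 4 _≼_
    _≼_ : {T U : Set} → (Element Ω → T) → (Element Ω → U) → Set
    f ≼ g = ∀ ω ω′ → Likely p ω → Likely p ω′ → g ω ≡ g ω′ → f ω ≡ f ω′

    H-mono : ∀ {T U : Set} {f : Element Ω → T} {g : Element Ω → U} → f ≼ g → H f ≤ H g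
    H-mono {f = f} {g} f≼g = 𝔼-mono λ ω 0<p → neg-mono-≤ (log-mono-≤ (ℙ-pos g 0<p)
      (ℙ-mono λ ω′ 0<p′ → f≼g ω′ ω 0<p′ 0<p))

    H-cong : ∀ {T U : Set} {f : Element Ω → T} {g : Element Ω → U} → f ≼ g → g ≼ f → H f ≈ H g
    H-cong f≼g g≼f = ≤.antisym (H-mono f≼g) (H-mono g≼f)

    𝔼-swap : ∀ (F : Element Ω → Element Ω → Carrier) →
             𝔼 (λ ω → 𝔼 (F ω)) ≈ 𝔼 (λ ω′ → 𝔼 (λ ω → F ω ω′))
    𝔼-swap F = trans (sum-cong (λ ω → sym (sum-*ˡ (pr p ω) _)))
      (trans (sum-comm Ω Ω _)
      (sum-cong λ ω′ → trans (sum-cong λ ω → solve 3 (λ p q f → p :* (q :* f) := q :* (p :* f)) refl _ _ _)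
          (sum-*ˡ (pr p ω′) _)))

    module Submodularity {S T U : Set} (f : Element Ω → S) (g : Element Ω → T) (i : Element Ω → U)
                         (i≼f : i ≼ f) (i≼g : i ≼ g) where

      private
        A B C D ratio deficit : Element Ω → Carrier
        A ω = ℙ f (f ω)
        B ω = ℙ g (g ω)
        C ω = ℙ (f ▵ g) (f ω , g ω)
        D ω = ℙ i (i ω)
        ratio ω = A ω * (B ω * (C ω ⁻¹ * D ω ⁻¹))
        deficit ω = log₂e * (ratio ω - 1#) - log₂ (ratio ω)

        inner : ∀ ω₁ → Likely p ω₁ → ∀ ω₂ → Likely p ω₂ →
                𝔼 (λ ω → 𝟏[ f ω₁ ≡ f ω ] * (𝟏[ g ω₂ ≡ g ω ] * (C ω ⁻¹ * D ω ⁻¹))) ≤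
                D ω₁ ⁻¹ * 𝟏[ i ω₂ ≡ i ω₁ ]
        inner ω₁ 0<p₁ ω₂ 0<p₂ = begin
          𝔼 (λ ω → 𝟏[ f ω₁ ≡ f ω ] * (𝟏[ g ω₂ ≡ g ω ] * (C ω ⁻¹ * D ω ⁻¹)))
            ≈⟨ 𝔼-cong (λ ω 0<p → trans (sym (*-assoc _ _ _)) (trans (*-congʳ (sym 𝟏-×))
                 (trans (𝟏-*-cong {f ω₁ ≡ f ω × g ω₂ ≡ g ω} {C ω ⁻¹ * D ω ⁻¹} {Z ⁻¹ * D ω₁ ⁻¹} λ (f≡ , g≡) → *-cong
                     (reflexive (≡.cong (λ t → ℙ (f ▵ g) t ⁻¹) (≡.cong₂ _,_ (≡.sym f≡) (≡.sym g≡))))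
                     (reflexive (≡.cong (λ t → ℙ i t ⁻¹) (i≼f ω ω₁ 0<p 0<p₁ (≡.sym f≡)))))
                 (trans (*-congʳ (𝟏-cong {Q = (f ▵ g) ω ≡ (f ω₁ , g ω₂)}
                     (λ (f≡ , g≡) → ≡.cong₂ _,_ (≡.sym f≡) (≡.sym g≡))
                                    (λ eq → ≡.cong proj₁ (≡.sym eq) , ≡.cong proj₂ (≡.sym eq)))) (*-comm _ _))))) ⟩
          𝔼 (λ ω → (Z ⁻¹ * D ω₁ ⁻¹) * 𝟏[ (f ▵ g) ω ≡ (f ω₁ , g ω₂) ])
            ≈⟨ 𝔼-*ˡ (Z ⁻¹ * D ω₁ ⁻¹) _ ⟩
          (Z ⁻¹ * D ω₁ ⁻¹) * Z
            ≈⟨ solve 3 (λ z y d → (y :* d) :* z := d :* (z :* y)) refl Z (Z ⁻¹) (D ω₁ ⁻¹) ⟩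
          D ω₁ ⁻¹ * (Z * Z ⁻¹)
            ≤⟨ ⁻¹-nonneg′ (ℙ-pos i 0<p₁) ⟨*⟩ cases (Z ≤? 0#) ⟩
          D ω₁ ⁻¹ * 𝟏[ i ω₂ ≡ i ω₁ ] ∎
          where
          open ≤-Reasoning
          Z = ℙ (f ▵ g) (f ω₁ , g ω₂)
          cases : Dec (Z ≤ 0#) → Z * Z ⁻¹ ≤ 𝟏[ i ω₂ ≡ i ω₁ ]
          cases (yes Z≤0) = ≤.trans (≤.reflexive (trans (*-congʳ (≤.antisym Z≤0 (ℙ-nonneg (f ▵ g) _)))
              (zeroˡ _))) (𝟏-nonneg {i ω₂ ≡ i ω₁})
          cases (no 0<Z) with ℙ-pos⇒∃ (f ▵ g) 0<Z
          ... | ω , 0<p , eq = ≤.reflexive (trans (*-inverseʳ (<⇒≉ 0<Z)) (sym (𝟏-yes (≡.trans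
                  (i≼g ω₂ ω 0<p₂ 0<p (≡.cong proj₂ (≡.sym eq)))
                  (i≼f ω ω₁ 0<p 0<p₁ (≡.cong proj₁ eq))))))

        𝔼-ratio≤1 : 𝔼 ratio ≤ 1#
        𝔼-ratio≤1 = begin
          𝔼 ratio
            ≈⟨ 𝔼-cong (λ ω _ → trans (*-comm _ _) (trans (sym (𝔼-*ˡ _ _)) (𝔼-cong λ _ _ →
                 trans (*-comm _ _) (*-congˡ (trans (*-comm _ _)
                     (trans (sym (𝔼-*ˡ _ _)) (𝔼-cong λ _ _ → *-comm _ _))))))) ⟩
          𝔼 (λ ω → 𝔼 (λ ω₁ → 𝟏[ f ω₁ ≡ f ω ] * 𝔼 (λ ω₂ → 𝟏[ g ω₂ ≡ g ω ] * (C ω ⁻¹ * D ω ⁻¹))))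
            ≈⟨ 𝔼-swap _ ⟩
          𝔼 (λ ω₁ → 𝔼 (λ ω → 𝟏[ f ω₁ ≡ f ω ] * 𝔼 (λ ω₂ → 𝟏[ g ω₂ ≡ g ω ] * (C ω ⁻¹ * D ω ⁻¹))))
            ≈⟨ 𝔼-cong (λ ω₁ _ → trans (𝔼-cong λ ω _ → sym (𝔼-*ˡ _ _)) (𝔼-swap _)) ⟩
          𝔼 (λ ω₁ → 𝔼 (λ ω₂ → 𝔼 (λ ω → 𝟏[ f ω₁ ≡ f ω ] * (𝟏[ g ω₂ ≡ g ω ] * (C ω ⁻¹ * D ω ⁻¹)))))
            ≤⟨ 𝔼-mono (λ ω₁ 0<p₁ → 𝔼-mono (inner ω₁ 0<p₁)) ⟩
          𝔼 (λ ω₁ → 𝔼 (λ ω₂ → D ω₁ ⁻¹ * 𝟏[ i ω₂ ≡ i ω₁ ]))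
            ≈⟨ 𝔼-cong (λ ω₁ 0<p₁ → trans (𝔼-*ˡ _ _) (*-inverseˡ (<⇒≉ (ℙ-pos i 0<p₁)))) ⟩
          𝔼 (λ _ → 1#)
            ≈⟨ 𝔼-const 1# ⟩
          1# ∎
          where open ≤-Reasoning

        ratio-pos : ∀ {ω} → Likely p ω → 0# < ratio ω
        ratio-pos 0<p = *-pos (ℙ-pos f 0<p) (*-pos (ℙ-pos g 0<p)
            (*-pos (⁻¹-pos (ℙ-pos (f ▵ g) 0<p)) (⁻¹-pos (ℙ-pos i 0<p))))

        log-ratio : ∀ {ω} → Likely p ω → log₂ (ratio ω) ≈ log₂ (A ω) + (log₂ (B ω) + (- log₂ (C ω) + - log₂ (D ω)))
        log-ratio {ω} 0<p = trans (log-* 0<A (*-pos 0<B (*-pos (⁻¹-pos 0<C) (⁻¹-pos 0<D)))) (+-congˡ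
          (trans (log-* 0<B (*-pos (⁻¹-pos 0<C) (⁻¹-pos 0<D))) (+-congˡ
          (trans (log-* (⁻¹-pos 0<C) (⁻¹-pos 0<D)) (+-cong (log-⁻¹ 0<C) (log-⁻¹ 0<D))))))
          where
          0<A = ℙ-pos f 0<p
          0<B = ℙ-pos g 0<p
          0<C = ℙ-pos (f ▵ g) 0<p
          0<D = ℙ-pos i 0<p

        deficit-nonneg : ∀ ω → Likely p ω → 0# ≤ deficit ω
        deficit-nonneg ω 0<p = ≤⇒0≤- (log-tangent (ratio-pos 0<p))

        balance : (H f + H g) + log₂e * 𝔼 ratio ≈ (H (f ▵ g) + H i) + (𝔼 deficit + log₂e)
        balance = begin
          (H f + H g) + log₂e * 𝔼 ratio
            ≈⟨ +-cong (𝔼-+ _ _) (𝔼-*ˡ _ _) ⟨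
          𝔼 (λ ω → - log₂ (A ω) + - log₂ (B ω)) + 𝔼 (λ ω → log₂e * ratio ω)
            ≈⟨ 𝔼-+ _ _ ⟨
          𝔼 (λ ω → (- log₂ (A ω) + - log₂ (B ω)) + log₂e * ratio ω)
            ≈⟨ 𝔼-cong (λ ω 0<p → trans
                 (solve 6 (λ a b c d e r → (:- a :+ :- b) :+ e :* r
                    := (:- c :+ :- d) :+ ((e :* (r :- :1) :- (a :+ (b :+ (:- c :+ :- d)))) :+ e)) refl _ _
                        (log₂ (C ω)) (log₂ (D ω)) _ _)
                 (+-congˡ (+-congʳ (+-congˡ (-‿cong (sym (log-ratio 0<p))))))) ⟩
          𝔼 (λ ω → (- log₂ (C ω) + - log₂ (D ω)) + (deficit ω + log₂e))
            ≈⟨ trans (𝔼-+ _ _) (+-cong (𝔼-+ _ _) (trans (𝔼-+ _ _) (+-congˡ (𝔼-const log₂e)))) ⟩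
          (H (f ▵ g) + H i) + (𝔼 deficit + log₂e) ∎
          where open ≈-Reasoning

      submodular : H (f ▵ g) + H i ≤ H f + H g
      submodular = ≤-via
        (solve 5 (λ a j δ c r → a :+ (j :+ (δ :+ c) :+ c :* r :+ :0) := j :+ (a :+ c :* r :+ c :* :1 :+ δ))
            refl _ _ _ _ _)
        (≤.reflexive (sym balance) ⟨+⟩ (log₂e-nonneg ⟨*⟩ 𝔼-ratio≤1) ⟨+⟩ 0≤𝔼-deficit)
        where
        0≤𝔼-deficit : 0# ≤ 𝔼 deficit
        0≤𝔼-deficit = ≤.trans (≤.reflexive (sym (𝔼-const 0#))) (𝔼-mono deficit-nonneg)

      submodular-equality : H f + H g ≤ H (f ▵ g) + H i → ∀ ω → Likely p ω →
        ℙ f (f ω) * ℙ g (g ω) ≈ ℙ (f ▵ g) (f ω , g ω) * ℙ i (i ω)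
      submodular-equality le ω 0<p with ratio ω ≟ 1#
      ... | no ≉1 = ⊥-elim (log-tangent-strict (ratio-pos 0<p) ≉1 (≤-via
              (solve 2 (λ t l → l :+ (t :- l) := t :+ :0) refl _ _)
              (*-cancelˡ-≤ 0<p (≤.trans (≤.reflexive (Finite.sum≤0⇒≈0 Ω terms≥0 𝔼-deficit≤0 ω))
                  (≤.reflexive (sym (zeroʳ _)))))))
        where
        terms≥0 : ∀ ω → 0# ≤ pr p ω * deficit ω
        terms≥0 ω = ≤.trans (≤.reflexive (sym (zeroʳ _))) (weigh ω (deficit-nonneg ω))
        𝔼-deficit≤0 : 𝔼 deficit ≤ 0#
        𝔼-deficit≤0 = ≤-via
          (solve 5 (λ a j δ c r → :0 :+ (a :+ (j :+ (δ :+ c)) :+ c :* r) := δ :+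
              (j :+ (a :+ c :* r) :+ c :* :1)) refl _ _ _ _ _)
          (le ⟨+⟩ ≤.reflexive (sym balance) ⟨+⟩ (log₂e-nonneg ⟨*⟩ 𝔼-ratio≤1))
      ... | yes ≈1 = trans (sym (*-identityʳ _)) (trans (*-congˡ (sym (*-identityʳ 1#))) (trans
              (*-congˡ (sym (*-cong (*-inverseʳ (<⇒≉ (ℙ-pos (f ▵ g) 0<p))) (*-inverseʳ (<⇒≉ (ℙ-pos i 0<p))))))
              (trans (solve 6 (λ a b c c′ d d′ → (a :* b) :* ((c :* c′) :* (d :* d′)) := (c :* d) :*
                  (a :* (b :* (c′ :* d′)))) refl _ _ _ _ _ _)
              (trans (*-congˡ ≈1) (*-identityʳ _)))))

    open Submodularity public using (submodular; submodular-equality)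

    H-const : H (λ _ → tt) ≈ 0#
    H-const = trans (𝔼-cong (λ ω 0<p → trans (-‿cong (trans (log-cong (ℙ-pos (λ _ → tt) 0<p) total) log-1))
        (solve 0 (:- :0 := :0) refl)))
      (𝔼-const 0#)
      where
      total : ℙ (λ _ → tt) tt ≈ 1#
      total = trans (𝔼-cong (λ _ _ → 𝟏-yes ≡.refl)) (𝔼-const 1#)

    H-nonneg : ∀ {T : Set} (f : Element Ω → T) → 0# ≤ H f
    H-nonneg f = ≤.trans (≤.reflexive (sym H-const)) (H-mono λ _ _ _ _ _ → ≡.refl)

    subadditive : ∀ {S T : Set} (f : Element Ω → S) (g : Element Ω → T) → H (f ▵ g) ≤ H f + H g
    subadditive f g = ≤.trans (≤.reflexive (trans (sym (+-identityʳ _)) (+-congˡ (sym H-const))))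
      (submodular f g (λ _ → tt) (λ _ _ _ _ _ → ≡.refl) (λ _ _ _ _ _ → ≡.refl))

    mutual-information-mono : ∀ {S T U V : Set} (F : Element Ω → S) (G : Element Ω → T)
      (f : Element Ω → U) (g : Element Ω → V) → f ≼ F → g ≼ G →
      ∀ {c} → H F + H G ≤ H (F ▵ G) + c → H f + H g ≤ H (f ▵ g) + c
    mutual-information-mono F G f g f≼F g≼G le = ≤-via
      (solve 8 (λ f g fg c F G FG fG → (fg :+ c) :+ ((F :+ G) :+ (FG :+ f) :+ (fG :+ g))
                  := (f :+ g) :+ ((FG :+ c) :+ (F :+ fG) :+ (G :+ fg))) refl _ _ _ _ _ _ _ (H (f ▵ G)))
      (le ⟨+⟩ ≤.trans (+-monoˡ-≤ _ (H-mono λ _ _ _ _ eq → ≡.cong₂ _,_ (≡.cong proj₁ eq)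
          (≡.cong (proj₂ ∘ proj₂) eq)))
                (submodular F (f ▵ G) f f≼F (λ _ _ _ _ → ≡.cong proj₁))
          ⟨+⟩ ≤.trans (+-monoˡ-≤ _ (H-mono λ _ _ _ _ eq → ≡.cong₂ _,_ (≡.cong (proj₁ ∘ proj₂) eq)
              (≡.cong proj₁ eq)))
                (submodular G (f ▵ g) g g≼G (λ _ _ _ _ → ≡.cong proj₂)))

  pushforward : ∀ {Ω Ω′ : Finite} → Law Ω → (Element Ω → Element Ω′) → Law Ω′
  pushforward {Ω} {Ω′} p F = record
    { pr        = ℙ p F
    ; pr-nonneg = ℙ-nonneg p F
    ; pr-total  = trans (sum-comm Ω′ Ω _) (trans (Finite.sum-cong Ω λ ω →
        trans (Finite.sum-*ˡ Ω′ _ _) (trans (*-congˡ (Finite.sum-δ Ω′ (F ω))) (*-identityʳ _))) (pr-total p))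
    }

  module Pushforward {Ω Ω′ : Finite} (p : Law Ω) (F : Element Ω → Element Ω′) where

    private p′ = pushforward {Ω} {Ω′} p F

    𝔼-push : ∀ G → 𝔼 p′ G ≈ 𝔼 p (λ ω → G (F ω))
    𝔼-push G = trans (Finite.sum-cong Ω′ λ ω′ → sym (Finite.sum-*ʳ Ω _ (G ω′)))
      (trans (sum-comm Ω′ Ω _) (Finite.sum-cong Ω λ ω →
        trans (Finite.sum-cong Ω′ λ ω′ → *-assoc _ _ _)
            (trans (Finite.sum-*ˡ Ω′ _ _) (*-congˡ (Finite.sum-pick Ω′ (F ω) G)))))

    ℙ-push : ∀ {T : Set} (f : Element Ω′ → T) t → ℙ p′ f t ≈ ℙ p (λ ω → f (F ω)) t
    ℙ-push f t = 𝔼-push _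

    H-push : ∀ {T : Set} (f : Element Ω′ → T) → H p′ f ≈ H p (λ ω → f (F ω))
    H-push f = trans (𝔼-push _) (𝔼-cong p λ ω 0<p →
      -‿cong (sym (log-cong (ℙ-pos p (λ ω → f (F ω)) 0<p) (sym (ℙ-push f _)))))

  ℙ-id : ∀ {Ω} (p : Law Ω) ω → ℙ p id ω ≈ pr p ω
  ℙ-id {Ω} p ω = trans (Finite.sum-cong Ω (λ ω′ → trans (*-comm _ _) (*-congʳ (𝟏-cong ≡.sym ≡.sym))))
    (Finite.sum-pick Ω ω (pr p))

  H-transport : ∀ {Ω Ω′} {p : Law Ω} {q : Law Ω′} {F : Element Ω → Element Ω′} →
                (∀ ω → pr q ω ≈ ℙ p F ω) → ∀ {T : Set} (g : Element Ω′ → T) → H q g ≈ H p (λ ω → g (F ω))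
  H-transport {Ω} {Ω′} {p} {q} {F = F} q≈ g = trans eq (Pushforward.H-push {Ω} {Ω′} p F g)
    where
    p′ = pushforward {Ω} {Ω′} p F
    𝔼-eq : ∀ G → 𝔼 q G ≈ 𝔼 p′ G
    𝔼-eq G = Finite.sum-cong Ω′ (λ ω → *-congʳ (q≈ ω))
    eq : H q g ≈ H p′ g
    eq = trans (𝔼-cong q λ ω 0<q → -‿cong (log-cong (ℙ-pos q g 0<q) (𝔼-eq _))) (𝔼-eq _)

module Conditioning (ℝ : RealField) where

  open RealField ℝ
  open OrderedField ℝ
  open Logarithm ℝ
  open FiniteProbability ℝ
  open Finite using (Element)
  open Law using (pr; pr-nonneg; pr-total; Likely)

  sum-≤⇒≈ : ∀ (Ω : Finite) {f g : Element Ω → Carrier} → (∀ t → f t ≤ g t) →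
            Finite.sum Ω f ≈ Finite.sum Ω g → ∀ t → f t ≈ g t
  sum-≤⇒≈ Ω {f} {g} f≤g Σf≈Σg t = trans (solve 2 (λ f g → f := g :- (g :- f)) refl (f t) (g t))
    (trans (+-congˡ (trans (-‿cong (Finite.sum≤0⇒≈0 Ω (λ t → ≤⇒0≤- (f≤g t)) (≤.reflexive total) t))
        (solve 0 (:- :0 := :0) refl))) (+-identityʳ _))
    where
    total : Finite.sum Ω (λ t → g t - f t) ≈ 0#
    total = trans (solve 2 (λ d f → d := (f :+ d) :- f) refl _ (Finite.sum Ω f))
      (trans (+-congʳ (trans (sym (Finite.sum-+ Ω f _))
          (trans (Finite.sum-cong Ω (λ t → solve 2 (λ f g → f :+ (g :- f) := g) refl _ _)) (sym Σf≈Σg))))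
      (-‿inverseʳ _))

  module Product {Ω Ω′ : Finite} (p : Law Ω) (q : Law Ω′) where

    productLaw : Law (Ω ⊗ Ω′)
    productLaw = record
      { pr        = λ (ω , ω′) → pr p ω * pr q ω′
      ; pr-nonneg = λ (ω , ω′) → *-nonneg (pr-nonneg p ω) (pr-nonneg q ω′)
      ; pr-total  = trans (Finite.sum-cong Ω λ ω → trans (Finite.sum-*ˡ Ω′ _ _)
          (trans (*-congˡ (pr-total q)) (*-identityʳ _))) (pr-total p)
      }

    𝔼-fst : ∀ f → 𝔼 productLaw (f ∘ proj₁) ≈ 𝔼 p f
    𝔼-fst f = Finite.sum-cong Ω λ ω → trans (Finite.sum-*ʳ Ω′ _ _) (*-congʳ
      (trans (Finite.sum-*ˡ Ω′ _ _) (trans (*-congˡ (pr-total q)) (*-identityʳ _))))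

    𝔼-snd : ∀ f → 𝔼 productLaw (f ∘ proj₂) ≈ 𝔼 q f
    𝔼-snd f = trans (Finite.sum-cong Ω λ ω → trans (Finite.sum-cong Ω′ λ ω′ → *-assoc _ _ _) (Finite.sum-*ˡ Ω′ _ _))
      (trans (Finite.sum-*ʳ Ω _ _) (trans (*-congʳ (pr-total p)) (*-identityˡ _)))

    H-fst : ∀ {T : Set} (f : Element Ω → T) → H p f ≈ H productLaw (f ∘ proj₁)
    H-fst = H-transport {Ω ⊗ Ω′} {Ω} {productLaw} {p} {F = proj₁} (λ ω → sym (trans (𝔼-fst _) (ℙ-id p ω)))

    H-snd : ∀ {T : Set} (f : Element Ω′ → T) → H q f ≈ H productLaw (f ∘ proj₂)
    H-snd = H-transport {Ω ⊗ Ω′} {Ω′} {productLaw} {q} {F = proj₂} (λ ω → sym (trans (𝔼-snd _) (ℙ-id q ω)))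

    likely-fst : ∀ {ω ω′} → Likely productLaw (ω , ω′) → Likely p ω
    likely-fst {ω} {ω′} 0<pq p≤0 = 0<pq (≤.trans (≤.reflexive (*-comm _ _))
      (≤.trans (pr-nonneg q ω′ ⟨*⟩ p≤0) (≤.reflexive (zeroʳ _))))

    likely-snd : ∀ {ω ω′} → Likely productLaw (ω , ω′) → Likely q ω′
    likely-snd {ω} {ω′} 0<pq q≤0 = 0<pq (≤.trans (pr-nonneg p ω ⟨*⟩ q≤0) (≤.reflexive (zeroʳ _)))

    H-product : H productLaw id ≈ H p id + H q id
    H-product = begin
      H productLaw id
        ≈⟨ 𝔼-cong productLaw (λ (ω , ω′) 0<pq → trans (-‿cong (trans (log-cong (ℙ-pos productLaw id 0<pq)
             (trans (ℙ-id productLaw (ω , ω′)) (*-cong (sym (ℙ-id p ω)) (sym (ℙ-id q ω′)))))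
             (log-* (ℙ-pos p id (likely-fst 0<pq)) (ℙ-pos q id (likely-snd 0<pq)))))
             (solve 2 (λ x y → :- (x :+ y) := :- x :+ :- y) refl _ _)) ⟩
      𝔼 productLaw (λ (ω , ω′) → - log₂ (ℙ p id ω) + - log₂ (ℙ q id ω′))
        ≈⟨ 𝔼-+ productLaw _ _ ⟩
      𝔼 productLaw (λ (ω , ω′) → - log₂ (ℙ p id ω)) + 𝔼 productLaw (λ (ω , ω′) → - log₂ (ℙ q id ω′))
        ≈⟨ +-cong (𝔼-fst _) (𝔼-snd _) ⟩
      H p id + H q id ∎
      where open ≈-Reasoning

  module Conditional {Ω : Finite} (p : Law Ω) {T : Set} (g : Element Ω → T) where

    open Finite Ω using (sum; sum-cong; sum-*ˡ; sum-*ʳ)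

    kernel : Element Ω → Element Ω → Carrier
    kernel ω₀ ω = pr p ω * (𝟏[ g ω ≡ g ω₀ ] * ℙ p g (g ω₀) ⁻¹)

    kernel-nonneg : ∀ {ω₀} → Likely p ω₀ → ∀ ω → 0# ≤ kernel ω₀ ω
    kernel-nonneg {ω₀} 0<p₀ ω = *-nonneg (pr-nonneg p ω)
        (*-nonneg (𝟏-nonneg {g ω ≡ g ω₀}) (⁻¹-nonneg′ (ℙ-pos p g 0<p₀)))

    kernel-total : ∀ {ω₀} → Likely p ω₀ → sum (kernel ω₀) ≈ 1#
    kernel-total 0<p₀ = trans (sum-cong λ ω → sym (*-assoc _ _ _))
        (trans (sum-*ʳ _ _) (*-inverseʳ (<⇒≉ (ℙ-pos p g 0<p₀))))

    conditionalLaw : ∀ {ω₀} → Likely p ω₀ → Law Ω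
    conditionalLaw {ω₀} 0<p₀ = record { pr = kernel ω₀ ; pr-nonneg = kernel-nonneg 0<p₀ ; pr-total =
        kernel-total 0<p₀ }

    likely-kernel : ∀ {ω₀ ω} → 0# < kernel ω₀ ω → Likely p ω × g ω ≡ g ω₀
    likely-kernel {ω₀} {ω} 0<k = 0<pω , same
      where
      0<pω : Likely p ω
      0<pω p≤0 = 0<k (≤.reflexive (trans (*-congʳ (≤.antisym p≤0 (pr-nonneg p ω))) (zeroˡ _)))
      same : g ω ≡ g ω₀
      same with excludedMiddle {g ω ≡ g ω₀}
      ... | yes eq = eq
      ... | no ¬eq = ⊥-elim (0<k (≤.reflexive (trans (*-congˡ (zeroˡ _)) (zeroʳ _))))

    tower : ∀ G → 𝔼 p (λ ω₀ → sum (λ ω → kernel ω₀ ω * G ω)) ≈ 𝔼 p G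
    tower G = begin
      𝔼 p (λ ω₀ → sum (λ ω → kernel ω₀ ω * G ω))
        ≈⟨ sum-cong (λ ω₀ → *-congˡ (sum-cong λ ω → solve 4
            (λ p i y G → (p :* (i :* y)) :* G := p :* ((i :* y) :* G)) refl _ _ _ _)) ⟩
      𝔼 p (λ ω₀ → 𝔼 p (λ ω → (𝟏[ g ω ≡ g ω₀ ] * ℙ p g (g ω₀) ⁻¹) * G ω))
        ≈⟨ 𝔼-swap p _ ⟩
      𝔼 p (λ ω → 𝔼 p (λ ω₀ → (𝟏[ g ω ≡ g ω₀ ] * ℙ p g (g ω₀) ⁻¹) * G ω))
        ≈⟨ 𝔼-cong p (λ ω 0<p → begin
             𝔼 p (λ ω₀ → (𝟏[ g ω ≡ g ω₀ ] * ℙ p g (g ω₀) ⁻¹) * G ω)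
               ≈⟨ 𝔼-cong p (λ ω₀ _ → trans (*-congʳ
                   (trans (𝟏-*-cong (λ eq → reflexive (≡.cong (λ t → ℙ p g t ⁻¹) (≡.sym eq))))
                    (*-congʳ (𝟏-cong ≡.sym ≡.sym))))
                        (solve 3 (λ i y G → (i :* y) :* G := (y :* G) :* i) refl _ _ _)) ⟩
             𝔼 p (λ ω₀ → (ℙ p g (g ω) ⁻¹ * G ω) * 𝟏[ g ω₀ ≡ g ω ])
               ≈⟨ 𝔼-*ˡ p _ _ ⟩
             (ℙ p g (g ω) ⁻¹ * G ω) * ℙ p g (g ω)
               ≈⟨ solve 3 (λ y G x → (y :* G) :* x := (y :* x) :* G) refl _ _ _ ⟩
             (ℙ p g (g ω) ⁻¹ * ℙ p g (g ω)) * G ω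
               ≈⟨ trans (*-congʳ (*-inverseˡ (<⇒≉ (ℙ-pos p g 0<p)))) (*-identityˡ _) ⟩
             G ω ∎) ⟩
      𝔼 p G ∎
      where open ≈-Reasoning

    ℙ-conditional : ∀ {U : Set} {ω₀} (0<p₀ : Likely p ω₀) (f : Element Ω → U) t →
                    ℙ (conditionalLaw 0<p₀) f t ≈ ℙ p (f ▵ g) (t , g ω₀) * ℙ p g (g ω₀) ⁻¹
    ℙ-conditional {ω₀ = ω₀} 0<p₀ f t = trans (sum-cong λ ω → trans
        (solve 4 (λ p i y j → (p :* (i :* y)) :* j := (p :* (j :* i)) :* y) refl _ _ _ _)
        (*-congʳ (*-congˡ (trans (sym 𝟏-×) (𝟏-cong (λ (eq , eq′) → ≡.cong₂ _,_ eq eq′)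
            (λ eq → ≡.cong proj₁ eq , ≡.cong proj₂ eq))))))
      (sum-*ʳ _ _)

    -- The entropy of f given g = g ω₀, as an expression defined for every ω₀.
    fibreH : ∀ {U : Set} → (Element Ω → U) → Element Ω → Carrier
    fibreH f ω₀ = sum (λ ω → kernel ω₀ ω * (- log₂ (ℙ p (f ▵ g) (f ω , g ω)) + log₂ (ℙ p g (g ω))))

    H-conditional : ∀ {U : Set} {ω₀} (0<p₀ : Likely p ω₀) (f : Element Ω → U) → H (conditionalLaw 0<p₀) f ≈
        fibreH f ω₀
    H-conditional {ω₀ = ω₀} 0<p₀ f = 𝔼-cong (conditionalLaw 0<p₀) λ ω 0<k →
      let 0<p , same = likely-kernel 0<k
          0<fg = ≡.subst (λ t → 0# < ℙ p (f ▵ g) (f ω , t)) same (ℙ-pos p (f ▵ g) 0<p)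
          0<g  = ℙ-pos p g 0<p₀
      in trans (-‿cong (trans (log-cong (ℙ-pos (conditionalLaw 0<p₀) f 0<k) (ℙ-conditional 0<p₀ f (f ω)))
           (trans (log-* 0<fg (⁻¹-pos 0<g)) (+-congˡ (log-⁻¹ 0<g)))))
         (trans (solve 2 (λ x y → :- (x :+ :- y) := :- x :+ y) refl _ _)
           (reflexive (≡.cong (λ t → - log₂ (ℙ p (f ▵ g) (f ω , t)) + log₂ (ℙ p g t)) (≡.sym same))))

    𝔼-fibreH : ∀ {U : Set} (f : Element Ω → U) → 𝔼 p (fibreH f) ≈ H p (f ▵ g) - H p g
    𝔼-fibreH f = trans (tower _) (trans (𝔼-+ p _ _)
        (+-congˡ (trans (𝔼-cong p λ ω _ → solve 1 (λ x → x := :- (:- x)) refl _) (𝔼-neg p _))))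

    -- Two copies of Ω, independent conditionally on the common value of g.
    coupling : Law (Ω ⊗ Ω)
    coupling = record
      { pr        = λ (ω , ω′) → pr p ω * kernel ω ω′
      ; pr-nonneg = λ (ω , ω′) → ≤.trans (≤.reflexive (sym (zeroʳ _))) (weigh p ω λ 0<p → kernel-nonneg 0<p ω′)
      ; pr-total  = trans (sum-cong λ ω → trans (sum-*ˡ _ _)
          (trans (weigh-cong p ω kernel-total) (*-identityʳ _))) (pr-total p)
      }

    likely-coupling : ∀ {ω ω′} → Likely coupling (ω , ω′) → Likely p ω × Likely p ω′ × g ω′ ≡ g ω
    likely-coupling {ω} {ω′} 0<pk = 0<p , likely-kernel 0<k
      where
      0<p : Likely p ω
      0<p p≤0 = 0<pk (≤.reflexive (trans (*-congʳ (≤.antisym p≤0 (pr-nonneg p ω))) (zeroˡ _)))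
      0<k : 0# < kernel ω ω′
      0<k k≤0 = 0<pk (≤.reflexive (trans (*-congˡ (≤.antisym k≤0 (kernel-nonneg 0<p ω′))) (zeroʳ _)))

    𝔼-coupling-fst : ∀ f → 𝔼 coupling (f ∘ proj₁) ≈ 𝔼 p f
    𝔼-coupling-fst f = sum-cong λ ω → trans (sum-*ʳ _ _) (*-congʳ
      (trans (sum-*ˡ _ _) (trans (weigh-cong p ω kernel-total) (*-identityʳ _))))

    𝔼-coupling-snd : ∀ f → 𝔼 coupling (f ∘ proj₂) ≈ 𝔼 p f
    𝔼-coupling-snd f = trans (sum-cong λ ω → trans (sum-cong λ ω′ → *-assoc _ _ _) (sum-*ˡ _ _)) (tower f)

    H-coupling-fst : ∀ {U : Set} (f : Element Ω → U) → H p f ≈ H coupling (f ∘ proj₁)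
    H-coupling-fst = H-transport {Ω ⊗ Ω} {Ω} {coupling} {p} {F = proj₁}
        (λ ω → sym (trans (𝔼-coupling-fst _) (ℙ-id p ω)))

    H-coupling-snd : ∀ {U : Set} (f : Element Ω → U) → H p f ≈ H coupling (f ∘ proj₂)
    H-coupling-snd = H-transport {Ω ⊗ Ω} {Ω} {coupling} {p} {F = proj₂}
        (λ ω → sym (trans (𝔼-coupling-snd _) (ℙ-id p ω)))

    H-coupling : H coupling id + H p g ≈ H p id + H p id
    H-coupling = begin
      H coupling id + H p g
        ≈⟨ +-congʳ (trans (𝔼-cong coupling pointwise) (𝔼-+ coupling _ _)) ⟩
      (𝔼 coupling (λ (ω , ω′) → - log₂ (ℙ p id ω) + log₂ (ℙ p g (g ω))) + 𝔼 coupling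
          (λ (ω , ω′) → - log₂ (ℙ p id ω′))) + H p g
        ≈⟨ +-congʳ (+-cong (trans (𝔼-coupling-fst _) (𝔼-+ p _ _)) (𝔼-coupling-snd _)) ⟩
      ((H p id + 𝔼 p (λ ω → log₂ (ℙ p g (g ω)))) + H p id) + H p g
        ≈⟨ +-congˡ (𝔼-neg p _) ⟩
      ((H p id + 𝔼 p (λ ω → log₂ (ℙ p g (g ω)))) + H p id) - 𝔼 p (λ ω → log₂ (ℙ p g (g ω)))
        ≈⟨ solve 2 (λ h l → ((h :+ l) :+ h) :- l := h :+ h) refl _ _ ⟩
      H p id + H p id ∎
      where
      open ≈-Reasoning
      pointwise : ∀ ((ω , ω′) : Element (Ω ⊗ Ω)) → Likely coupling (ω , ω′) →
                  - log₂ (ℙ coupling id (ω , ω′)) ≈ (- log₂ (ℙ p id ω) + log₂ (ℙ p g (g ω))) + - log₂ (ℙ p id ω′)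
      pointwise (ω , ω′) 0<pk = let 0<p , 0<p′ , same = likely-coupling 0<pk ; 0<g = ℙ-pos p g 0<p in
        trans (-‿cong (trans (log-cong (ℙ-pos coupling id 0<pk) (trans (ℙ-id coupling (ω , ω′))
            (*-cong (sym (ℙ-id p ω)) (*-cong (sym (ℙ-id p ω′)) (trans (*-congʳ (𝟏-yes same)) (*-identityˡ _))))))
          (trans (log-* (ℙ-pos p id 0<p) (*-pos (ℙ-pos p id 0<p′) (⁻¹-pos 0<g)))
             (+-congˡ (trans (log-* (ℙ-pos p id 0<p′) (⁻¹-pos 0<g)) (+-congˡ (log-⁻¹ 0<g)))))))
        (solve 3 (λ x y z → :- (x :+ (y :+ :- z)) := (:- x :+ z) :+ :- y) refl _ _ _)

module RandomVariables (ℝ : RealField) where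

  open RealField ℝ
  open OrderedField ℝ
  open Logarithm ℝ
  open FiniteProbability ℝ
  open Conditioning ℝ
  open Finite using (Element)
  open Law using (pr; pr-nonneg; pr-total; Likely)
  private module Ent = Entropy ℝ
  open Ent using (RandomVariable; Pr; Pr-nonneg; Pr-total; _⊟_)

  HasLaw : ∀ {Ω n} → Law Ω → (Element Ω → F₂^ n) → RandomVariable n → Set
  HasLaw p x X = ∀ v → ℙ p x v ≈ Pr X v

  law : ∀ {n} → RandomVariable n → Law (vectors n)
  law X = record { pr = Pr X ; pr-nonneg = Pr-nonneg X ; pr-total = Pr-total X }

  id-hasLaw : ∀ {n} (X : RandomVariable n) → HasLaw (law X) id X
  id-hasLaw X = ℙ-id (law X)

  distribution : ∀ {Ω n} → Law Ω → (Element Ω → F₂^ n) → RandomVariable n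
  distribution {Ω} {n} p x = record { Pr = pr q ; Pr-nonneg = pr-nonneg q ; Pr-total = pr-total q }
    where q = pushforward {Ω} {vectors n} p x

  ∑-ℙ : ∀ {Ω n} (p : Law Ω) (x : Element Ω → F₂^ n) → Finite.sum (vectors n) (ℙ p x) ≈ 1#
  ∑-ℙ {Ω} {n} p x = pr-total (pushforward {Ω} {vectors n} p x)

  H-law : ∀ {n} (X : RandomVariable n) → Ent.H X ≈ H (law X) id
  H-law {n} X = Finite.sum-cong (vectors n) term
    where
    term : ∀ v → (if does (Pr X v ≟ 0#) then 0# else - (Pr X v * log₂ (Pr X v))) ≈ Pr X v * - log₂ (ℙ (law X) id v)
    term v with Pr X v ≟ 0#
    ... | yes ≈0 = sym (trans (*-congʳ ≈0) (zeroˡ _))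
    ... | no ≉0  = trans (-‿cong (*-congˡ (log-cong (≤∧≉⇒< (Pr-nonneg X v) ≉0) (sym (id-hasLaw X v)))))
                     (solve 2 (λ x y → :- (x :* y) := x :* :- y) refl _ _)

  H-hasLaw : ∀ {Ω n} (p : Law Ω) (x : Element Ω → F₂^ n) X → HasLaw p x X → Ent.H X ≈ H p x
  H-hasLaw {Ω} {n} p x X x~X = trans (H-law X) (H-transport {Ω} {vectors n} {p} {law X} {x} (λ v → sym (x~X v)) id)

  hasLaw-≤ : ∀ {Ω n} (p : Law Ω) (x : Element Ω → F₂^ n) X → (∀ v → ℙ p x v ≤ Pr X v) → HasLaw p x X
  hasLaw-≤ {n = n} p x X le = sum-≤⇒≈ (vectors n) le (trans (∑-ℙ p x) (sym (Pr-total X)))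

  hasLaw-likely : ∀ {Ω n} (p : Law Ω) (x : Element Ω → F₂^ n) X →
                  (∀ ω → Likely p ω → ℙ p x (x ω) ≈ Pr X (x ω)) → HasLaw p x X
  hasLaw-likely p x X eq = hasLaw-≤ p x X λ v → case v (ℙ p x v ≤? 0#)
    where
    case : ∀ v → Dec (ℙ p x v ≤ 0#) → ℙ p x v ≤ Pr X v
    case v (yes ≤0) = ≤.trans ≤0 (Pr-nonneg X v)
    case v (no 0<) with ℙ-pos⇒∃ p x 0<
    ... | ω , 0<p , ≡.refl = ≤.reflexive (eq ω 0<p)

  Independent : ∀ {Ω} {S T : Set} → Law Ω → (Element Ω → S) → (Element Ω → T) → Set
  Independent p x y = ∀ ω → Likely p ω → ℙ p (x ▵ y) (x ω , y ω) ≈ ℙ p x (x ω) * ℙ p y (y ω)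

  entropic-independence : ∀ {Ω} {S T : Set} (p : Law Ω) (x : Element Ω → S) (y : Element Ω → T) →
                          H p x + H p y ≤ H p (x ▵ y) → Independent p x y
  entropic-independence p x y le ω 0<p = sym (trans
    (submodular-equality p x y (λ _ → tt) (λ _ _ _ _ _ → ≡.refl) (λ _ _ _ _ _ → ≡.refl)
      (≤.trans le (x≤x+y _ (H-nonneg p _))) ω 0<p)
    (trans (*-congˡ (trans (𝔼-cong p λ _ _ → 𝟏-yes ≡.refl) (𝔼-const p 1#))) (*-identityʳ _)))

  difference-hasLaw : ∀ {Ω n} (p : Law Ω) (x y : Element Ω → F₂^ n) X Y →
                      HasLaw p x X → HasLaw p y Y → Independent p x y →
                      HasLaw p (λ ω → x ω ⊖ y ω) (X ⊟ Y)
  difference-hasLaw {Ω} {n} p x y X Y x~X y~Y ind = hasLaw-≤ p _ (X ⊟ Y) λ z → begin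
    ℙ p (λ ω → x ω ⊖ y ω) z
      ≈⟨ Pushforward.𝔼-push {Ω} {vectors n ⊗ vectors n} p (x ▵ y) (λ (u , v) → 𝟏[ u ⊖ v ≡ z ]) ⟨
    V.sum (λ u → V.sum λ v → ℙ p (x ▵ y) (u , v) * 𝟏[ u ⊖ v ≡ z ])
      ≤⟨ V.sum-mono (λ u → V.sum-mono λ v → *-mono-≤ (ℙ-nonneg p _ _) (𝟏-nonneg {u ⊖ v ≡ z})
          (joint≤ u v (ℙ p (x ▵ y) (u , v) ≤? 0#)) ≤.refl) ⟩
    V.sum (λ u → V.sum λ v → Pr X u * Pr Y v * 𝟏[ u ⊖ v ≡ z ])
      ≈⟨ V.sum-cong (λ u → V.sum-cong λ v → *-congˡ (𝟏≈𝟙 (u ⊖ v ≟ᵛ z))) ⟩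
    Pr (X ⊟ Y) z ∎
    where
    open ≤-Reasoning
    module V = Finite (vectors n)
    joint≤ : ∀ u v → Dec (ℙ p (x ▵ y) (u , v) ≤ 0#) → ℙ p (x ▵ y) (u , v) ≤ Pr X u * Pr Y v
    joint≤ u v (yes ≤0) = ≤.trans ≤0 (*-nonneg (Pr-nonneg X u) (Pr-nonneg Y v))
    joint≤ u v (no 0<) with ℙ-pos⇒∃ p (x ▵ y) 0<
    ... | ω , 0<p , ≡.refl = ≤.reflexive (trans (ind ω 0<p) (*-cong (x~X _) (y~Y _)))

  -- Twice the entropic Ruzsa distance.
  D : ∀ {n} → RandomVariable n → RandomVariable n → Carrier
  D X Y = (Ent.H (X ⊟ Y) + Ent.H (X ⊟ Y)) - (Ent.H X + Ent.H Y)

  module Disintegration {n} (K t : Carrier) (0≤K : 0# ≤ K) (A B : RandomVariable n)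
                        (lower : ∀ X Y → t ≤ K * D X Y + (D A X + D B Y)) where

    module _ {Ω : Finite} (p : Law Ω) {T : Set} (x y a b : Element Ω → F₂^ n) (g : Element Ω → T)
             (a~A : HasLaw p a A) (b~B : HasLaw p b B)
             (x⊥y∣g : H p (x ▵ g) + H p (y ▵ g) ≤ H p ((x ▵ g) ▵ (y ▵ g)) + H p g)
             (a⊥x,g : H p a + H p (x ▵ g) ≤ H p (a ▵ (x ▵ g)))
             (b⊥y,g : H p b + H p (y ▵ g) ≤ H p (b ▵ (y ▵ g))) where

      open Conditional p g

      private
        a⊥g : ∀ (a x : Element Ω → F₂^ n) → H p a + H p (x ▵ g) ≤ H p (a ▵ (x ▵ g)) → H p a + H p g ≤ H p (a ▵ g)
        a⊥g a x le = ≤-via (solve 5 (λ a xg axg g ag → ag :+ (a :+ xg :+ (axg :+ g)) := (a :+ g) :+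
            (axg :+ (ag :+ xg))) refl _ _ _ _ _)
          (le ⟨+⟩ ≤.trans (+-monoˡ-≤ _ (H-mono p λ _ _ _ _ eq → ≡.cong₂ _,_ (≡.cong (proj₁ ∘ proj₁) eq)
              (≡.cong proj₂ eq)))
            (submodular p (a ▵ g) (x ▵ g) g (λ _ _ _ _ → ≡.cong proj₂) (λ _ _ _ _ → ≡.cong proj₂)))

      module Fibre {ω₀} (0<p₀ : Likely p ω₀) where

        p₀ = conditionalLaw 0<p₀
        Z = ℙ p g (g ω₀)

        cancelZ : ∀ w → (w * Z) * Z ⁻¹ ≈ w
        cancelZ w = trans (*-assoc _ _ _) (trans (*-congˡ (*-inverseʳ (<⇒≉ (ℙ-pos p g 0<p₀)))) (*-identityʳ w))

        x⊥y : Independent p₀ x y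
        x⊥y ω 0<k with likely-kernel 0<k
        ... | 0<p , same = begin
          ℙ p₀ (x ▵ y) (x ω , y ω)                          ≈⟨ ℙ-conditional 0<p₀ (x ▵ y) _ ⟩
          ℙ p ((x ▵ y) ▵ g) ((x ω , y ω) , g ω₀) * Z ⁻¹      ≈⟨ *-congʳ (trans (ℙ-cong p
             (λ _ _ eq → ≡.cong (λ ((u , v) , γ) → (u , γ) , (v , γ)) eq)
                 (λ _ _ eq → ≡.cong (λ ((u , γ) , (v , _)) → (u , v) , γ) eq)) (sym (cancelZ _))) ⟩
          (ℙ p ((x ▵ g) ▵ (y ▵ g)) ((x ω , g ω₀) , (y ω , g ω₀)) * Z * Z ⁻¹) * Z ⁻¹
            ≈⟨ *-congʳ (*-congʳ (≡.subst (λ γ → ℙ p (x ▵ g) (x ω , γ) * ℙ p (y ▵ g) (y ω , γ) ≈ ℙ p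
                ((x ▵ g) ▵ (y ▵ g)) ((x ω , γ) , (y ω , γ)) * ℙ p g γ) same
                 (submodular-equality p (x ▵ g) (y ▵ g) g (λ _ _ _ _ → ≡.cong proj₂)
                     (λ _ _ _ _ → ≡.cong proj₂) x⊥y∣g ω 0<p))) ⟨
          (ℙ p (x ▵ g) (x ω , g ω₀) * ℙ p (y ▵ g) (y ω , g ω₀) * Z ⁻¹) * Z ⁻¹
            ≈⟨ solve 3 (λ x y z → (x :* y :* z) :* z := (x :* z) :* (y :* z)) refl _ _ _ ⟩
          (ℙ p (x ▵ g) (x ω , g ω₀) * Z ⁻¹) * (ℙ p (y ▵ g) (y ω , g ω₀) * Z ⁻¹)
            ≈⟨ *-cong (ℙ-conditional 0<p₀ x _) (ℙ-conditional 0<p₀ y _) ⟨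
          ℙ p₀ x (x ω) * ℙ p₀ y (y ω) ∎
          where open ≈-Reasoning

        module _ {a x : Element Ω → F₂^ n} {A : RandomVariable n} (a~A : HasLaw p a A) (a⊥x,g : H p a + H p (x ▵ g) ≤ H p (a ▵ (x ▵ g))) where

          a~₀A : HasLaw p₀ a A
          a~₀A = hasLaw-likely p₀ a A law-at
            where
            open ≈-Reasoning
            law-at : ∀ ω → Likely p₀ ω → ℙ p₀ a (a ω) ≈ Pr A (a ω)
            law-at ω 0<k with likely-kernel 0<k
            ... | 0<p , same = begin
              ℙ p₀ a (a ω)                          ≈⟨ ℙ-conditional 0<p₀ a _ ⟩
              ℙ p (a ▵ g) (a ω , g ω₀) * Z ⁻¹       ≈⟨ *-congʳ
                  (≡.subst (λ γ → ℙ p (a ▵ g) (a ω , γ) ≈ ℙ p a (a ω) * ℙ p g γ) same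
                                                        (entropic-independence p a g (a⊥g a x a⊥x,g) ω 0<p)) ⟩
              (ℙ p a (a ω) * Z) * Z ⁻¹              ≈⟨ cancelZ _ ⟩
              ℙ p a (a ω)                           ≈⟨ a~A _ ⟩
              Pr A (a ω)                            ∎

          a⊥₀x : Independent p₀ a x
          a⊥₀x ω 0<k with likely-kernel 0<k
          ... | 0<p , same = begin
            ℙ p₀ (a ▵ x) (a ω , x ω)                        ≈⟨ ℙ-conditional 0<p₀ (a ▵ x) _ ⟩
            ℙ p ((a ▵ x) ▵ g) ((a ω , x ω) , g ω₀) * Z ⁻¹   ≈⟨ *-congʳ (ℙ-cong p
               (λ _ _ eq → ≡.cong (λ ((u , v) , γ) → u , (v , γ)) eq)
                   (λ _ _ eq → ≡.cong (λ (u , (v , γ)) → (u , v) , γ) eq)) ⟩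
            ℙ p (a ▵ (x ▵ g)) (a ω , (x ω , g ω₀)) * Z ⁻¹   ≈⟨ *-congʳ
                (≡.subst (λ γ → ℙ p (a ▵ (x ▵ g)) (a ω , (x ω , γ)) ≈ ℙ p a (a ω) * ℙ p (x ▵ g) (x ω , γ))
                same
                                                                  (entropic-independence p a (x ▵ g) a⊥x,g ω 0<p)) ⟩
            (ℙ p a (a ω) * ℙ p (x ▵ g) (x ω , g ω₀)) * Z ⁻¹ ≈⟨ *-assoc _ _ _ ⟩
            ℙ p a (a ω) * (ℙ p (x ▵ g) (x ω , g ω₀) * Z ⁻¹) ≈⟨ *-cong (trans (a~A _) (sym (a~₀A _)))
                (sym (ℙ-conditional 0<p₀ x _)) ⟩
            ℙ p₀ a (a ω) * ℙ p₀ x (x ω)                     ∎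
            where open ≈-Reasoning

        X = distribution p₀ x
        Y = distribution p₀ y

        fibre-H : ∀ (f : Element Ω → F₂^ n) F → HasLaw p₀ f F → Ent.H F ≈ fibreH f ω₀
        fibre-H f F f~F = trans (H-hasLaw p₀ f F f~F) (H-conditional 0<p₀ f)

        fibre-D : ∀ (f h : Element Ω → F₂^ n) F G {e} → HasLaw p₀ f F → HasLaw p₀ h G → Independent p₀ f h →
            Ent.H F ≈ e →
                  D F G ≈ (fibreH (λ ω → f ω ⊖ h ω) ω₀ + fibreH (λ ω → f ω ⊖ h ω) ω₀) - (e + fibreH h ω₀)
        fibre-D f h F G f~F h~G f⊥h HF≈ =
          +-cong (+-cong diff diff) (-‿cong (+-cong HF≈ (fibre-H h G h~G)))
          where diff = fibre-H _ (F ⊟ G) (difference-hasLaw p₀ f h F G f~F h~G f⊥h)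

      private
        𝔼-D : ∀ u v w → 𝔼 p (λ ω → (u ω + u ω) - (v ω + w ω)) ≈ (𝔼 p u + 𝔼 p u) - (𝔼 p v + 𝔼 p w)
        𝔼-D u v w = trans (𝔼-+ p _ _) (+-cong (𝔼-+ p u u) (trans (𝔼-neg p _) (-‿cong (𝔼-+ p v w))))

      conditional-lower-bound :
        t ≤ K * ((H p ((λ ω → x ω ⊖ y ω) ▵ g) + H p ((λ ω → x ω ⊖ y ω) ▵ g)) - (H p (x ▵ g) + H p (y ▵ g)))
          + ((((H p ((λ ω → a ω ⊖ x ω) ▵ g) + H p ((λ ω → a ω ⊖ x ω) ▵ g)) - H p g) - (Ent.H A + H p (x ▵ g)))
          +  (((H p ((λ ω → b ω ⊖ y ω) ▵ g) + H p ((λ ω → b ω ⊖ y ω) ▵ g)) - H p g) - (Ent.H B + H p (y ▵ g))))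
      conditional-lower-bound = begin
        t              ≈⟨ 𝔼-const p t ⟨
        𝔼 p (λ _ → t)  ≤⟨ 𝔼-mono p (λ ω₀ 0<p₀ → let open Fibre 0<p₀ in ≤.trans (lower X Y) (≤.reflexive (+-cong
                            (*-congˡ (fibre-D x y X Y (λ v → refl) (λ v → refl) x⊥y (fibre-H x X (λ v → refl))))
                            (+-cong (fibre-D a x A X (a~₀A {A = A} a~A a⊥x,g) (λ v → refl)
                                (a⊥₀x {A = A} a~A a⊥x,g) refl)
                                    (fibre-D b y B Y (a~₀A {A = B} b~B b⊥y,g) (λ v → refl)
                                        (a⊥₀x {A = B} b~B b⊥y,g) refl))))) ⟩
        𝔼 p (λ ω → K * ((h x-y ω + h x-y ω) - (h x ω + h y ω))
                 + (((h a-x ω + h a-x ω) - (Ent.H A + h x ω)) + ((h b-y ω + h b-y ω) - (Ent.H B + h y ω))))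
          ≈⟨ trans (𝔼-+ p _ _) (+-cong (trans (𝔼-*ˡ p K _) (*-congˡ (𝔼-D _ _ _))) (trans (𝔼-+ p _ _) (+-cong
               (trans (𝔼-D _ _ _) (+-congˡ (-‿cong (+-congʳ (𝔼-const p _)))))
               (trans (𝔼-D _ _ _) (+-congˡ (-‿cong (+-congʳ (𝔼-const p _)))))))) ⟩
        K * ((𝔼 p (h x-y) + 𝔼 p (h x-y)) - (𝔼 p (h x) + 𝔼 p (h y)))
          + (((𝔼 p (h a-x) + 𝔼 p (h a-x)) - (Ent.H A + 𝔼 p (h x))) +
              ((𝔼 p (h b-y) + 𝔼 p (h b-y)) - (Ent.H B + 𝔼 p (h y))))
          ≈⟨ +-cong (*-congˡ (+-cong (+-cong (𝔼-fibreH x-y) (𝔼-fibreH x-y))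
              (-‿cong (+-cong (𝔼-fibreH x) (𝔼-fibreH y)))))
               (+-cong (+-cong (+-cong (𝔼-fibreH a-x) (𝔼-fibreH a-x)) (-‿cong (+-congˡ (𝔼-fibreH x))))
                       (+-cong (+-cong (𝔼-fibreH b-y) (𝔼-fibreH b-y)) (-‿cong (+-congˡ (𝔼-fibreH y))))) ⟩
        _ ≈⟨ +-cong (*-congˡ (solve 4 (λ d x y g → ((d :- g) :+ (d :- g)) :- ((x :- g) :+ (y :- g)) :=
            (d :+ d) :- (x :+ y)) refl _ _ _ _))
               (+-cong (solve 4 (λ d x e g → ((d :- g) :+ (d :- g)) :- (e :+ (x :- g)) := ((d :+ d) :- g) :-
                   (e :+ x)) refl _ _ _ _)
                       (solve 4 (λ d x e g → ((d :- g) :+ (d :- g)) :- (e :+ (x :- g)) := ((d :+ d) :- g) :-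
                           (e :+ x)) refl _ _ _ _)) ⟩
        _ ∎
        where
        open ≤-Reasoning
        h = fibreH
        x-y a-x b-y : Element Ω → F₂^ n
        x-y ω = x ω ⊖ y ω
        a-x ω = a ω ⊖ x ω
        b-y ω = b ω ⊖ y ω

module LinearCombinations where

  module _ {n : ℕ} where

    ⊕-assoc : ∀ (u v w : F₂^ n) → (u ⊕ v) ⊕ w ≡ u ⊕ (v ⊕ w)
    ⊕-assoc = Vec.zipWith-assoc Bool.xor-assoc

    ⊕-comm : ∀ (u v : F₂^ n) → u ⊕ v ≡ v ⊕ u
    ⊕-comm = Vec.zipWith-comm Bool.xor-comm

    ⊕-identityʳ : ∀ (v : F₂^ n) → v ⊕ 𝟎 ≡ v
    ⊕-identityʳ = Vec.zipWith-identityʳ Bool.xor-identityʳ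

    ⊕-identityˡ : ∀ (v : F₂^ n) → 𝟎 ⊕ v ≡ v
    ⊕-identityˡ = Vec.zipWith-identityˡ Bool.xor-identityˡ

  ⊕-self : ∀ {n} (v : F₂^ n) → v ⊕ v ≡ 𝟎
  ⊕-self []      = ≡.refl
  ⊕-self (b ∷ v) = ≡.cong₂ _∷_ (Bool.xor-same b) (⊕-self v)

  ⊕-cancelʳ : ∀ {n} (u v : F₂^ n) → (u ⊕ v) ⊕ v ≡ u
  ⊕-cancelʳ u v = ≡.trans (⊕-assoc u v v) (≡.trans (≡.cong (u ⊕_) (⊕-self v)) (⊕-identityʳ u))

  ⊕-injectiveʳ : ∀ {n} {u u′ v v′ : F₂^ n} → u ⊕ v ≡ u′ ⊕ v′ → v ≡ v′ → u ≡ u′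
  ⊕-injectiveʳ {u = u} {u′} {v} eq ≡.refl =
    ≡.trans (≡.sym (⊕-cancelʳ u v)) (≡.trans (≡.cong (_⊕ v) eq) (⊕-cancelʳ u′ v))

  ⊕-interchange : ∀ {n} (a b c d : F₂^ n) → (a ⊕ b) ⊕ (c ⊕ d) ≡ (a ⊕ c) ⊕ (b ⊕ d)
  ⊕-interchange a b c d = begin
    (a ⊕ b) ⊕ (c ⊕ d)  ≡⟨ ⊕-assoc a b (c ⊕ d) ⟩
    a ⊕ (b ⊕ (c ⊕ d))  ≡⟨ ≡.cong (a ⊕_) (⊕-assoc b c d) ⟨
    a ⊕ ((b ⊕ c) ⊕ d)  ≡⟨ ≡.cong (λ x → a ⊕ (x ⊕ d)) (⊕-comm b c) ⟩
    a ⊕ ((c ⊕ b) ⊕ d)  ≡⟨ ≡.cong (a ⊕_) (⊕-assoc c b d) ⟩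
    a ⊕ (c ⊕ (b ⊕ d))  ≡⟨ ⊕-assoc a c (b ⊕ d) ⟨
    (a ⊕ c) ⊕ (b ⊕ d)  ∎
    where open ≡.≡-Reasoning

  -- A row of coefficients r stands for the combination Σ rᵢ vᵢ of k vectors.
  Row : ℕ → Set
  Row = F₂^

  module _ {n : ℕ} where

    accumulate : ∀ {k} → F₂^ n → Row k → Vec (F₂^ n) k → F₂^ n
    accumulate u []          []       = u
    accumulate u (false ∷ r) (v ∷ vs) = accumulate u r vs
    accumulate u (true ∷ r)  (v ∷ vs) = accumulate (u ⊕ v) r vs

    -- Written so that on a closed row it unfolds to a sum without a summand 𝟎.
    combine : ∀ {k} → Row k → Vec (F₂^ n) k → F₂^ n
    combine []          []       = 𝟎
    combine (false ∷ r) (v ∷ vs) = combine r vs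
    combine (true ∷ r)  (v ∷ vs) = accumulate v r vs

    accumulate≡ : ∀ {k} u (r : Row k) vs → accumulate u r vs ≡ u ⊕ combine r vs
    accumulate≡ u []          []       = ≡.sym (⊕-identityʳ u)
    accumulate≡ u (false ∷ r) (v ∷ vs) = accumulate≡ u r vs
    accumulate≡ u (true ∷ r)  (v ∷ vs) = begin
      accumulate (u ⊕ v) r vs    ≡⟨ accumulate≡ (u ⊕ v) r vs ⟩
      (u ⊕ v) ⊕ combine r vs     ≡⟨ ⊕-assoc u v _ ⟩
      u ⊕ (v ⊕ combine r vs)     ≡⟨ ≡.cong (u ⊕_) (accumulate≡ v r vs) ⟨
      u ⊕ accumulate v r vs      ∎
      where open ≡.≡-Reasoning

    combine-𝟎 : ∀ {k} (vs : Vec (F₂^ n) k) → combine 𝟎 vs ≡ 𝟎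
    combine-𝟎 []       = ≡.refl
    combine-𝟎 (v ∷ vs) = combine-𝟎 vs

    combine-⊕ : ∀ {k} (r s : Row k) vs → combine (r ⊕ s) vs ≡ combine r vs ⊕ combine s vs
    combine-⊕ []          []          []       = ≡.sym (⊕-self 𝟎)
    combine-⊕ (false ∷ r) (false ∷ s) (v ∷ vs) = combine-⊕ r s vs
    combine-⊕ (false ∷ r) (true ∷ s)  (v ∷ vs) = begin
      accumulate v (r ⊕ s) vs             ≡⟨ accumulate≡ v (r ⊕ s) vs ⟩
      v ⊕ combine (r ⊕ s) vs              ≡⟨ ≡.cong (v ⊕_) (≡.trans (combine-⊕ r s vs) (⊕-comm (combine r vs) _)) ⟩
      v ⊕ (combine s vs ⊕ combine r vs)   ≡⟨ ⊕-assoc v _ _ ⟨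
      (v ⊕ combine s vs) ⊕ combine r vs   ≡⟨ ⊕-comm _ (combine r vs) ⟩
      combine r vs ⊕ (v ⊕ combine s vs)   ≡⟨ ≡.cong (combine r vs ⊕_) (accumulate≡ v s vs) ⟨
      combine r vs ⊕ accumulate v s vs    ∎
      where open ≡.≡-Reasoning
    combine-⊕ (true ∷ r)  (false ∷ s) (v ∷ vs) = begin
      accumulate v (r ⊕ s) vs             ≡⟨ accumulate≡ v (r ⊕ s) vs ⟩
      v ⊕ combine (r ⊕ s) vs              ≡⟨ ≡.cong (v ⊕_) (combine-⊕ r s vs) ⟩
      v ⊕ (combine r vs ⊕ combine s vs)   ≡⟨ ⊕-assoc v _ _ ⟨
      (v ⊕ combine r vs) ⊕ combine s vs   ≡⟨ ≡.cong (_⊕ combine s vs) (accumulate≡ v r vs) ⟨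
      accumulate v r vs ⊕ combine s vs    ∎
      where open ≡.≡-Reasoning
    combine-⊕ (true ∷ r)  (true ∷ s)  (v ∷ vs) = begin
      combine (r ⊕ s) vs                                ≡⟨ combine-⊕ r s vs ⟩
      combine r vs ⊕ combine s vs                       ≡⟨ ⊕-identityˡ _ ⟨
      𝟎 ⊕ (combine r vs ⊕ combine s vs)                 ≡⟨ ≡.cong (_⊕ (combine r vs ⊕ combine s vs)) (⊕-self v) ⟨
      (v ⊕ v) ⊕ (combine r vs ⊕ combine s vs)           ≡⟨ ⊕-interchange v v _ _ ⟩
      (v ⊕ combine r vs) ⊕ (v ⊕ combine s vs)           ≡⟨ ≡.cong₂ _⊕_ (accumulate≡ v r vs) (accumulate≡ v s vs) ⟨
      accumulate v r vs ⊕ accumulate v s vs             ∎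
      where open ≡.≡-Reasoning

    evaluate : ∀ {k} → List (Row k) → Vec (F₂^ n) k → List (F₂^ n)
    evaluate M vs = map (λ r → combine r vs) M

  evaluate-++ : ∀ {k n} (M N : List (Row k)) (vs : Vec (F₂^ n) k) → evaluate (M ++ N) vs ≡ evaluate M vs ++
      evaluate N vs
  evaluate-++ M N vs = List.map-++ (λ r → combine r vs) M N

  evaluate-++⁻ : ∀ {k n} (M N : List (Row k)) {u w : Vec (F₂^ n) k} → evaluate (M ++ N) u ≡ evaluate (M ++ N) w →
                 evaluate M u ≡ evaluate M w × evaluate N u ≡ evaluate N w
  evaluate-++⁻ []      N eq = ≡.refl , eq
  evaluate-++⁻ (r ∷ M) N eq = let eqM , eqN = evaluate-++⁻ M N (List.∷-injectiveʳ eq) in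
    ≡.cong₂ _∷_ (List.∷-injectiveˡ eq) eqM , eqN

  isZero : ∀ {k} → Row k → Bool
  isZero []      = true
  isZero (b ∷ r) = not b ∧ isZero r

  inSpan : ∀ {k} → List (Row k) → Row k → Bool
  inSpan []      r = isZero r
  inSpan (s ∷ N) r = inSpan N r ∨ inSpan N (r ⊕ s)

  covers : ∀ {k} → List (Row k) → List (Row k) → Bool
  covers N []      = true
  covers N (r ∷ M) = inSpan N r ∧ covers N M

  isZero-sound : ∀ {k} (r : Row k) → T (isZero r) → r ≡ 𝟎
  isZero-sound []          _ = ≡.refl
  isZero-sound (false ∷ r) z = ≡.cong (false ∷_) (isZero-sound r z)

  inSpan-sound : ∀ {k n} (N : List (Row k)) r → T (inSpan N r) → (u w : Vec (F₂^ n) k) →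
                 evaluate N u ≡ evaluate N w → combine r u ≡ combine r w
  inSpan-sound [] r z u w _ rewrite isZero-sound r z = ≡.trans (combine-𝟎 u) (≡.sym (combine-𝟎 w))
  inSpan-sound (s ∷ N) r z u w eq with Equivalence.to Bool.T-∨ z
  ... | inj₁ z = inSpan-sound N r z u w (List.∷-injectiveʳ eq)
  ... | inj₂ z = ⊕-injectiveʳ (≡.trans (≡.sym (combine-⊕ r s u))
      (≡.trans (inSpan-sound N (r ⊕ s) z u w (List.∷-injectiveʳ eq)) (combine-⊕ r s w))) (List.∷-injectiveˡ eq)

  covers-sound : ∀ {k n} (N M : List (Row k)) → T (covers N M) → (u w : Vec (F₂^ n) k) →
                 evaluate N u ≡ evaluate N w → evaluate M u ≡ evaluate M w
  covers-sound N []      _ u w eq = ≡.refl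
  covers-sound N (r ∷ M) z u w eq with Equivalence.to Bool.T-∧ z
  ... | z₁ , z₂ = ≡.cong₂ _∷_ (inSpan-sound N r z₁ u w eq) (covers-sound N M z₂ u w eq)

  units : ∀ {k} → Row k → List (Row k)
  units []          = []
  units (false ∷ b) = map (false ∷_) (units b)
  units (true ∷ b)  = (true ∷ 𝟎) ∷ map (false ∷_) (units b)

  otherUnits : ∀ {k} → Row k → List (Row k)
  otherUnits b = units (Vec.map not b)

  evaluate-shift : ∀ {k n} (M : List (Row k)) (v : F₂^ n) vs → evaluate (map (false ∷_) M) (v ∷ vs) ≡ evaluate M vs
  evaluate-shift []      v vs = ≡.refl
  evaluate-shift (r ∷ M) v vs = ≡.cong (combine r vs ∷_) (evaluate-shift M v vs)

  combine-unit : ∀ {k n} (v : F₂^ n) (vs : Vec (F₂^ n) k) → combine (true ∷ 𝟎) (v ∷ vs) ≡ v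
  combine-unit v vs = ≡.trans (accumulate≡ v 𝟎 vs) (≡.trans (≡.cong (v ⊕_) (combine-𝟎 vs)) (⊕-identityʳ v))

  units-determine : ∀ {k n} (b : Row k) (u w : Vec (F₂^ n) k) → evaluate (units b) u ≡ evaluate (units b) w →
                    evaluate (otherUnits b) u ≡ evaluate (otherUnits b) w → u ≡ w
  units-determine []          []      []      _  _   = ≡.refl
  units-determine (false ∷ b) (v ∷ u) (v′ ∷ w) eq eq′ = ≡.cong₂ _∷_
    (≡.trans (≡.sym (combine-unit v u)) (≡.trans (List.∷-injectiveˡ eq′) (combine-unit v′ w)))
    (units-determine b u w
      (≡.trans (≡.sym (evaluate-shift (units b) v u)) (≡.trans eq (evaluate-shift (units b) v′ w)))
      (≡.trans (≡.sym (evaluate-shift (otherUnits b) v u))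
          (≡.trans (List.∷-injectiveʳ eq′) (evaluate-shift (otherUnits b) v′ w))))
  units-determine (true ∷ b)  (v ∷ u) (v′ ∷ w) eq eq′ = ≡.cong₂ _∷_
    (≡.trans (≡.sym (combine-unit v u)) (≡.trans (List.∷-injectiveˡ eq) (combine-unit v′ w)))
    (units-determine b u w
      (≡.trans (≡.sym (evaluate-shift (units b) v u))
          (≡.trans (List.∷-injectiveʳ eq) (evaluate-shift (units b) v′ w)))
      (≡.trans (≡.sym (evaluate-shift (otherUnits b) v u)) (≡.trans eq′ (evaluate-shift (otherUnits b) v′ w))))

module LinearEntropy (ℝ : RealField) where

  open RealField ℝ
  open OrderedField ℝ
  open FiniteProbability ℝ
  open Finite using (Element)
  open Law using (Likely)
  open LinearCombinations

  total : ∀ {A : Set} → (A → Carrier) → List A → Carrier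
  total f []      = 0#
  total f (r ∷ M) = f r + total f M

  total-map : ∀ {A B : Set} (f : B → Carrier) (g : A → B) M → total f (map g M) ≡ total (λ r → f (g r)) M
  total-map f g []      = ≡.refl
  total-map f g (r ∷ M) = ≡.cong (f (g r) +_) (total-map f g M)

  units-total : ∀ {k} (f : Row k → Carrier) (b : Row k) →
                total f (units b) + total f (otherUnits b) ≈ total f (units (replicate k true))
  units-total f [] = +-identityˡ 0#
  units-total f (false ∷ b) = trans (trans (solve 3 (λ x u v → u :+ (x :+ v) := x :+ (u :+ v)) refl _ _ _)
    (+-congˡ (+-cong (reflexive (total-map f (false ∷_) (units b)))
        (reflexive (total-map f (false ∷_) (otherUnits b))))))
    (+-congˡ (trans (units-total (λ r → f (false ∷ r)) b)
        (reflexive (≡.sym (total-map f (false ∷_) (units (replicate _ true)))))))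
  units-total f (true ∷ b) = trans (trans (+-assoc _ _ _)
    (+-congˡ (+-cong (reflexive (total-map f (false ∷_) (units b)))
        (reflexive (total-map f (false ∷_) (otherUnits b))))))
    (+-congˡ (trans (units-total (λ r → f (false ∷ r)) b)
        (reflexive (≡.sym (total-map f (false ∷_) (units (replicate _ true)))))))

  module Space {Ω : Finite} (p : Law Ω) {n k} (F : Element Ω → Vec (F₂^ n) k)
               (relations : List (Row k))
               (relations-hold : ∀ ω ω′ → Likely p ω → Likely p ω′ → evaluate relations (F ω) ≡ evaluate relations (F ω′)) where

    ⟪_⟫ : List (Row k) → Element Ω → List (F₂^ n)
    ⟪ M ⟫ ω = evaluate M (F ω)

    h : List (Row k) → Carrier
    h M = H p ⟪ M ⟫

    -- Computes to the unit type for suitable closed lists of rows; arguments of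
    -- this type are therefore implicit.
    infix 4 _⊒_
    _⊒_ : List (Row k) → List (Row k) → Set
    N ⊒ M = T (covers (N ++ relations) M)

    private
      determines : ∀ N M → N ⊒ M → _≼_ p ⟪ M ⟫ ⟪ N ⟫
      determines N M z ω ω′ 0<p 0<p′ eq = covers-sound (N ++ relations) M z (F ω) (F ω′)
        (≡.trans (evaluate-++ N relations _) (≡.trans (≡.cong₂ _++_ eq (relations-hold ω ω′ 0<p 0<p′))
          (≡.sym (evaluate-++ N relations _))))

      determines₂ : ∀ M N J → M ++ N ⊒ J → _≼_ p ⟪ J ⟫ (⟪ M ⟫ ▵ ⟪ N ⟫)
      determines₂ M N J z ω ω′ 0<p 0<p′ eq = determines (M ++ N) J z ω ω′ 0<p 0<p′
        (≡.trans (evaluate-++ M N _) (≡.trans (≡.cong₂ _++_ (≡.cong proj₁ eq) (≡.cong proj₂ eq))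
            (≡.sym (evaluate-++ M N _))))

    mono : ∀ M N {c : N ⊒ M} → h M ≤ h N
    mono M N {c} = H-mono p (determines N M c)

    same : ∀ M N {c : N ⊒ M} {c′ : M ⊒ N} → h M ≈ h N
    same M N {c} {c′} = ≤.antisym (mono M N {c}) (mono N M {c′})

    submod : ∀ M N J I {c₁ : M ++ N ⊒ J}
             {c₂ : M ⊒ I} {c₃ : N ⊒ I} → h J + h I ≤ h M + h N
    submod M N J I {c₁} {c₂} {c₃} = ≤.trans (+-monoˡ-≤ _ (H-mono p (determines₂ M N J c₁)))
      (submodular p ⟪ M ⟫ ⟪ N ⟫ ⟪ I ⟫ (determines M I c₂) (determines N I c₃))

    h-[] : h [] ≈ 0#
    h-[] = trans (H-cong p (λ _ _ _ _ _ → ≡.refl) (λ _ _ _ _ _ → ≡.refl)) (H-const p)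

    h-nonneg : ∀ M → 0# ≤ h M
    h-nonneg M = H-nonneg p ⟪ M ⟫

    private
      join : ∀ M N → _≼_ p ⟪ M ++ N ⟫ (⟪ M ⟫ ▵ ⟪ N ⟫)
      join M N ω ω′ _ _ eq = ≡.trans (evaluate-++ M N _)
        (≡.trans (≡.cong₂ _++_ (≡.cong proj₁ eq) (≡.cong proj₂ eq)) (≡.sym (evaluate-++ M N _)))

      split : ∀ M N → _≼_ p (⟪ M ⟫ ▵ ⟪ N ⟫) ⟪ M ++ N ⟫
      split M N ω ω′ _ _ eq = let eqM , eqN = evaluate-++⁻ M N eq in ≡.cong₂ _,_ eqM eqN

    subadd : ∀ M N → h (M ++ N) ≤ h M + h N
    subadd M N = ≤.trans (H-mono p (join M N)) (subadditive p ⟪ M ⟫ ⟪ N ⟫)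

    h≤total : ∀ M → h M ≤ total (λ r → h (r ∷ [])) M
    h≤total []      = ≤.reflexive h-[]
    h≤total (r ∷ M) = ≤.trans (subadd (r ∷ []) M) (≤.refl ⟨+⟩ h≤total M)

    restrict : ∀ I J M N {c} {c₁ : I ⊒ M} {c₂ : J ⊒ N} →
               h I + h J ≤ h (I ++ J) + c → h M + h N ≤ h (M ++ N) + c
    restrict I J M N {c} {c₁} {c₂} le = ≤.trans
      (mutual-information-mono p ⟪ I ⟫ ⟪ J ⟫ ⟪ M ⟫ ⟪ N ⟫ (determines I M c₁) (determines J N c₂)
        (≤.trans le (+-monoˡ-≤ c (H-mono p (join I J)))))
      (+-monoˡ-≤ c (H-mono p (split M N)))

    module Independence (independent : total (λ r → h (r ∷ [])) (units (replicate k true)) ≤ h (units (replicate k true))) where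

      private
        complementary : ∀ b → h (units b) + h (otherUnits b) ≤ h (units b ++ otherUnits b)
        complementary b = begin
          h (units b) + h (otherUnits b)   ≤⟨ h≤total (units b) ⟨+⟩ h≤total (otherUnits b) ⟩
          _                                         ≈⟨ units-total _ b ⟩
          _                                         ≤⟨ independent ⟩
          h (units (replicate k true))              ≤⟨ H-mono p (λ ω ω′ _ _ eq → let eqb , eqb′ = evaluate-++⁻ (units b) _ eq in
                                                         ≡.cong (evaluate (units (replicate k true)))
                                                             (units-determine b (F ω) (F ω′) eqb eqb′)) ⟩
          h (units b ++ otherUnits b)      ∎
          where open ≤-Reasoning

      independence : ∀ b M N {c₁ : units b ⊒ M} {c₂ : otherUnits b ⊒ N} →
                     h M + h N ≤ h (M ++ N)
      independence b M N {c₁} {c₂} = ≤.trans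
        (restrict (units b) (otherUnits b) M N {0#} {c₁} {c₂}
          (≤.trans (complementary b) (≤.reflexive (sym (+-identityʳ _)))))
        (≤.reflexive (+-identityʳ _))

module CoreInequality (ℝ : RealField) where

  open RealField ℝ
  open OrderedField ℝ
  open FiniteProbability ℝ
  open Conditioning ℝ
  open RandomVariables ℝ
  open Finite using (Element)
  open Law using (Likely)
  open LinearCombinations
  open LinearEntropy ℝ
  private module Ent = Entropy ℝ
  open Ent using (RandomVariable)

  module Uses {n} (K t : Carrier) (0≤K : 0# ≤ K) (A B : RandomVariable n)
              (lower : ∀ X Y → t ≤ K * D X Y + (D A X + D B Y)) where

    open Disintegration K t 0≤K A B lower

    Hₗ : ∀ {Ω} → Law Ω → (Element Ω → List (F₂^ n)) → Carrier
    Hₗ p = H p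

    module _ {Ω : Finite} (p : Law Ω) (x y a b : Element Ω → F₂^ n) (g : Element Ω → List (F₂^ n))
             (a~A : HasLaw p a A) (b~B : HasLaw p b B)
             (x⊥y∣g : Hₗ p (λ ω → x ω ∷ g ω) + Hₗ p (λ ω → y ω ∷ g ω) ≤ Hₗ p (λ ω → x ω ∷ y ω ∷ g ω) + H p g)
             (a⊥x,g : H p a + Hₗ p (λ ω → x ω ∷ g ω) ≤ Hₗ p (λ ω → a ω ∷ x ω ∷ g ω))
             (b⊥y,g : H p b + Hₗ p (λ ω → y ω ∷ g ω) ≤ Hₗ p (λ ω → b ω ∷ y ω ∷ g ω)) where

      private
        cons : ∀ (x : Element Ω → F₂^ n) (g : Element Ω → List (F₂^ n)) → H p (x ▵ g) ≈ Hₗ p (λ ω → x ω ∷ g ω)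
        cons x g = H-cong p (λ _ _ _ _ eq → ≡.cong₂ _,_ (List.∷-injectiveˡ eq) (List.∷-injectiveʳ eq))
                            (λ _ _ _ _ eq → ≡.cong₂ _∷_ (≡.cong proj₁ eq) (≡.cong proj₂ eq))

        independent-cons : ∀ (a x : Element Ω → F₂^ n) → H p a + Hₗ p (λ ω → x ω ∷ g ω) ≤ Hₗ p
            (λ ω → a ω ∷ x ω ∷ g ω) →
                           H p a + H p (x ▵ g) ≤ H p (a ▵ (x ▵ g))
        independent-cons a x le = ≤.trans (≤.reflexive (+-congˡ (cons x g))) (≤.trans le (H-mono p λ _ _ _ _ eq →
          ≡.cong₂ _∷_ (≡.cong proj₁ eq) (≡.cong₂ _∷_ (≡.cong (proj₁ ∘ proj₂) eq) (≡.cong (proj₂ ∘ proj₂) eq))))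

      lower-bound :
        t ≤ K * ((Hₗ p (λ ω → (x ω ⊕ y ω) ∷ g ω) + Hₗ p (λ ω → (x ω ⊕ y ω) ∷ g ω)) -
            (Hₗ p (λ ω → x ω ∷ g ω) + Hₗ p (λ ω → y ω ∷ g ω)))
          + ((((Hₗ p (λ ω → (a ω ⊕ x ω) ∷ g ω) + Hₗ p (λ ω → (a ω ⊕ x ω) ∷ g ω)) - H p g) -
              (Ent.H A + Hₗ p (λ ω → x ω ∷ g ω)))
          +  (((Hₗ p (λ ω → (b ω ⊕ y ω) ∷ g ω) + Hₗ p (λ ω → (b ω ⊕ y ω) ∷ g ω)) - H p g) -
              (Ent.H B + Hₗ p (λ ω → y ω ∷ g ω))))
      lower-bound = ≤.trans
        (conditional-lower-bound p x y a b g a~A b~B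
          (≤.trans (≤.reflexive (+-cong (cons x g) (cons y g))) (≤.trans x⊥y∣g (+-monoˡ-≤ _ (H-mono p λ _ _ _ _ eq →
            ≡.cong₂ _∷_ (≡.cong (proj₁ ∘ proj₁) eq)
                (≡.cong₂ _∷_ (≡.cong (proj₁ ∘ proj₂) eq) (≡.cong (proj₂ ∘ proj₂) eq))))))
          (independent-cons a x a⊥x,g) (independent-cons b y b⊥y,g))
        (≤.reflexive (+-cong (*-congˡ (+-cong (twice (cons _ g)) (-‿cong (+-cong (cons x g) (cons y g)))))
          (+-cong (+-cong (+-congʳ (twice (cons _ g))) (-‿cong (+-congˡ (cons x g))))
                  (+-cong (+-congʳ (twice (cons _ g))) (-‿cong (+-congˡ (cons y g)))))))
        where
        twice : ∀ {u v} → u ≈ v → u + u ≈ v + v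
        twice u≈v = +-cong u≈v u≈v

    -- The entropic Balog–Szemerédi–Gowers argument: apply the lower bound to T₁ and an
    -- independent copy of T₂, conditionally on T₁ ⊕ T₂ and s.
    module _ {Ω : Finite} (p : Law Ω) (T₁ T₂ s a b : Element Ω → F₂^ n)
             (a~A : HasLaw p a A) (b~B : HasLaw p b B)
             (a⊥ : H p a + Hₗ p (λ ω → T₁ ω ∷ (T₁ ω ⊕ T₂ ω) ∷ s ω ∷ []) ≤ Hₗ p
                 (λ ω → a ω ∷ T₁ ω ∷ (T₁ ω ⊕ T₂ ω) ∷ s ω ∷ []))
             (b⊥ : H p b + Hₗ p (λ ω → T₂ ω ∷ (T₁ ω ⊕ T₂ ω) ∷ s ω ∷ []) ≤ Hₗ p (λ ω → b ω ∷ T₂ ω ∷ (T₁ ω ⊕ T₂ ω) ∷ s ω ∷ [])) where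

      private
        g : Element Ω → List (F₂^ n)
        g ω = (T₁ ω ⊕ T₂ ω) ∷ s ω ∷ []

        open Conditional p g

        F : Element (Ω ⊗ Ω) → Vec (F₂^ n) 8
        F (ω , ω′) = a ω ∷ b ω′ ∷ T₁ ω ∷ T₂ ω ∷ s ω ∷ T₁ ω′ ∷ T₂ ω′ ∷ s ω′ ∷ []

        a₁ b₁ s₁ a₂ b₂ s₂ α β : Row 8
        α  = true ∷ 𝟎
        β  = false ∷ true ∷ 𝟎
        a₁ = false ∷ false ∷ true ∷ 𝟎
        b₁ = false ∷ false ∷ false ∷ true ∷ 𝟎
        s₁ = false ∷ false ∷ false ∷ false ∷ true ∷ 𝟎
        a₂ = false ∷ false ∷ false ∷ false ∷ false ∷ true ∷ 𝟎
        b₂ = false ∷ false ∷ false ∷ false ∷ false ∷ false ∷ true ∷ 𝟎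
        s₂ = false ∷ false ∷ false ∷ false ∷ false ∷ false ∷ false ∷ true ∷ 𝟎

        relations : List (Row 8)
        relations = (a₁ ⊕ b₁ ⊕ a₂ ⊕ b₂) ∷ (s₁ ⊕ s₂) ∷ []

        relations-vanish : ∀ ω → Likely coupling ω → evaluate relations (F ω) ≡ 𝟎 ∷ 𝟎 ∷ []
        relations-vanish (ω , ω′) 0<q = ≡.cong₂ (λ u v → u ∷ v ∷ [])
          (≡.trans (⊕-assoc (T₁ ω ⊕ T₂ ω) (T₁ ω′) (T₂ ω′))
              (≡.trans (≡.cong ((T₁ ω ⊕ T₂ ω) ⊕_) (List.∷-injectiveˡ same-g)) (⊕-self _)))
          (≡.trans (≡.cong (s ω ⊕_) (List.∷-injectiveˡ (List.∷-injectiveʳ same-g))) (⊕-self _))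
          where same-g = proj₂ (proj₂ (likely-coupling 0<q))

        open Space coupling F relations (λ ω ω′ 0<q 0<q′ → ≡.trans (relations-vanish ω 0<q)
            (≡.sym (relations-vanish ω′ 0<q′)))

        z = a₁ ⊕ b₁
        I J : List (Row 8)
        I = a₁ ∷ b₁ ∷ s₁ ∷ []
        J = a₂ ∷ b₂ ∷ s₂ ∷ []

        hg-fst : H p g ≈ h (z ∷ s₁ ∷ [])
        hg-fst = H-coupling-fst g

        conditionally-independent : h I + h J ≤ h (I ++ J) + h (z ∷ s₁ ∷ [])
        conditionally-independent = ≤.trans
          (mutual-information-mono coupling proj₁ proj₂ ⟪ I ⟫ ⟪ J ⟫
            (λ { (_ , _) (_ , _) _ _ ≡.refl → ≡.refl }) (λ { (_ , _) (_ , _) _ _ ≡.refl → ≡.refl })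
            (≤.trans (≤.reflexive (trans (sym (+-cong (H-coupling-fst id) (H-coupling-snd id))) (sym H-coupling)))
              (≤.trans (+-monoˡ-≤ _ (H-mono coupling λ _ _ _ _ eq → ≡.cong₂ _,_ (≡.cong proj₁ eq)
                  (≡.cong proj₂ eq)))
                       (≤.reflexive (+-congˡ hg-fst)))))
          (+-monoˡ-≤ _ (H-mono coupling λ { ω ω′ _ _ eq → ≡.cong₂ _,_
            (≡.cong (λ { (u ∷ v ∷ w ∷ _) → u ∷ v ∷ w ∷ [] ; l → l }) eq)
            (≡.cong (λ { (_ ∷ _ ∷ _ ∷ l) → l ; l → l }) eq) }))

        fstₗ : (f : Element Ω → List (F₂^ n)) → Hₗ p f ≈ Hₗ coupling (f ∘ proj₁)
        fstₗ = H-coupling-fst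

        sndₗ : (f : Element Ω → List (F₂^ n)) → Hₗ p f ≈ Hₗ coupling (f ∘ proj₂)
        sndₗ = H-coupling-snd

        h-T₁  = fstₗ (λ ω → T₁ ω ∷ s ω ∷ [])
        h-T₁′ = sndₗ (λ ω → T₁ ω ∷ s ω ∷ [])
        h-T₂  = fstₗ (λ ω → T₂ ω ∷ s ω ∷ [])
        h-T₂′ = sndₗ (λ ω → T₂ ω ∷ s ω ∷ [])
        h-s   = fstₗ (λ ω → s ω ∷ [])
        h-I   = fstₗ (λ ω → T₁ ω ∷ T₂ ω ∷ s ω ∷ [])
        h-J   = sndₗ (λ ω → T₁ ω ∷ T₂ ω ∷ s ω ∷ [])

        joint : Carrier
        joint = Hₗ p (λ ω → T₁ ω ∷ T₂ ω ∷ s ω ∷ [])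

        sum-bound : h ((a₁ ⊕ b₂) ∷ z ∷ s₁ ∷ []) + # 3 * Hₗ p (λ ω → s ω ∷ []) + # 2 * joint ≤
          # 2 * (Hₗ p (λ ω → T₁ ω ∷ s ω ∷ []) + Hₗ p (λ ω → T₂ ω ∷ s ω ∷ []) + Hₗ p g)
        sum-bound = ≤-via
          (solve 10 (λ d s j T₁ T₂ g ds a₁b₂ b₁a₂ IJ → :# 2 :* (T₁ :+ T₂ :+ g) :+
              ((d :+ s) :+ (IJ :+ ds) :+ (a₁b₂ :+ s) :+ (b₁a₂ :+ s) :+ (j :+ j))
            := (d :+ :# 3 :* s :+ :# 2 :* j) :+
              ((ds :+ g) :+ (a₁b₂ :+ b₁a₂) :+ (T₁ :+ T₂) :+ (T₂ :+ T₁) :+ (IJ :+ g)))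
            refl _ _ _ _ _ _ _ _ _ _)
          (≤.trans (≤.reflexive (+-congˡ h-s)) (≤.trans
              (submod ((a₁ ⊕ b₂) ∷ s₁ ∷ []) (z ∷ s₁ ∷ []) ((a₁ ⊕ b₂) ∷ z ∷ s₁ ∷ []) (s₁ ∷ []))
             (≤.reflexive (+-congˡ (sym hg-fst))))
           ⟨+⟩ ≤.trans (+-monoˡ-≤ _ (mono (I ++ J) (a₁ ∷ b₁ ∷ a₂ ∷ s₁ ∷ [])))
                 (submod (a₁ ∷ b₂ ∷ s₁ ∷ []) (b₁ ∷ a₂ ∷ s₁ ∷ []) (a₁ ∷ b₁ ∷ a₂ ∷ s₁ ∷ []) ((a₁ ⊕ b₂) ∷ s₁ ∷ []))
           ⟨+⟩ ≤.trans (≤.reflexive (+-congˡ h-s)) (≤.trans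
               (submod (a₁ ∷ s₁ ∷ []) (b₂ ∷ s₂ ∷ []) (a₁ ∷ b₂ ∷ s₁ ∷ []) (s₁ ∷ []))
                 (≤.reflexive (+-cong (sym h-T₁) (sym h-T₂′))))
           ⟨+⟩ ≤.trans (≤.reflexive (+-congˡ h-s)) (≤.trans
               (submod (b₁ ∷ s₁ ∷ []) (a₂ ∷ s₂ ∷ []) (b₁ ∷ a₂ ∷ s₁ ∷ []) (s₁ ∷ []))
                 (≤.reflexive (+-cong (sym h-T₂) (sym h-T₁′))))
           ⟨+⟩ ≤.trans (≤.reflexive (+-cong h-I h-J))
               (≤.trans conditionally-independent (≤.reflexive (+-congˡ (sym hg-fst)))))

      bsg-lower-bound :
        t ≤ K * (# 4 * (Hₗ p (λ ω → T₁ ω ∷ s ω ∷ []) + Hₗ p (λ ω → T₂ ω ∷ s ω ∷ []) + Hₗ p g)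
                 - # 6 * Hₗ p (λ ω → s ω ∷ []) - # 6 * Hₗ p (λ ω → T₁ ω ∷ T₂ ω ∷ s ω ∷ []))
          + ((((Hₗ p (λ ω → (a ω ⊕ T₁ ω) ∷ g ω) + Hₗ p (λ ω → (a ω ⊕ T₁ ω) ∷ g ω)) - H p g) -
              (Ent.H A + Hₗ p (λ ω → T₁ ω ∷ g ω)))
          +  (((Hₗ p (λ ω → (b ω ⊕ T₂ ω) ∷ g ω) + Hₗ p (λ ω → (b ω ⊕ T₂ ω) ∷ g ω)) - H p g) -
              (Ent.H B + Hₗ p (λ ω → T₂ ω ∷ g ω))))
      bsg-lower-bound = ≤.trans
        (lower-bound coupling (T₁ ∘ proj₁) (T₂ ∘ proj₂) (a ∘ proj₁) (b ∘ proj₂) (g ∘ proj₁)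
          (λ v → trans (𝔼-coupling-fst _) (a~A v)) (λ v → trans (𝔼-coupling-snd _) (b~B v))
          (≤.trans (restrict I J (a₁ ∷ z ∷ s₁ ∷ []) (b₂ ∷ z ∷ s₁ ∷ []) conditionally-independent)
            (+-monoˡ-≤ _ (mono (a₁ ∷ z ∷ s₁ ∷ b₂ ∷ z ∷ s₁ ∷ []) (a₁ ∷ b₂ ∷ z ∷ s₁ ∷ []))))
          (≤.trans (≤.reflexive (sym (+-cong (H-coupling-fst a) x-fst)))
              (≤.trans a⊥ (≤.reflexive (fstₗ (λ ω → a ω ∷ T₁ ω ∷ g ω)))))
          (≤.trans (≤.reflexive (+-cong (sym (H-coupling-snd b)) (sym y-snd)))
            (≤.trans b⊥ (≤.trans (≤.reflexive (sndₗ (λ ω → b ω ∷ T₂ ω ∷ g ω)))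
                (mono (β ∷ b₂ ∷ (a₂ ⊕ b₂) ∷ s₂ ∷ []) (β ∷ b₂ ∷ z ∷ s₁ ∷ []))))))
        ((0≤K ⟨*⟩ ≤-via
            (solve 8 (λ d x y j s g T₁ T₂ → (:# 4 :* (T₁ :+ T₂ :+ g) :- :# 6 :* s :- :# 6 :* j) :+
                ((d :+ :# 3 :* s :+ :# 2 :* j) :+ (d :+ :# 3 :* s :+ :# 2 :* j) :+ j :+ j)
                := ((d :+ d) :- (x :+ y)) :+ (:# 2 :* (T₁ :+ T₂ :+ g) :+ :# 2 :* (T₁ :+ T₂ :+ g) :+ x :+ y))
                    refl _ _ _ _ _ _ _ _)
            (sum-bound ⟨+⟩ sum-bound ⟨+⟩ ≤.reflexive j≈x ⟨+⟩ ≤.reflexive j≈y))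
         ⟨+⟩ ≤.reflexive (+-cong
           (+-cong (+-cong (sym (+-cong a-x a-x)) (-‿cong (sym (H-coupling-fst g)))) (-‿cong (+-congˡ (sym x-fst))))
           (+-cong (+-cong (sym (+-cong b-y b-y)) (-‿cong (sym (H-coupling-fst g))))
               (-‿cong (+-congˡ (sym y-snd))))))
        where
        j≈x : joint ≈ h (a₁ ∷ z ∷ s₁ ∷ [])
        j≈x = trans h-I (same I (a₁ ∷ z ∷ s₁ ∷ []))
        j≈y : joint ≈ h (b₂ ∷ z ∷ s₁ ∷ [])
        j≈y = trans h-J (same J (b₂ ∷ z ∷ s₁ ∷ []))
        x-fst : Hₗ p (λ ω → T₁ ω ∷ g ω) ≈ h (a₁ ∷ z ∷ s₁ ∷ [])
        x-fst = fstₗ (λ ω → T₁ ω ∷ g ω)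
        y-snd : Hₗ p (λ ω → T₂ ω ∷ g ω) ≈ h (b₂ ∷ z ∷ s₁ ∷ [])
        y-snd = trans (sndₗ (λ ω → T₂ ω ∷ g ω)) (same (b₂ ∷ (a₂ ⊕ b₂) ∷ s₂ ∷ []) (b₂ ∷ z ∷ s₁ ∷ []))
        a-x : Hₗ p (λ ω → (a ω ⊕ T₁ ω) ∷ g ω) ≈ h ((α ⊕ a₁) ∷ z ∷ s₁ ∷ [])
        a-x = fstₗ (λ ω → (a ω ⊕ T₁ ω) ∷ g ω)
        b-y : Hₗ p (λ ω → (b ω ⊕ T₂ ω) ∷ g ω) ≈ h ((β ⊕ b₂) ∷ z ∷ s₁ ∷ [])
        b-y = trans (sndₗ (λ ω → (b ω ⊕ T₂ ω) ∷ g ω))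
            (same ((β ⊕ b₂) ∷ (a₂ ⊕ b₂) ∷ s₂ ∷ []) ((β ⊕ b₂) ∷ z ∷ s₁ ∷ []))

module SextupleInequality (ℝ : RealField) where

  open RealField ℝ
  open OrderedField ℝ
  open FiniteProbability ℝ
  open RandomVariables ℝ
  open Finite using (Element)
  open LinearCombinations
  open LinearEntropy ℝ
  open CoreInequality ℝ
  private module Ent = Entropy ℝ
  open Ent using (RandomVariable; _⊟_)

  module Sextuple {n} (K t₀ : Carrier) (0≤K : 0# ≤ K) (A B : RandomVariable n)
                  (lower : ∀ X Y → t₀ ≤ K * D X Y + (D A X + D B Y)) (P Q : RandomVariable n)
                  {Ω : Finite} (p : Law Ω) (a b x₁ x₂ x₃ x₄ : Element Ω → F₂^ n)
                  (a~A : HasLaw p a A) (b~B : HasLaw p b B)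
                  (x₁~P : HasLaw p x₁ P) (x₂~Q : HasLaw p x₂ Q) (x₃~P : HasLaw p x₃ P) (x₄~Q : HasLaw p x₄ Q) where

    open Uses K t₀ 0≤K A B lower

    private
      F : Element Ω → Vec (F₂^ n) 6
      F ω = a ω ∷ b ω ∷ x₁ ω ∷ x₂ ω ∷ x₃ ω ∷ x₄ ω ∷ []

      α β ξ₁ ξ₂ ξ₃ ξ₄ : Row 6
      α  = true ∷ 𝟎
      β  = false ∷ true ∷ 𝟎
      ξ₁ = false ∷ false ∷ true ∷ 𝟎
      ξ₂ = false ∷ false ∷ false ∷ true ∷ 𝟎
      ξ₃ = false ∷ false ∷ false ∷ false ∷ true ∷ 𝟎
      ξ₄ = false ∷ false ∷ false ∷ false ∷ false ∷ true ∷ 𝟎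

    open Space p F [] (λ _ _ _ _ → ≡.refl)

    module _ (independent : total (λ r → h (r ∷ [])) (units (replicate 6 true)) ≤ h (units (replicate 6 true))) where

      open Independence independent

      HA HB HP HQ AP BQ PQ PP QQ t : Carrier
      HA = Ent.H A
      HB = Ent.H B
      HP = Ent.H P
      HQ = Ent.H Q
      AP = Ent.H (A ⊟ P)
      BQ = Ent.H (B ⊟ Q)
      PQ = Ent.H (P ⊟ Q)
      PP = Ent.H (P ⊟ P)
      QQ = Ent.H (Q ⊟ Q)

      υ₁ υ₂ υ₃ σ : Row 6
      υ₁ = ξ₁ ⊕ ξ₂
      υ₂ = ξ₂ ⊕ ξ₃
      υ₃ = ξ₁ ⊕ ξ₃
      σ  = ξ₁ ⊕ ξ₂ ⊕ ξ₃ ⊕ ξ₄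

      even : List (Row 6)
      even = υ₁ ∷ υ₂ ∷ σ ∷ []

      t = h even

      H-≡ : ∀ {T : Set} {f g : Element Ω → T} → (∀ ω → f ω ≡ g ω) → H p f ≈ H p g
      H-≡ eq = H-cong p (λ ω ω′ _ _ e → ≡.trans (eq ω) (≡.trans e (≡.sym (eq ω′))))
                        (λ ω ω′ _ _ e → ≡.trans (≡.sym (eq ω)) (≡.trans e (eq ω′)))

      private
        value : ∀ (x : Element Ω → F₂^ n) X → HasLaw p x X → Hₗ p (λ ω → x ω ∷ []) ≈ Ent.H X
        value x X x~X = trans (H-cong p (λ _ _ _ _ → ≡.cong (_∷ [])) (λ _ _ _ _ → List.∷-injectiveˡ))
            (sym (H-hasLaw p x X x~X))

        pair-value : ∀ (x y : Element Ω → F₂^ n) X Y → HasLaw p x X → HasLaw p y Y →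
                     Hₗ p (λ ω → x ω ∷ []) + Hₗ p (λ ω → y ω ∷ []) ≤ Hₗ p (λ ω → x ω ∷ y ω ∷ []) →
                     Hₗ p (λ ω → (x ω ⊕ y ω) ∷ []) ≈ Ent.H (X ⊟ Y)
        pair-value x y X Y x~X y~Y le = value _ (X ⊟ Y)
            (difference-hasLaw p x y X Y x~X y~Y (entropic-independence p x y
          (≤.trans (≤.reflexive (+-cong (single x) (single y))) (≤.trans le
            (H-mono p λ _ _ _ _ eq → ≡.cong₂ (λ u v → u ∷ v ∷ []) (≡.cong proj₁ eq) (≡.cong proj₂ eq))))))
          where
          single : ∀ (x : Element Ω → F₂^ n) → H p x ≈ Hₗ p (λ ω → x ω ∷ [])
          single x = H-cong p (λ _ _ _ _ → List.∷-injectiveˡ) (λ _ _ _ _ → ≡.cong (_∷ []))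

        h-ξ₁ : h (ξ₁ ∷ []) ≈ HP
        h-ξ₁ = value x₁ P x₁~P
        h-ξ₂ : h (ξ₂ ∷ []) ≈ HQ
        h-ξ₂ = value x₂ Q x₂~Q
        h-ξ₃ : h (ξ₃ ∷ []) ≈ HP
        h-ξ₃ = value x₃ P x₃~P
        h-ξ₄ : h (ξ₄ ∷ []) ≈ HQ
        h-ξ₄ = value x₄ Q x₄~Q
        h-12 : h ((ξ₁ ⊕ ξ₂) ∷ []) ≈ PQ
        h-12 = pair-value x₁ x₂ P Q x₁~P x₂~Q (independence ξ₁ (ξ₁ ∷ []) (ξ₂ ∷ []))
        h-14 : h ((ξ₁ ⊕ ξ₄) ∷ []) ≈ PQ
        h-14 = pair-value x₁ x₄ P Q x₁~P x₄~Q (independence ξ₁ (ξ₁ ∷ []) (ξ₄ ∷ []))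
        h-34 : h ((ξ₃ ⊕ ξ₄) ∷ []) ≈ PQ
        h-34 = pair-value x₃ x₄ P Q x₃~P x₄~Q (independence ξ₃ (ξ₃ ∷ []) (ξ₄ ∷ []))
        h-23 : h ((ξ₂ ⊕ ξ₃) ∷ []) ≈ PQ
        h-23 = trans (H-≡ λ ω → ≡.cong (_∷ []) (⊕-comm (x₂ ω) (x₃ ω)))
          (pair-value x₃ x₂ P Q x₃~P x₂~Q (independence ξ₃ (ξ₃ ∷ []) (ξ₂ ∷ [])))
        h-13 : h ((ξ₁ ⊕ ξ₃) ∷ []) ≈ PP
        h-13 = pair-value x₁ x₃ P P x₁~P x₃~P (independence ξ₁ (ξ₁ ∷ []) (ξ₃ ∷ []))
        h-24 : h ((ξ₂ ⊕ ξ₄) ∷ []) ≈ QQ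
        h-24 = pair-value x₂ x₄ Q Q x₂~Q x₄~Q (independence ξ₂ (ξ₂ ∷ []) (ξ₄ ∷ []))
        h-α1 : h ((α ⊕ ξ₁) ∷ []) ≈ AP
        h-α1 = pair-value a x₁ A P a~A x₁~P (independence α (α ∷ []) (ξ₁ ∷ []))
        h-α3 : h ((α ⊕ ξ₃) ∷ []) ≈ AP
        h-α3 = pair-value a x₃ A P a~A x₃~P (independence α (α ∷ []) (ξ₃ ∷ []))
        h-β2 : h ((β ⊕ ξ₂) ∷ []) ≈ BQ
        h-β2 = pair-value b x₂ B Q b~B x₂~Q (independence β (β ∷ []) (ξ₂ ∷ []))

      kaimanovich-vershik : ∀ Y Z₁ Z₂ {u v w}
        {c₁ : ((Y ⊕ Z₁) ∷ Z₂ ∷ []) ++ (Y ∷ (Z₁ ⊕ Z₂) ∷ []) ⊒ Y ∷ Z₁ ∷ Z₂ ∷ []}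
        {c₂ : (Y ⊕ Z₁) ∷ Z₂ ∷ [] ⊒ (Y ⊕ Z₁ ⊕ Z₂) ∷ []}
        {c₃ : Y ∷ (Z₁ ⊕ Z₂) ∷ [] ⊒ (Y ⊕ Z₁ ⊕ Z₂) ∷ []}
        {c₄ : units Y ⊒ Y ∷ []} {c₅ : otherUnits Y ⊒ Z₁ ∷ Z₂ ∷ []}
        {c₆ : units Z₁ ⊒ Z₁ ∷ []} {c₇ : otherUnits Z₁ ⊒ Z₂ ∷ []} →
        h ((Y ⊕ Z₁) ∷ []) ≈ u → h ((Z₁ ⊕ Z₂) ∷ []) ≈ v → h (Z₁ ∷ []) ≈ w →
        h ((Y ⊕ Z₁ ⊕ Z₂) ∷ []) ≤ (u + v) - w
      kaimanovich-vershik Y Z₁ Z₂ {c₁ = c₁} {c₂} {c₃} {c₄} {c₅} {c₆} {c₇} ≈u ≈v ≈w = ≤.trans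
        (≤-via (solve 10 (λ yzz yz₁ z₁₂ z₁ z₂ y J M N Z → ((yz₁ :+ z₁₂) :- z₁) :+
            ((J :+ yzz) :+ M :+ N :+ (y :+ Z) :+ (z₁ :+ z₂))
                 := yzz :+ ((M :+ N) :+ (yz₁ :+ z₂) :+ (y :+ z₁₂) :+ J :+ Z)) refl _ _ _ _ _ _ _ _ _ _)
          (submod ((Y ⊕ Z₁) ∷ Z₂ ∷ []) (Y ∷ (Z₁ ⊕ Z₂) ∷ []) (Y ∷ Z₁ ∷ Z₂ ∷ []) ((Y ⊕ Z₁ ⊕ Z₂) ∷ []) {c₁} {c₂} {c₃}
           ⟨+⟩ subadd ((Y ⊕ Z₁) ∷ []) (Z₂ ∷ []) ⟨+⟩ subadd (Y ∷ []) ((Z₁ ⊕ Z₂) ∷ [])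
           ⟨+⟩ independence Y (Y ∷ []) (Z₁ ∷ Z₂ ∷ []) {c₄} {c₅} ⟨+⟩ independence Z₁ (Z₁ ∷ []) (Z₂ ∷ []) {c₆} {c₇}))
        (≤.reflexive (+-cong (+-cong ≈u ≈v) (-‿cong ≈w)))

      module Fibring (Y Z₁ Z₂ Z₃ Z₄ : Row 6) where
        sum₃ d₁ d₂ : Row 6
        sum₃ = Y ⊕ Z₁ ⊕ Z₂
        d₁   = Z₁ ⊕ Z₃
        d₂   = Z₂ ⊕ Z₄

        conditional-kaimanovich-vershik : ∀ {u v w₁ w₃}
          {c₁ : ((Y ⊕ Z₁) ∷ d₁ ∷ Z₂ ∷ d₂ ∷ []) ++ (Y ∷ (Z₁ ⊕ Z₂) ∷ d₁ ∷ d₂ ∷ []) ⊒ Y ∷ Z₁ ∷ Z₂ ∷ Z₃ ∷ Z₄ ∷ []}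
          {c₂ : (Y ⊕ Z₁) ∷ d₁ ∷ Z₂ ∷ d₂ ∷ [] ⊒ sum₃ ∷ d₁ ∷ d₂ ∷ []}
          {c₃ : Y ∷ (Z₁ ⊕ Z₂) ∷ d₁ ∷ d₂ ∷ [] ⊒ sum₃ ∷ d₁ ∷ d₂ ∷ []}
          {c₄ : Z₂ ∷ Z₄ ∷ [] ⊒ Z₂ ∷ d₂ ∷ []} {c₅ : even ⊒ (Z₁ ⊕ Z₂) ∷ d₁ ∷ d₂ ∷ []}
          {c₆ : units Y ⊒ Y ∷ []} {c₇ : otherUnits Y ⊒ Z₁ ∷ Z₂ ∷ Z₃ ∷ Z₄ ∷ []}
          {c₈ : units Z₁ ⊒ Z₁ ∷ []} {c₉ : otherUnits Z₁ ⊒ Z₂ ∷ Z₃ ∷ Z₄ ∷ []}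
          {c₁₀ : units Z₂ ⊒ Z₂ ∷ []} {c₁₁ : otherUnits Z₂ ⊒ Z₃ ∷ Z₄ ∷ []}
          {c₁₂ : units Z₃ ⊒ Z₃ ∷ []} {c₁₃ : otherUnits Z₃ ⊒ Z₄ ∷ []} →
          h ((Y ⊕ Z₁) ∷ []) ≈ u → h (d₁ ∷ []) ≈ v → h (Z₁ ∷ []) ≈ w₁ → h (Z₃ ∷ []) ≈ w₃ →
          h (sum₃ ∷ d₁ ∷ d₂ ∷ []) ≤ (u + v + t) - (w₁ + w₃)
        conditional-kaimanovich-vershik {c₁ = c₁} {c₂} {c₃} {c₄} {c₅} {c₆} {c₇} {c₈} {c₉} {c₁₀} {c₁₁} {c₁₂}
            {c₁₃} ≈u ≈v ≈w₁ ≈w₃ = ≤.trans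
          (≤-via (solve 17 (λ s yz₁ d₁ t w₁ w₃ y w₂ w₄ J M N M′ M″ J₁ J₂ J₃ →
                    ((yz₁ :+ d₁ :+ t) :- (w₁ :+ w₃)) :+
                    ((J :+ s) :+ M :+ M′ :+ M″ :+ N :+ (y :+ J₁) :+ (w₁ :+ J₂) :+ (w₂ :+ J₃) :+ (w₃ :+ w₄))
                  := s :+ ((M :+ N) :+ (yz₁ :+ M′) :+ (d₁ :+ M″) :+ (w₂ :+ w₄) :+ (y :+ t) :+ J :+ J₁ :+ J₂ :+ J₃))
                 refl _ _ _ _ _ _ _ _ _ _ _ _ _ _ _ _ _)
            (submod ((Y ⊕ Z₁) ∷ d₁ ∷ Z₂ ∷ d₂ ∷ []) (Y ∷ (Z₁ ⊕ Z₂) ∷ d₁ ∷ d₂ ∷ []) (Y ∷ Z₁ ∷ Z₂ ∷ Z₃ ∷ Z₄ ∷ [])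
                (sum₃ ∷ d₁ ∷ d₂ ∷ []) {c₁} {c₂} {c₃}
             ⟨+⟩ subadd ((Y ⊕ Z₁) ∷ []) (d₁ ∷ Z₂ ∷ d₂ ∷ [])
             ⟨+⟩ subadd (d₁ ∷ []) (Z₂ ∷ d₂ ∷ [])
             ⟨+⟩ ≤.trans (mono (Z₂ ∷ d₂ ∷ []) (Z₂ ∷ Z₄ ∷ []) {c₄}) (subadd (Z₂ ∷ []) (Z₄ ∷ []))
             ⟨+⟩ ≤.trans (subadd (Y ∷ []) ((Z₁ ⊕ Z₂) ∷ d₁ ∷ d₂ ∷ []))
                 (≤.refl ⟨+⟩ mono ((Z₁ ⊕ Z₂) ∷ d₁ ∷ d₂ ∷ []) even {c₅})
             ⟨+⟩ independence Y (Y ∷ []) (Z₁ ∷ Z₂ ∷ Z₃ ∷ Z₄ ∷ []) {c₆} {c₇}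
             ⟨+⟩ independence Z₁ (Z₁ ∷ []) (Z₂ ∷ Z₃ ∷ Z₄ ∷ []) {c₈} {c₉}
             ⟨+⟩ independence Z₂ (Z₂ ∷ []) (Z₃ ∷ Z₄ ∷ []) {c₁₀} {c₁₁}
             ⟨+⟩ independence Z₃ (Z₃ ∷ []) (Z₄ ∷ []) {c₁₂} {c₁₃}))
          (≤.reflexive (+-cong (+-congʳ (+-cong ≈u ≈v)) (-‿cong (+-cong ≈w₁ ≈w₃))))

        -- Average of the bounds obtained from the two ways of conditioning Z₁ ⊕ Z₂:
        -- on its two halves, or not at all; the entropy t cancels.
        distance-increment : ∀ x τ g {u v₁₂ v₁₃ w₁ w₃ y} →
          h (sum₃ ∷ d₁ ∷ d₂ ∷ []) ≤ (u + v₁₃ + t) - (w₁ + w₃) → h (sum₃ ∷ []) ≤ (u + v₁₂) - w₁ →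
          {c₁ : sum₃ ∷ d₁ ∷ d₂ ∷ [] ⊒ x ∷ g}
          {c₂ : g ⊒ d₁ ∷ d₂ ∷ []}
          {c₃ : τ ∷ g ⊒ even} →
          ((h (x ∷ g) + h (x ∷ g)) - h g) - (y + h (τ ∷ g)) ≤ ((u + u + (v₁₂ + v₁₃)) - (w₁ + w₁ + w₃)) - y
        distance-increment x τ g bound₁ bound₂ {c₁} {c₂} {c₃} = ≤-via
          (solve 13 (λ xg g τg y u v₁₂ v₁₃ w₁ w₃ t s s′ d₁₂ →
              (((u :+ u :+ (v₁₂ :+ v₁₃)) :- (w₁ :+ w₁ :+ w₃)) :- y) :+ (xg :+ s :+ xg :+ s′ :+ d₁₂ :+ t)
              := (((xg :+ xg) :- g) :- (y :+ τg)) :+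
                  (s :+ ((u :+ v₁₃ :+ t) :- (w₁ :+ w₃)) :+ (s′ :+ d₁₂) :+ ((u :+ v₁₂) :- w₁) :+ g :+ τg))
            refl _ _ _ _ _ _ _ _ _ _ _ _ _)
          (mono (x ∷ g) (sum₃ ∷ d₁ ∷ d₂ ∷ []) {c₁} ⟨+⟩ bound₁
           ⟨+⟩ ≤.trans (mono (x ∷ g) (sum₃ ∷ d₁ ∷ d₂ ∷ []) {c₁}) (subadd (sum₃ ∷ []) (d₁ ∷ d₂ ∷ []))
           ⟨+⟩ bound₂ ⟨+⟩ mono (d₁ ∷ d₂ ∷ []) g {c₂} ⟨+⟩ mono even (τ ∷ g) {c₃})

      private
        module _ (x y : Row 6) where
          ⊕-value : ∀ g → Hₗ p (λ ω → (combine x (F ω) ⊕ combine y (F ω)) ∷ ⟪ g ⟫ ω) ≈ h ((x ⊕ y) ∷ g)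
          ⊕-value g = H-≡ λ ω → ≡.cong (_∷ ⟪ g ⟫ ω) (≡.sym (combine-⊕ x y (F ω)))

        unit-value : ∀ (a : Element Ω → F₂^ n) → H p a ≈ Hₗ p (λ ω → a ω ∷ [])
        unit-value a = H-cong p (λ _ _ _ _ → List.∷-injectiveˡ) (λ _ _ _ _ → ≡.cong (_∷ []))

        row-lower-bound : ∀ x y g {d e₁ e₂}
          {c₁ : units α ⊒ α ∷ []} {c₂ : otherUnits α ⊒ x ∷ g}
          {c₃ : units β ⊒ β ∷ []} {c₄ : otherUnits β ⊒ y ∷ g} →
          h (x ∷ g) + h (y ∷ g) ≤ h (x ∷ y ∷ g) + h g →
          (h ((x ⊕ y) ∷ g) + h ((x ⊕ y) ∷ g)) - (h (x ∷ g) + h (y ∷ g)) ≤ d →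
          ((h ((α ⊕ x) ∷ g) + h ((α ⊕ x) ∷ g)) - h g) - (HA + h (x ∷ g)) ≤ e₁ →
          ((h ((β ⊕ y) ∷ g) + h ((β ⊕ y) ∷ g)) - h g) - (HB + h (y ∷ g)) ≤ e₂ →
          t₀ ≤ K * d + (e₁ + e₂)
        row-lower-bound x y g {c₁ = c₁} {c₂} {c₃} {c₄} indep d-bound e₁-bound e₂-bound = ≤.trans
          (lower-bound p (λ ω → combine x (F ω)) (λ ω → combine y (F ω)) a b ⟪ g ⟫ a~A b~B indep
            (≤.trans (≤.reflexive (+-congʳ (unit-value a))) (independence α (α ∷ []) (x ∷ g) {c₁} {c₂}))
            (≤.trans (≤.reflexive (+-congʳ (unit-value b))) (independence β (β ∷ []) (y ∷ g) {c₃} {c₄})))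
          ((0≤K ⟨*⟩ ≤.trans (≤.reflexive (+-congʳ (+-cong (⊕-value x y g) (⊕-value x y g)))) d-bound)
           ⟨+⟩ (≤.trans (≤.reflexive (+-congʳ (+-congʳ (+-cong (⊕-value α x g) (⊕-value α x g))))) e₁-bound
           ⟨+⟩ ≤.trans (≤.reflexive (+-congʳ (+-congʳ (+-cong (⊕-value β y g) (⊕-value β y g))))) e₂-bound))

        unconditional : ∀ {s x y u v} → s ≤ u → x ≈ v → ((s + s) - h []) - (y + x) ≤ (u + u) - (y + v)
        unconditional s≤u x≈v = ≤-via
          (solve 6 (λ s x y u v o → ((u :+ u) :- (y :+ v)) :+ (s :+ s :+ v :+ :0) :=
              (((s :+ s) :- o) :- (y :+ x)) :+ (u :+ u :+ x :+ o)) refl _ _ _ _ _ _)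
          (s≤u ⟨+⟩ s≤u ⟨+⟩ ≤.reflexive (sym x≈v) ⟨+⟩ h-nonneg [])

      use₁ : t₀ ≤ K * ((h (σ ∷ []) + h (σ ∷ [])) - (PQ + PQ))
                + (((((AP + PQ) - HP) + ((AP + PQ) - HP)) - (HA + PQ)) +
                    ((((BQ + PQ) - HQ) + ((BQ + PQ) - HQ)) - (HB + PQ)))
      use₁ = row-lower-bound (ξ₁ ⊕ ξ₄) (ξ₂ ⊕ ξ₃) []
        (≤.trans (independence (ξ₁ ⊕ ξ₄) ((ξ₁ ⊕ ξ₄) ∷ []) ((ξ₂ ⊕ ξ₃) ∷ [])) (x≤x+y _ (h-nonneg [])))
        (≤.reflexive (+-congˡ (-‿cong (+-cong h-14 h-23))))
        (unconditional (kaimanovich-vershik α ξ₁ ξ₄ h-α1 h-14 h-ξ₁) h-14)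
        (unconditional (kaimanovich-vershik β ξ₂ ξ₃ h-β2 h-23 h-ξ₂) h-23)

      use₃ : t₀ ≤ K * ((h (σ ∷ []) + h (σ ∷ [])) - (PP + QQ))
                + (((((AP + PP) - HP) + ((AP + PP) - HP)) - (HA + PP)) +
                    ((((BQ + QQ) - HQ) + ((BQ + QQ) - HQ)) - (HB + QQ)))
      use₃ = row-lower-bound (ξ₁ ⊕ ξ₃) (ξ₂ ⊕ ξ₄) []
        (≤.trans (independence (ξ₁ ⊕ ξ₃) ((ξ₁ ⊕ ξ₃) ∷ []) ((ξ₂ ⊕ ξ₄) ∷ [])) (x≤x+y _ (h-nonneg [])))
        (≤.reflexive (+-congˡ (-‿cong (+-cong h-13 h-24))))
        (unconditional (kaimanovich-vershik α ξ₁ ξ₃ h-α1 h-13 h-ξ₁) h-13)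
        (unconditional (kaimanovich-vershik β ξ₂ ξ₄ h-β2 h-24 h-ξ₂) h-24)

      conditioned-use : ∀ X X′ Y Y′ (let c = X ⊕ X′) (let d = Y ⊕ Y′) {u v γ δ w₁ w₂ w₃ w₄}
        {c₁ : X ∷ X′ ∷ d ∷ [] ⊒ X ∷ c ∷ d ∷ []} {c₂ : Y ∷ Y′ ∷ c ∷ [] ⊒ Y ∷ c ∷ d ∷ []}
        {c₃ : X ∷ Y ∷ c ∷ d ∷ [] ⊒ X ∷ X′ ∷ Y ∷ Y′ ∷ []}
        {c₄ : X ∷ c ∷ d ∷ [] ⊒ X ∷ X′ ∷ d ∷ []} {c₅ : Y ∷ c ∷ d ∷ [] ⊒ Y ∷ Y′ ∷ c ∷ []}
        {c₆ : even ⊒ (X ⊕ Y) ∷ c ∷ d ∷ []}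
        {i₁ : units X ⊒ X ∷ []} {i₂ : otherUnits X ⊒ X′ ∷ []}
        {i₃ : units Y ⊒ Y ∷ []} {i₄ : otherUnits Y ⊒ Y′ ∷ []}
        {i₅ : units c ⊒ X ∷ X′ ∷ []} {i₆ : otherUnits c ⊒ Y ∷ Y′ ∷ []}
        {i₇ : otherUnits c ⊒ d ∷ []}
        {i₈ : units d ⊒ Y ∷ Y′ ∷ []} {i₉ : otherUnits d ⊒ c ∷ []}
        {j₁ : units c ⊒ c ∷ []}
        {j₂ : units α ⊒ α ∷ []} {j₃ : otherUnits α ⊒ X ∷ c ∷ d ∷ []}
        {j₄ : units β ⊒ β ∷ []} {j₅ : otherUnits β ⊒ Y ∷ c ∷ d ∷ []} →
        h ((α ⊕ X) ∷ []) ≈ u → h ((β ⊕ Y) ∷ []) ≈ v → h (c ∷ []) ≈ γ → h (d ∷ []) ≈ δ →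
        h (X ∷ []) ≈ w₁ → h (X′ ∷ []) ≈ w₂ → h (Y ∷ []) ≈ w₃ → h (Y′ ∷ []) ≈ w₄ →
        t₀ ≤ K * ((t + t) - ((w₁ + w₂ + δ) + (w₃ + w₄ + γ)))
           + (((((u + γ + δ) + (u + γ + δ)) - (γ + δ)) - (HA + (w₁ + w₂ + δ))) +
               ((((v + γ + δ) + (v + γ + δ)) - (γ + δ)) - (HB + (w₃ + w₄ + γ))))
      conditioned-use X X′ Y Y′ {u} {v} {γ} {δ} {w₁} {w₂} {w₃} {w₄} {c₁} {c₂} {c₃} {c₄} {c₅} {c₆} {i₁} {i₂}
          {i₃} {i₄} {i₅} {i₆} {i₇} {i₈} {i₉} {j₁} {j₂} {j₃} {j₄} {j₅}
                      ≈u ≈v ≈γ ≈δ ≈w₁ ≈w₂ ≈w₃ ≈w₄ =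
        row-lower-bound X Y (c ∷ d ∷ []) {c₁ = j₂} {j₃} {j₄} {j₅}
          (≤.trans (Xg-upper ⟨+⟩ Yg-upper) (≤.trans
              (≤.reflexive (solve 6 (λ w₁ w₂ w₃ w₄ γ δ → (w₁ :+ w₂ :+ δ) :+ (w₃ :+ w₄ :+ γ)
              := ((w₁ :+ w₂) :+ (w₃ :+ w₄)) :+ (γ :+ δ)) refl _ _ _ _ _ _)) (XYg-lower ⟨+⟩ g-lower)))
          (mono₁ ⟨+⟩ mono₁ ⟨+⟩ neg-mono-≤ (Xg-lower ⟨+⟩ Yg-lower))
          (distance α X ≈u Xg-lower) (distance β Y ≈v Yg-lower)
        where
        c = X ⊕ X′
        d = Y ⊕ Y′
        g = c ∷ d ∷ []
        mono₁ = mono ((X ⊕ Y) ∷ g) even {c₆}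
        XX′-upper : h (X ∷ X′ ∷ []) ≤ w₁ + w₂
        XX′-upper = ≤.trans (subadd (X ∷ []) (X′ ∷ [])) (≤.reflexive (+-cong ≈w₁ ≈w₂))
        YY′-upper : h (Y ∷ Y′ ∷ []) ≤ w₃ + w₄
        YY′-upper = ≤.trans (subadd (Y ∷ []) (Y′ ∷ [])) (≤.reflexive (+-cong ≈w₃ ≈w₄))
        XX′-lower : w₁ + w₂ ≤ h (X ∷ X′ ∷ [])
        XX′-lower = ≤.trans (≤.reflexive (sym (+-cong ≈w₁ ≈w₂))) (independence X (X ∷ []) (X′ ∷ []) {i₁} {i₂})
        YY′-lower : w₃ + w₄ ≤ h (Y ∷ Y′ ∷ [])
        YY′-lower = ≤.trans (≤.reflexive (sym (+-cong ≈w₃ ≈w₄))) (independence Y (Y ∷ []) (Y′ ∷ []) {i₃} {i₄})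
        Xg-upper : h (X ∷ g) ≤ w₁ + w₂ + δ
        Xg-upper = ≤.trans (mono (X ∷ g) (X ∷ X′ ∷ d ∷ []) {c₁})
            (≤.trans (subadd (X ∷ X′ ∷ []) (d ∷ [])) (XX′-upper ⟨+⟩ ≤.reflexive ≈δ))
        Yg-upper : h (Y ∷ g) ≤ w₃ + w₄ + γ
        Yg-upper = ≤.trans (mono (Y ∷ g) (Y ∷ Y′ ∷ c ∷ []) {c₂})
            (≤.trans (subadd (Y ∷ Y′ ∷ []) (c ∷ [])) (YY′-upper ⟨+⟩ ≤.reflexive ≈γ))
        Xg-lower : w₁ + w₂ + δ ≤ h (X ∷ g)
        Xg-lower = ≤.trans (XX′-lower ⟨+⟩ ≤.reflexive (sym ≈δ))
            (≤.trans (independence c (X ∷ X′ ∷ []) (d ∷ []) {i₅} {i₇}) (mono (X ∷ X′ ∷ d ∷ []) (X ∷ g) {c₄}))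
        Yg-lower : w₃ + w₄ + γ ≤ h (Y ∷ g)
        Yg-lower = ≤.trans (YY′-lower ⟨+⟩ ≤.reflexive (sym ≈γ))
            (≤.trans (independence d (Y ∷ Y′ ∷ []) (c ∷ []) {i₈} {i₉}) (mono (Y ∷ Y′ ∷ c ∷ []) (Y ∷ g) {c₅}))
        XYg-lower : (w₁ + w₂) + (w₃ + w₄) ≤ h (X ∷ Y ∷ g)
        XYg-lower = ≤.trans (XX′-lower ⟨+⟩ YY′-lower)
            (≤.trans (independence c (X ∷ X′ ∷ []) (Y ∷ Y′ ∷ []) {i₅} {i₆})
            (mono (X ∷ X′ ∷ Y ∷ Y′ ∷ []) (X ∷ Y ∷ g) {c₃}))
        g-lower : γ + δ ≤ h g
        g-lower = ≤.trans (≤.reflexive (sym (+-cong ≈γ ≈δ))) (independence c (c ∷ []) (d ∷ []) {j₁} {i₇})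
        distance : ∀ a x {u y l} → h ((a ⊕ x) ∷ []) ≈ u → l ≤ h (x ∷ g) →
          ((h ((a ⊕ x) ∷ g) + h ((a ⊕ x) ∷ g)) - h g) - (y + h (x ∷ g)) ≤
              (((u + γ + δ) + (u + γ + δ)) - (γ + δ)) - (y + l)
        distance a x {u} ≈u l≤ = (upper ⟨+⟩ upper ⟨+⟩ neg-mono-≤ g-lower) ⟨+⟩ neg-mono-≤ (≤.refl ⟨+⟩ l≤)
          where
          upper : h ((a ⊕ x) ∷ g) ≤ u + γ + δ
          upper = ≤.trans (subadd ((a ⊕ x) ∷ c ∷ []) (d ∷ []))
              (≤.trans (subadd ((a ⊕ x) ∷ []) (c ∷ [])) (≤.reflexive (+-cong ≈u ≈γ)) ⟨+⟩ ≤.reflexive ≈δ)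

      use₂ = conditioned-use ξ₁ ξ₄ ξ₂ ξ₃ h-α1 h-β2 h-14 h-23 h-ξ₁ h-ξ₄ h-ξ₂ h-ξ₃
      use₄ = conditioned-use ξ₁ ξ₃ ξ₂ ξ₄ h-α1 h-β2 h-13 h-24 h-ξ₁ h-ξ₃ h-ξ₂ h-ξ₄

      bsg-use : ∀ T₁ T₂ (let z = T₁ ⊕ T₂) {e₁ e₂}
        {c₁ : units α ⊒ α ∷ []} {c₂ : otherUnits α ⊒ T₁ ∷ z ∷ σ ∷ []}
        {c₃ : units β ⊒ β ∷ []} {c₄ : otherUnits β ⊒ T₂ ∷ z ∷ σ ∷ []}
        {c₅ : T₁ ∷ T₂ ∷ σ ∷ [] ⊒ even} →
        h (T₁ ∷ σ ∷ []) + h (T₂ ∷ σ ∷ []) + h (z ∷ σ ∷ []) ≤ (PQ + PQ) + (PQ + PQ) + (PP + QQ) →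
        ((h ((α ⊕ T₁) ∷ z ∷ σ ∷ []) + h ((α ⊕ T₁) ∷ z ∷ σ ∷ [])) - h (z ∷ σ ∷ [])) -
            (HA + h (T₁ ∷ z ∷ σ ∷ [])) ≤ e₁ →
        ((h ((β ⊕ T₂) ∷ z ∷ σ ∷ []) + h ((β ⊕ T₂) ∷ z ∷ σ ∷ [])) - h (z ∷ σ ∷ [])) -
            (HB + h (T₂ ∷ z ∷ σ ∷ [])) ≤ e₂ →
        t₀ ≤ K * ((# 4 * ((PQ + PQ) + (PQ + PQ) + (PP + QQ)) - # 6 * h (σ ∷ [])) - # 6 * t) + (e₁ + e₂)
      bsg-use T₁ T₂ {c₁ = c₁} {c₂} {c₃} {c₄} {c₅} pairs e₁-bound e₂-bound = ≤.trans
        (bsg-lower-bound p (λ ω → combine T₁ (F ω)) (λ ω → combine T₂ (F ω)) (λ ω → combine σ (F ω)) a b a~A b~B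
          (≤.trans (≤.reflexive (+-cong (unit-value a)
              (sumₗ (λ ω z → combine T₁ (F ω) ∷ z ∷ combine σ (F ω) ∷ []))))
            (≤.trans (independence α (α ∷ []) (T₁ ∷ z ∷ σ ∷ []) {c₁} {c₂})
                (≤.reflexive (sym (sumₗ (λ ω z → a ω ∷ combine T₁ (F ω) ∷ z ∷ combine σ (F ω) ∷ []))))))
          (≤.trans (≤.reflexive (+-cong (unit-value b)
              (sumₗ (λ ω z → combine T₂ (F ω) ∷ z ∷ combine σ (F ω) ∷ []))))
            (≤.trans (independence β (β ∷ []) (T₂ ∷ z ∷ σ ∷ []) {c₃} {c₄})
                (≤.reflexive (sym (sumₗ (λ ω z → b ω ∷ combine T₂ (F ω) ∷ z ∷ combine σ (F ω) ∷ [])))))))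
        ((0≤K ⟨*⟩ (((#-nonneg 4 ⟨*⟩ ≤.trans (≤.reflexive (+-congˡ h-z)) pairs) ⟨+⟩ ≤.refl)
                    ⟨+⟩ neg-mono-≤ (#-nonneg 6 ⟨*⟩ mono even (T₁ ∷ T₂ ∷ σ ∷ []) {c₅})))
         ⟨+⟩ (≤.trans (≤.reflexive (+-cong (+-cong (+-cong αT₁ αT₁) (-‿cong h-z))
             (-‿cong (+-congˡ (sumₗ (λ ω z → combine T₁ (F ω) ∷ z ∷ combine σ (F ω) ∷ [])))))) e₁-bound
         ⟨+⟩ ≤.trans (≤.reflexive (+-cong (+-cong (+-cong βT₂ βT₂) (-‿cong h-z))
             (-‿cong (+-congˡ (sumₗ (λ ω z → combine T₂ (F ω) ∷ z ∷ combine σ (F ω) ∷ [])))))) e₂-bound))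
        where
        z = T₁ ⊕ T₂
        sumₗ : ∀ (f : Element Ω → F₂^ n → List (F₂^ n)) → Hₗ p
            (λ ω → f ω (combine T₁ (F ω) ⊕ combine T₂ (F ω))) ≈ Hₗ p (λ ω → f ω (combine z (F ω)))
        sumₗ f = H-≡ λ ω → ≡.cong (f ω) (≡.sym (combine-⊕ T₁ T₂ (F ω)))
        h-z = sumₗ (λ ω z → z ∷ combine σ (F ω) ∷ [])
        αT₁ : Hₗ p (λ ω → (a ω ⊕ combine T₁ (F ω)) ∷ (combine T₁ (F ω) ⊕ combine T₂ (F ω)) ∷ combine σ (F ω) ∷
            []) ≈ h ((α ⊕ T₁) ∷ z ∷ σ ∷ [])
        αT₁ = trans (sumₗ (λ ω z → (a ω ⊕ combine T₁ (F ω)) ∷ z ∷ combine σ (F ω) ∷ [])) (⊕-value α T₁ (z ∷ σ ∷ []))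
        βT₂ : Hₗ p (λ ω → (b ω ⊕ combine T₂ (F ω)) ∷ (combine T₁ (F ω) ⊕ combine T₂ (F ω)) ∷ combine σ (F ω) ∷
            []) ≈ h ((β ⊕ T₂) ∷ z ∷ σ ∷ [])
        βT₂ = trans (sumₗ (λ ω z → (b ω ⊕ combine T₂ (F ω)) ∷ z ∷ combine σ (F ω) ∷ [])) (⊕-value β T₂ (z ∷ σ ∷ []))

      private
        pairs : ∀ {x y z} → h (υ₁ ∷ σ ∷ []) + h (υ₂ ∷ σ ∷ []) + h (υ₃ ∷ σ ∷ []) ≈ x + y + z → x + y + z ≤
            (PQ + PQ) + (PQ + PQ) + (PP + QQ)
        pairs eq = ≤.trans (≤.reflexive (sym eq))
          (pair (υ₁ ∷ σ ∷ []) (ξ₁ ⊕ ξ₂) (ξ₃ ⊕ ξ₄) (mono (υ₁ ∷ σ ∷ []) ((ξ₁ ⊕ ξ₂) ∷ (ξ₃ ⊕ ξ₄) ∷ [])) h-12 h-34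
           ⟨+⟩ pair (υ₂ ∷ σ ∷ []) (ξ₂ ⊕ ξ₃) (ξ₁ ⊕ ξ₄) (mono (υ₂ ∷ σ ∷ []) ((ξ₂ ⊕ ξ₃) ∷ (ξ₁ ⊕ ξ₄) ∷ [])) h-23 h-14
           ⟨+⟩ pair (υ₃ ∷ σ ∷ []) (ξ₁ ⊕ ξ₃) (ξ₂ ⊕ ξ₄) (mono (υ₃ ∷ σ ∷ []) ((ξ₁ ⊕ ξ₃) ∷ (ξ₂ ⊕ ξ₄) ∷ [])) h-13 h-24)
          where
          pair : ∀ M r s {u v} → h M ≤ h (r ∷ s ∷ []) → h (r ∷ []) ≈ u → h (s ∷ []) ≈ v → h M ≤ u + v
          pair M r s M≤ ≈u ≈v = ≤.trans M≤ (≤.trans (subadd (r ∷ []) (s ∷ [])) (≤.reflexive (+-cong ≈u ≈v)))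

      use₅ = bsg-use υ₁ υ₂ (pairs refl)
        (Fibring.distance-increment α ξ₁ ξ₂ ξ₃ ξ₄ (α ⊕ υ₁) υ₁ (υ₃ ∷ σ ∷ [])
          (Fibring.conditional-kaimanovich-vershik α ξ₁ ξ₂ ξ₃ ξ₄ h-α1 h-13 h-ξ₁ h-ξ₃)
              (kaimanovich-vershik α ξ₁ ξ₂ h-α1 h-12 h-ξ₁))
        (Fibring.distance-increment β ξ₂ ξ₃ ξ₄ ξ₁ (β ⊕ υ₂) υ₂ (υ₃ ∷ σ ∷ [])
          (Fibring.conditional-kaimanovich-vershik β ξ₂ ξ₃ ξ₄ ξ₁ h-β2 h-24 h-ξ₂ h-ξ₄)
              (kaimanovich-vershik β ξ₂ ξ₃ h-β2 h-23 h-ξ₂))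

      use₆ = bsg-use υ₁ υ₃ (pairs (solve 3 (λ x y z → x :+ y :+ z := x :+ z :+ y) refl _ _ _))
        (Fibring.distance-increment α ξ₁ ξ₂ ξ₄ ξ₃ (α ⊕ υ₁) υ₁ (υ₂ ∷ σ ∷ [])
          (Fibring.conditional-kaimanovich-vershik α ξ₁ ξ₂ ξ₄ ξ₃ h-α1 h-14 h-ξ₁ h-ξ₄)
              (kaimanovich-vershik α ξ₁ ξ₂ h-α1 h-12 h-ξ₁))
        (Fibring.distance-increment β ξ₂ ξ₄ ξ₃ ξ₁ (β ⊕ υ₃) υ₃ (υ₂ ∷ σ ∷ [])
          (Fibring.conditional-kaimanovich-vershik β ξ₂ ξ₄ ξ₃ ξ₁ h-β2 h-23 h-ξ₂ h-ξ₃)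
              (kaimanovich-vershik β ξ₂ ξ₄ h-β2 h-24 h-ξ₂))

      use₇ = bsg-use υ₃ υ₁ (pairs (solve 3 (λ x y z → x :+ y :+ z := z :+ x :+ y) refl _ _ _))
        (Fibring.distance-increment α ξ₃ ξ₁ ξ₂ ξ₄ (α ⊕ υ₃) υ₃ (υ₂ ∷ σ ∷ [])
          (Fibring.conditional-kaimanovich-vershik α ξ₃ ξ₁ ξ₂ ξ₄ h-α3 h-23 h-ξ₃ h-ξ₂)
              (kaimanovich-vershik α ξ₃ ξ₁ h-α3 h-13 h-ξ₃))
        (Fibring.distance-increment β ξ₂ ξ₁ ξ₃ ξ₄ (β ⊕ υ₁) υ₁ (υ₂ ∷ σ ∷ [])
          (Fibring.conditional-kaimanovich-vershik β ξ₂ ξ₁ ξ₃ ξ₄ h-β2 h-23 h-ξ₂ h-ξ₃)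
              (kaimanovich-vershik β ξ₂ ξ₁ h-β2 h-12 h-ξ₂))

      -- The multipliers 1, 3, 8, 6, 1, 1, 1 make both h (σ ∷ []) and t cancel.
      sextuple-inequality :
        # 21 * t₀ ≤ K * (# 20 * D P Q - (D P P + D Q Q)) +
            (# 21 * (D A P + D B Q) + # 8 * (D P Q + (D P P + D Q Q)))
      sextuple-inequality = ≤-via
        (solve 13 (λ K t₀ HA HB HP HQ AP BQ PQ PP QQ hS t →
          (K :* (:# 20 :* ((PQ :+ PQ) :- (HP :+ HQ)) :- (((PP :+ PP) :- (HP :+ HP)) :+ ((QQ :+ QQ) :- (HQ :+ HQ))))
           :+ (:# 21 :* (((AP :+ AP) :- (HA :+ HP)) :+ ((BQ :+ BQ) :- (HB :+ HQ)))
           :+ :# 8 :* (((PQ :+ PQ) :- (HP :+ HQ)) :+ (((PP :+ PP) :- (HP :+ HP)) :+ ((QQ :+ QQ) :- (HQ :+ HQ))))))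
          :+ (t₀ :+ :# 3 :* t₀ :+ :# 8 :* t₀ :+ :# 6 :* t₀ :+ t₀ :+ t₀ :+ t₀)
          := :# 21 :* t₀ :+
          ((K :* ((hS :+ hS) :- (PQ :+ PQ)) :+ (((((AP :+ PQ) :- HP) :+ ((AP :+ PQ) :- HP)) :- (HA :+ PQ)) :+
              ((((BQ :+ PQ) :- HQ) :+ ((BQ :+ PQ) :- HQ)) :- (HB :+ PQ))))
           :+ :# 3 :* (K :* ((t :+ t) :- ((HP :+ HQ :+ PQ) :+ (HQ :+ HP :+ PQ)))
              :+ (((((AP :+ PQ :+ PQ) :+ (AP :+ PQ :+ PQ)) :- (PQ :+ PQ)) :- (HA :+ (HP :+ HQ :+ PQ))) :+
                  ((((BQ :+ PQ :+ PQ) :+ (BQ :+ PQ :+ PQ)) :- (PQ :+ PQ)) :- (HB :+ (HQ :+ HP :+ PQ)))))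
           :+ :# 8 :* (K :* ((hS :+ hS) :- (PP :+ QQ)) :+
               (((((AP :+ PP) :- HP) :+ ((AP :+ PP) :- HP)) :- (HA :+ PP)) :+
               ((((BQ :+ QQ) :- HQ) :+ ((BQ :+ QQ) :- HQ)) :- (HB :+ QQ))))
           :+ :# 6 :* (K :* ((t :+ t) :- ((HP :+ HP :+ QQ) :+ (HQ :+ HQ :+ PP)))
              :+ (((((AP :+ PP :+ QQ) :+ (AP :+ PP :+ QQ)) :- (PP :+ QQ)) :- (HA :+ (HP :+ HP :+ QQ))) :+
                  ((((BQ :+ PP :+ QQ) :+ (BQ :+ PP :+ QQ)) :- (PP :+ QQ)) :- (HB :+ (HQ :+ HQ :+ PP)))))
           :+ (K :* ((:# 4 :* ((PQ :+ PQ) :+ (PQ :+ PQ) :+ (PP :+ QQ)) :- :# 6 :* hS) :- :# 6 :* t)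
              :+ ((((AP :+ AP :+ (PQ :+ PP)) :- (HP :+ HP :+ HP)) :- HA) :+
                  (((BQ :+ BQ :+ (PQ :+ QQ)) :- (HQ :+ HQ :+ HQ)) :- HB)))
           :+ (K :* ((:# 4 :* ((PQ :+ PQ) :+ (PQ :+ PQ) :+ (PP :+ QQ)) :- :# 6 :* hS) :- :# 6 :* t)
              :+ ((((AP :+ AP :+ (PQ :+ PQ)) :- (HP :+ HP :+ HQ)) :- HA) :+
                  (((BQ :+ BQ :+ (QQ :+ PQ)) :- (HQ :+ HQ :+ HP)) :- HB)))
           :+ (K :* ((:# 4 :* ((PQ :+ PQ) :+ (PQ :+ PQ) :+ (PP :+ QQ)) :- :# 6 :* hS) :- :# 6 :* t)
              :+ ((((AP :+ AP :+ (PP :+ PQ)) :- (HP :+ HP :+ HQ)) :- HA) :+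
                  (((BQ :+ BQ :+ (PQ :+ PQ)) :- (HQ :+ HQ :+ HP)) :- HB)))))
          refl K t₀ HA HB HP HQ AP BQ PQ PP QQ (h (σ ∷ [])) t)
        (use₁ ⟨+⟩ (#-nonneg 3 ⟨*⟩ use₂) ⟨+⟩ (#-nonneg 8 ⟨*⟩ use₃) ⟨+⟩ (#-nonneg 6 ⟨*⟩ use₄) ⟨+⟩ use₅ ⟨+⟩ use₆
            ⟨+⟩ use₇)

module NearMinimisers (ℝ : RealField) where

  open RealField ℝ
  open OrderedField ℝ
  open Logarithm ℝ
  open FiniteProbability ℝ
  open Conditioning ℝ
  open RandomVariables ℝ
  open Finite using (Element)
  open LinearCombinations
  open LinearEntropy ℝ
  open SextupleInequality ℝ
  private module Ent = Entropy ℝ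
  open Ent using (RandomVariable; _⊟_)

  module IndependentPair {Ω Ω′ : Finite} (p : Law Ω) (q : Law Ω′) where

    open Product p q public

    hasLaw-fst : ∀ {n} {x : Element Ω → F₂^ n} {X} → HasLaw p x X → HasLaw productLaw (x ∘ proj₁) X
    hasLaw-fst x~X v = trans (𝔼-fst _) (x~X v)

    hasLaw-snd : ∀ {n} {x : Element Ω′ → F₂^ n} {X} → HasLaw q x X → HasLaw productLaw (x ∘ proj₂) X
    hasLaw-snd x~X v = trans (𝔼-snd _) (x~X v)

    H-independent : ∀ {S T : Set} (f : Element Ω → S) (g : Element Ω′ → T) →
                    H p f + H q g ≤ H productLaw ((f ∘ proj₁) ▵ (g ∘ proj₂))
    H-independent f g = ≤.trans (≤.reflexive (+-cong (H-fst f) (H-snd g))) (≤.trans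
      (mutual-information-mono productLaw proj₁ proj₂ (f ∘ proj₁) (g ∘ proj₂)
        (λ _ _ _ _ → ≡.cong f) (λ _ _ _ _ → ≡.cong g) {0#}
        (≤.reflexive (trans (sym (+-cong (H-fst id) (H-snd id))) (trans (sym H-product) (sym (+-identityʳ _))))))
      (≤.reflexive (+-identityʳ _)))

  module _ {n} (X Y : RandomVariable n) where

    open IndependentPair (law X) (law Y)

    pairLaw : Law (vectors n ⊗ vectors n)
    pairLaw = productLaw

    fst~X : HasLaw pairLaw proj₁ X
    fst~X = hasLaw-fst {x = id} {X} (id-hasLaw X)

    snd~Y : HasLaw pairLaw proj₂ Y
    snd~Y = hasLaw-snd {x = id} {Y} (id-hasLaw Y)

    difference : Element (vectors n ⊗ vectors n) → F₂^ n
    difference (x , y) = x ⊖ y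

    pair-independent : H pairLaw proj₁ + H pairLaw proj₂ ≤ H pairLaw (proj₁ ▵ proj₂)
    pair-independent = ≤.trans (≤.reflexive (sym (+-cong (H-fst id) (H-snd id)))) (H-independent id id)

    difference~ : HasLaw pairLaw difference (X ⊟ Y)
    difference~ = difference-hasLaw pairLaw proj₁ proj₂ X Y fst~X snd~Y
        (entropic-independence pairLaw proj₁ proj₂ pair-independent)

    H-X : Ent.H X ≈ H pairLaw proj₁
    H-X = H-hasLaw pairLaw proj₁ X fst~X

    H-Y : Ent.H Y ≈ H pairLaw proj₂
    H-Y = H-hasLaw pairLaw proj₂ Y snd~Y

    H-difference : Ent.H (X ⊟ Y) ≈ H pairLaw difference
    H-difference = H-hasLaw pairLaw difference (X ⊟ Y) difference~

    HX+HY≤difference,snd : Ent.H X + Ent.H Y ≤ H pairLaw (difference ▵ proj₂)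
    HX+HY≤difference,snd = ≤.trans (≤.reflexive (+-cong H-X H-Y)) (≤.trans pair-independent
      (H-mono pairLaw λ (x , y) (x′ , y′) _ _ eq → ≡.cong₂ _,_
          (⊕-injectiveʳ {u = x} {x′} (≡.cong proj₁ eq) (≡.cong proj₂ eq)) (≡.cong proj₂ eq)))

    HX+HY≤difference,fst : Ent.H X + Ent.H Y ≤ H pairLaw (difference ▵ proj₁)
    HX+HY≤difference,fst = ≤.trans (≤.reflexive (+-cong H-X H-Y)) (≤.trans pair-independent
      (H-mono pairLaw λ (x , y) (x′ , y′) _ _ eq → ≡.cong₂ _,_ (≡.cong proj₂ eq)
        (⊕-injectiveʳ {u = y} {y′} (≡.trans (⊕-comm y x) (≡.trans (≡.cong proj₁ eq) (⊕-comm x′ y′)))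
            (≡.cong proj₂ eq))))

    H-left≤ : Ent.H X ≤ Ent.H (X ⊟ Y)
    H-left≤ = ≤-via (solve 3 (λ d x y → d :+ (x :+ y) := x :+ (d :+ y)) refl _ _ (Ent.H Y))
      (≤.trans HX+HY≤difference,snd (≤.trans (subadditive pairLaw difference proj₂)
          (≤.reflexive (sym (+-cong H-difference H-Y)))))

    H-right≤ : Ent.H Y ≤ Ent.H (X ⊟ Y)
    H-right≤ = ≤-via (solve 3 (λ d x y → d :+ (x :+ y) := y :+ (d :+ x)) refl _ (Ent.H X) _)
      (≤.trans HX+HY≤difference,fst (≤.trans (subadditive pairLaw difference proj₁)
          (≤.reflexive (sym (+-cong H-difference H-X)))))

    D-nonneg : 0# ≤ D X Y
    D-nonneg = ≤⇒0≤- (H-left≤ ⟨+⟩ H-right≤)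

  D-sym : ∀ {n} (X Y : RandomVariable n) → D X Y ≈ D Y X
  D-sym X Y = +-cong (+-cong H-sym H-sym) (-‿cong (+-comm _ _))
    where
    H-sym : Ent.H (X ⊟ Y) ≈ Ent.H (Y ⊟ X)
    H-sym = trans (H-hasLaw (pairLaw Y X) _ (X ⊟ Y)
        (difference-hasLaw (pairLaw Y X) proj₂ proj₁ X Y (snd~Y Y X) (fst~X Y X)
          (entropic-independence (pairLaw Y X) proj₂ proj₁
              (≤.trans (≤.reflexive (+-comm _ _)) (≤.trans (pair-independent Y X)
            (H-mono (pairLaw Y X) λ _ _ _ _ eq → ≡.cong₂ _,_ (≡.cong proj₂ eq) (≡.cong proj₁ eq)))))))
      (trans (H-cong (pairLaw Y X) (λ (y , x) (y′ , x′) _ _ eq → ≡.trans (⊕-comm x y) (≡.trans eq (⊕-comm y′ x′)))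
                                   (λ (y , x) (y′ , x′) _ _ eq → ≡.trans (⊕-comm y x) (≡.trans eq (⊕-comm x′ y′))))
      (sym (H-difference Y X)))

  module _ {n} (K t₀ : Carrier) (0≤K : 0# ≤ K) (A B : RandomVariable n)
           (lower : ∀ X Y → t₀ ≤ K * D X Y + (D A X + D B Y)) (P Q : RandomVariable n) where

    private
      V = vectors n

      infixr 5 _⊗ᴸ_
      _⊗ᴸ_ : ∀ {Ω} → RandomVariable n → Law Ω → Law (vectors n ⊗ Ω)
      X ⊗ᴸ q = Product.productLaw (law X) q

      here : ∀ {Ω} X (q : Law Ω) → HasLaw (X ⊗ᴸ q) proj₁ X
      here X q = IndependentPair.hasLaw-fst (law X) q {x = id} {X} (id-hasLaw X)

      there : ∀ {Ω} X (q : Law Ω) {x : Element Ω → F₂^ n} {Y} → HasLaw q x Y → HasLaw (X ⊗ᴸ q) (x ∘ proj₂) Y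
      there X q {x} {Y} = IndependentPair.hasLaw-snd (law X) q {x = x} {Y}

      extend : ∀ {Ω} X (q : Law Ω) {s} (f : Element Ω → List (F₂^ n)) → s ≤ H q f →
               Ent.H X + s ≤ H (X ⊗ᴸ q) {List (F₂^ n)} (λ ω → proj₁ ω ∷ f (proj₂ ω))
      extend X q f s≤ = ≤.trans (≤.reflexive (H-law X) ⟨+⟩ s≤)
          (≤.trans (IndependentPair.H-independent (law X) q id f)
        (H-mono (X ⊗ᴸ q) λ _ _ _ _ eq → ≡.cong₂ _,_ (List.∷-injectiveˡ eq) (List.∷-injectiveʳ eq)))

      p₅ = P ⊗ᴸ law Q
      p₄ = Q ⊗ᴸ p₅
      p₃ = P ⊗ᴸ p₄
      p₂ = B ⊗ᴸ p₃
      p₁ = A ⊗ᴸ p₂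

      b~ = there A p₂ {Y = B} (here B p₃)
      x₁~ = there A p₂ {Y = P} (there B p₃ {Y = P} (here P p₄))
      x₂~ = there A p₂ {Y = Q} (there B p₃ {Y = Q} (there P p₄ {Y = Q} (here Q p₅)))
      x₃~ = there A p₂ {Y = P} (there B p₃ {Y = P} (there P p₄ {Y = P} (there Q p₅ {Y = P} (here P (law Q)))))
      x₄~ = there A p₂ {Y = Q} (there B p₃ {Y = Q} (there P p₄ {Y = Q}
          (there Q p₅ {Y = Q} (there P (law Q) {Y = Q} (id-hasLaw Q)))))

      single : ∀ (x : Element (V ⊗ V ⊗ V ⊗ V ⊗ V ⊗ V) → F₂^ n) X → HasLaw p₁ x X → H p₁ {List (F₂^ n)}
          (λ ω → x ω ∷ []) ≤ Ent.H X
      single x X x~X = ≤.trans (H-mono p₁ {f = λ ω → x ω ∷ []} {x} λ _ _ _ _ → ≡.cong (_∷ []))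
          (≤.reflexive (sym (H-hasLaw p₁ x X x~X)))

    distance-inequality :
      # 21 * t₀ ≤ K * (# 20 * D P Q - (D P P + D Q Q)) + (# 21 * (D A P + D B Q) + # 8 * (D P Q + (D P P + D Q Q)))
    distance-inequality = Sextuple.sextuple-inequality K t₀ 0≤K A B lower P Q p₁ _ _ _ _ _ _
      (here A p₂) b~ x₁~ x₂~ x₃~ x₄~
      (≤.trans (single proj₁ A (here A p₂) ⟨+⟩ (single _ B b~ ⟨+⟩
          (single _ P x₁~ ⟨+⟩ (single _ Q x₂~ ⟨+⟩ (single _ P x₃~ ⟨+⟩ (single _ Q x₄~ ⟨+⟩ ≤.refl))))))
        (extend A p₂ _ (extend B p₃ _ (extend P p₄ _
            (extend Q p₅ _ (extend P (law Q) _ (≤.trans (≤.reflexive (trans (+-identityʳ _) (H-law Q)))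
          (H-mono (law Q) {U = List (F₂^ n)} {g = λ v → v ∷ []} λ _ _ _ _ → List.∷-injectiveˡ))))))))

  -- P and Q nearly minimise K d[P ; Q] + d[A ; P] + d[B ; Q] with K = 8 + κ, where
  -- competing with (B , A) bounds the minimum.
  near-minimisers : ∀ {n} (A B : RandomVariable n) {κ ε} → 0# ≤ κ → 0# < ε → ∃ λ P → ∃ λ Q →
    (κ * D P Q ≤ # 21 * ε) × (D A P + D B Q ≤ (# 10 + κ) * D A B + ε)
  near-minimisers A B {κ} {ε} 0≤κ 0<ε = P , Q ,
      ≤-via (solve 6 (λ κ k t ε e p → :# 21 :* ε :+ (:# 21 :* ((:# 8 :+ κ) :* k :+ e) :+ :# 21 :* t :+ κ :* :0)
          := κ :* k :+ (:# 21 :* (t :+ ε) :+ ((:# 8 :+ κ) :* (:# 20 :* k :- p) :+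
              (:# 21 :* e :+ :# 8 :* (k :+ p))) :+ κ :* p))
          refl κ (D P Q) t₀ ε (D A P + D B Q) (D P P + D Q Q))
        ((#-nonneg 21 ⟨*⟩ near) ⟨+⟩ distance-inequality K t₀ 0≤K A B lower P Q ⟨+⟩
            (0≤κ ⟨*⟩ +-nonneg (D-nonneg P P) (D-nonneg Q Q))) ,
      ≤-via (solve 6 (λ κ k t ε e d → ((:# 10 :+ κ) :* d :+ ε) :+
          (((:# 8 :+ κ) :* k :+ e) :+ t :+ (:# 8 :+ κ) :* :0)
          := e :+ (t :+ ε :+ ((:# 8 :+ κ) :* d :+ (d :+ d)) :+ (:# 8 :+ κ) :* k)) refl κ (D P Q) t₀ ε
              (D A P + D B Q) (D A B))
        (near ⟨+⟩ ≤.trans (lower B A) (≤.reflexive (+-cong (*-congˡ (D-sym B A)) (+-congˡ (D-sym B A)))) ⟨+⟩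
            (0≤K ⟨*⟩ D-nonneg P Q))
    where
    K = # 8 + κ
    0≤K : 0# ≤ K
    0≤K = +-nonneg (#-nonneg 8) 0≤κ
    τ : _ → _ → Carrier
    τ X Y = K * D X Y + (D A X + D B Y)
    S : Carrier → Set
    S x = ∃ λ X → ∃ λ Y → x ≈ - τ X Y
    S-sup : IsSup S (sup S)
    S-sup = completeness S (_ , A , B , refl) (0# , λ { x (X , Y , x≈) → ≤.trans (≤.reflexive x≈)
      (≤.trans (neg-mono-≤ (+-nonneg (*-nonneg 0≤K (D-nonneg X Y)) (+-nonneg (D-nonneg A X) (D-nonneg B Y))))
        (≤.reflexive (solve 0 (:- :0 := :0) refl))) })
    t₀ = - sup S
    lower : ∀ X Y → t₀ ≤ τ X Y
    lower X Y = ≤-via (solve 2 (λ τ s → τ :+ :- τ := :- s :+ s) refl _ _) (proj₁ S-sup _ (X , Y , refl))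
    approximate : ∃ λ y → S y × sup S - ε < y
    approximate = proj₂ S-sup (sup S - ε) (λ le → 0<ε
        (≤-via (solve 2 (λ s ε → :0 :+ s := ε :+ (s :- ε)) refl _ _) le))
    P = proj₁ (proj₁ (proj₂ approximate))
    Q = proj₁ (proj₂ (proj₁ (proj₂ approximate)))
    near : K * D P Q + (D A P + D B Q) ≤ t₀ + ε
    near = ≤-via (solve 3 (λ τ s ε → (:- s :+ ε) :+ (s :- ε) := τ :+ :- τ) refl _ _ _)
      (≤.trans (<⇒≤ (proj₂ (proj₂ approximate))) (≤.reflexive (proj₂ (proj₂ (proj₁ (proj₂ approximate))))))

module Limits (ℝ : RealField) where

  open RealField ℝ
  open OrderedField ℝ
  open Logarithm ℝ
  open FiniteProbability ℝ
  open RandomVariables ℝ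
  private module Ent = Entropy ℝ
  open Ent using (RandomVariable; Pr; Pr-nonneg; Pr-total; _⊟_; ∑; 𝟙-nonneg)

  Near : Carrier → Carrier → Carrier → Set
  Near x y ε = (x - y ≤ ε) × (y - x ≤ ε)

  Near-mono : ∀ {x y ε δ} → ε ≤ δ → Near x y ε → Near x y δ
  Near-mono ε≤δ (xy , yx) = ≤.trans xy ε≤δ , ≤.trans yx ε≤δ

  Near-cong : ∀ {x x′ y y′ ε} → x ≈ x′ → y ≈ y′ → Near x y ε → Near x′ y′ ε
  Near-cong x≈ y≈ (xy , yx) = ≤.trans (≤.reflexive (sym (+-cong x≈ (-‿cong y≈)))) xy ,
                              ≤.trans (≤.reflexive (sym (+-cong y≈ (-‿cong x≈)))) yx

  Near-refl : ∀ {x ε} → 0# ≤ ε → Near x x ε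
  Near-refl 0≤ε = ≤.trans (≤.reflexive (-‿inverseʳ _)) 0≤ε , ≤.trans (≤.reflexive (-‿inverseʳ _)) 0≤ε

  infix 4 _⟶_
  _⟶_ : (ℕ → Carrier) → Carrier → Set
  f ⟶ l = ∀ ε → 0# < ε → ∃ λ N → ∀ m → N ℕ.≤ m → Near (f m) l ε

  private
    variable
      f g : ℕ → Carrier
      k l : Carrier

  ⟶-by : ∀ c → 0# ≤ c → (∀ ε → 0# < ε → ∃ λ N → ∀ m → N ℕ.≤ m → Near (f m) l (c * ε)) → f ⟶ l
  ⟶-by c 0≤c approx ε 0<ε = let N , near = approx δ 0<δ in N , λ m N≤m → Near-mono cδ≤ε (near m N≤m)
    where
    0<1+c = +-pos 0<1 0≤c
    δ = (1# + c) ⁻¹ * ε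
    0<δ : 0# < δ
    0<δ = *-pos (⁻¹-pos 0<1+c) 0<ε
    cδ≤ε : c * δ ≤ ε
    cδ≤ε = begin
      c * δ                       ≤⟨ ≤-via (solve 2 (λ c δ → (:1 :+ c) :* δ :+ :0 := c :* δ :+ δ) refl c δ)
          (<⇒≤ 0<δ) ⟩
      (1# + c) * δ                ≈⟨ *-assoc _ _ _ ⟨
      (1# + c) * (1# + c) ⁻¹ * ε  ≈⟨ trans (*-congʳ (*-inverseʳ (<⇒≉ 0<1+c))) (*-identityˡ ε) ⟩
      ε                           ∎
      where open ≤-Reasoning

  both : ∀ {P Q : ℕ → Set} → (∃ λ N → ∀ m → N ℕ.≤ m → P m) → (∃ λ N → ∀ m → N ℕ.≤ m → Q m) →
         ∃ λ N → ∀ m → N ℕ.≤ m → P m × Q m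
  both (M , p) (N , q) = M ℕ.⊔ N , λ m ≤m → p m (ℕ.≤-trans (ℕ.m≤m⊔n M N) ≤m) , q m (ℕ.≤-trans (ℕ.m≤n⊔m M N) ≤m)

  map-eventually : ∀ {P Q : ℕ → Set} → (∀ m → P m → Q m) → (∃ λ N → ∀ m → N ℕ.≤ m → P m) → ∃ λ N → ∀ m → N ℕ.≤
      m → Q m
  map-eventually p⇒q (N , p) = N , λ m N≤m → p⇒q m (p m N≤m)

  ⟶-const : (λ _ → l) ⟶ l
  ⟶-const ε 0<ε = 0 , λ _ _ → Near-refl (<⇒≤ 0<ε)

  ⟶-cong : (∀ m → f m ≈ g m) → f ⟶ l → g ⟶ l
  ⟶-cong f≈g f⟶l ε 0<ε = map-eventually (λ m → Near-cong (f≈g m) refl) (f⟶l ε 0<ε)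

  ⟶-+ : f ⟶ k → g ⟶ l → (λ m → f m + g m) ⟶ k + l
  ⟶-+ f⟶k g⟶l = ⟶-by (# 2) (#-nonneg 2) λ ε 0<ε → map-eventually
    (λ m ((f≤ , ≤f) , (g≤ , ≤g)) → add f≤ g≤ , add ≤f ≤g) (both (f⟶k ε 0<ε) (g⟶l ε 0<ε))
    where
    add : ∀ {a b c d ε} → a - b ≤ ε → c - d ≤ ε → (a + c) - (b + d) ≤ # 2 * ε
    add p q = ≤-via (solve 5 (λ a b c d ε → :# 2 :* ε :+ ((a :- b) :+ (c :- d)) := ((a :+ c) :- (b :+ d)) :+
        (ε :+ ε)) refl _ _ _ _ _) (p ⟨+⟩ q)

  ⟶-neg : f ⟶ l → (λ m → - f m) ⟶ - l
  ⟶-neg f⟶l ε 0<ε = map-eventually (λ m (p , q) → flip q , flip p) (f⟶l ε 0<ε)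
    where
    flip : ∀ {a b} → b - a ≤ ε → - a - - b ≤ ε
    flip le = ≤.trans (≤.reflexive (solve 2 (λ a b → :- a :- :- b := b :- a) refl _ _)) le

  shrink : ∀ {u ε g} → 0# ≤ ε → 0# ≤ g → g ≤ 1# → u ≤ ε → g * u ≤ ε
  shrink {u} {ε} {g} 0≤ε 0≤g g≤1 u≤ε = begin
    g * u   ≤⟨ 0≤g ⟨*⟩ u≤ε ⟩
    g * ε   ≤⟨ *-mono-≤ 0≤g 0≤ε g≤1 ≤.refl ⟩
    1# * ε  ≈⟨ *-identityˡ ε ⟩
    ε       ∎
    where open ≤-Reasoning

  ⟶-* : (∀ m → 0# ≤ g m) → (∀ m → g m ≤ 1#) → 0# ≤ k → k ≤ 1# → f ⟶ k → g ⟶ l → (λ m → f m * g m) ⟶ k * l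
  ⟶-* 0≤g g≤1 0≤k k≤1 f⟶k g⟶l = ⟶-by (# 2) (#-nonneg 2) λ ε 0<ε → map-eventually
    (λ m ((f≤ , ≤f) , (g≤ , ≤g)) →
      ≤-via (solve 5 (λ f g k l ε → :# 2 :* ε :+ (g :* (f :- k) :+ k :* (g :- l)) := (f :* g :- k :* l) :+
          (ε :+ ε)) refl _ _ _ _ _) (shrink (<⇒≤ 0<ε) (0≤g m) (g≤1 m) f≤ ⟨+⟩ shrink (<⇒≤ 0<ε) 0≤k k≤1 g≤) ,
      ≤-via (solve 5 (λ f g k l ε → :# 2 :* ε :+ (g :* (k :- f) :+ k :* (l :- g)) := (k :* l :- f :* g) :+
          (ε :+ ε)) refl _ _ _ _ _) (shrink (<⇒≤ 0<ε) (0≤g m) (g≤1 m) ≤f ⟨+⟩ shrink (<⇒≤ 0<ε) 0≤k k≤1 ≤g))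
    (both (f⟶k ε 0<ε) (g⟶l ε 0<ε))

  ⟶-≤ : (∀ m → f m ≤ g m) → f ⟶ k → g ⟶ l → k ≤ l
  ⟶-≤ f≤g f⟶k g⟶l = -≤0⇒≤ ((≤0-by-small (#-nonneg 2) λ ε 0<ε → let N , near = both (f⟶k ε 0<ε) (g⟶l ε 0<ε) ; (_ , ≤f) , (g≤ , _) = near N ℕ.≤-refl in
      ≤-via (solve 5 (λ f g k l ε → ε :* :# 2 :+ ((k :- f) :+ (g :- l) :+ f) := (k :- l) :+ (ε :+ ε :+ g))
          refl _ _ _ _ _) (≤f ⟨+⟩ g≤ ⟨+⟩ f≤g N)))

  ⟶-unique : f ⟶ k → f ⟶ l → k ≈ l
  ⟶-unique p q = ≤.antisym (⟶-≤ (λ _ → ≤.refl) p q) (⟶-≤ (λ _ → ≤.refl) q p)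

  ⟶-∑ : ∀ n {F : ℕ → F₂^ n → Carrier} {L} → (∀ v → (λ m → F m v) ⟶ L v) → (λ m → ∑ n (F m)) ⟶ ∑ n L
  ⟶-∑ zero    F⟶L = F⟶L []
  ⟶-∑ (suc n) F⟶L = ⟶-+ (⟶-∑ n (λ v → F⟶L (false ∷ v))) (⟶-∑ n (λ v → F⟶L (true ∷ v)))

  η : ℕ → Carrier
  η m = fromℕ (suc m) ⁻¹

  η-pos : ∀ m → 0# < η m
  η-pos m = ⁻¹-pos (fromℕ-pos m)

  η-small : ∀ {ε} → 0# < ε → ∃ λ N → ∀ m → N ℕ.≤ m → η m ≤ ε
  η-small {ε} 0<ε = let N , ε⁻¹≤N = archimedean (ε ⁻¹) in N , λ m N≤m → *-cancelˡ-≤ (fromℕ-pos m) (begin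
    fromℕ (suc m) * η m   ≈⟨ *-inverseʳ (<⇒≉ (fromℕ-pos m)) ⟩
    1#                    ≈⟨ *-inverseˡ (<⇒≉ 0<ε) ⟨
    ε ⁻¹ * ε              ≤⟨ *-mono-≤ (⁻¹-nonneg′ 0<ε) (<⇒≤ 0<ε)
        (≤.trans ε⁻¹≤N (fromℕ-mono-≤ (ℕ.≤-trans N≤m (ℕ.n≤1+n m)))) ≤.refl ⟩
    fromℕ (suc m) * ε     ∎)
    where open ≤-Reasoning

  ⟶-η : ∀ {f l} → (∀ m → Near (f m) l (η m)) → f ⟶ l
  ⟶-η near ε 0<ε = map-eventually (λ m η≤ε → Near-mono η≤ε (near m)) (η-small 0<ε)

  entropyTerm : Carrier → Carrier
  entropyTerm x = if does (x ≟ 0#) then 0# else - (x * log₂ x)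

  entropyTerm-zero : ∀ {x} → x ≈ 0# → entropyTerm x ≈ 0#
  entropyTerm-zero {x} x≈0 with x ≟ 0#
  ... | yes _   = refl
  ... | no x≉0 = ⊥-elim (x≉0 x≈0)

  entropyTerm-pos : ∀ {x} → 0# < x → entropyTerm x ≈ - (x * log₂ x)
  entropyTerm-pos {x} 0<x with x ≟ 0#
  ... | yes x≈0 = ⊥-elim (<⇒≉ 0<x x≈0)
  ... | no _    = refl

  neg-log-nonneg : ∀ {x} → 0# < x → x ≤ 1# → 0# ≤ - log₂ x
  neg-log-nonneg 0<x x≤1 = neg-nonneg (≤.trans (log-mono-≤ 0<x x≤1) (≤.reflexive log-1))

  private
    zero-or-pos : ∀ {x} → 0# ≤ x → x ≈ 0# ⊎ 0# < x
    zero-or-pos {x} 0≤x with x ≟ 0#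
    ... | yes x≈0 = inj₁ x≈0
    ... | no x≉0  = inj₂ (≤∧≉⇒< 0≤x x≉0)

  entropyTerm-nonneg : ∀ {x} → 0# ≤ x → x ≤ 1# → 0# ≤ entropyTerm x
  entropyTerm-nonneg 0≤x x≤1 with zero-or-pos 0≤x
  ... | inj₁ x≈0 = ≤.reflexive (sym (entropyTerm-zero x≈0))
  ... | inj₂ 0<x = ≤.trans (*-nonneg 0≤x (neg-log-nonneg 0<x x≤1))
                     (≤.reflexive (trans (solve 2 (λ x l → x :* :- l := :- (x :* l)) refl _ _)
                         (sym (entropyTerm-pos 0<x))))

  -- From log (1 / (M x)) ≤ log₂e / (M x).
  entropyTerm-near-zero : ∀ {x M} → 0# ≤ x → 1# ≤ M → entropyTerm x ≤ log₂e * M ⁻¹ + x * log₂ M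
  entropyTerm-near-zero {x} {M} 0≤x 1≤M with zero-or-pos 0≤x
  ... | inj₁ x≈0 = ≤.trans (≤.reflexive (entropyTerm-zero x≈0))
                     (+-nonneg (*-nonneg log₂e-nonneg (⁻¹-nonneg′ (<-≤-trans 0<1 1≤M)))
                         (*-nonneg 0≤x (log-nonneg 1≤M)))
  ... | inj₂ 0<x = begin
    entropyTerm x                                       ≈⟨ entropyTerm-pos 0<x ⟩
    - (x * log₂ x)                                      ≈⟨ solve 3
        (λ x l m → :- (x :* l) := x :* (:- l :+ :- m) :+ x :* m) refl x (log₂ x) (log₂ M) ⟩
    x * (- log₂ x + - log₂ M) + x * log₂ M              ≈⟨ +-congʳ
        (*-congˡ (trans (log-* (⁻¹-pos 0<x) (⁻¹-pos 0<M)) (+-cong (log-⁻¹ 0<x) (log-⁻¹ 0<M)))) ⟨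
    x * log₂ (x ⁻¹ * M ⁻¹) + x * log₂ M                 ≤⟨
        (0≤x ⟨*⟩ log-tangent (*-pos (⁻¹-pos 0<x) (⁻¹-pos 0<M))) ⟨+⟩ ≤.refl ⟩
    x * (log₂e * (x ⁻¹ * M ⁻¹ - 1#)) + x * log₂ M       ≈⟨ +-congʳ
        (solve 4 (λ x e y z → x :* (e :* (y :* z :- :1)) := e :* ((x :* y) :* z) :- x :* e) refl x log₂e
        (x ⁻¹) (M ⁻¹)) ⟩
    (log₂e * ((x * x ⁻¹) * M ⁻¹) - x * log₂e) + x * log₂ M ≈⟨ +-congʳ
        (+-congʳ (*-congˡ (trans (*-congʳ (*-inverseʳ (<⇒≉ 0<x))) (*-identityˡ _)))) ⟩
    (log₂e * M ⁻¹ - x * log₂e) + x * log₂ M             ≤⟨ ≤-via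
        (solve 3 (λ a b c → (a :+ c) :+ :0 := ((a :- b) :+ c) :+ b) refl _ _ _) (*-nonneg 0≤x log₂e-nonneg) ⟩
    log₂e * M ⁻¹ + x * log₂ M                           ∎
    where
    open ≤-Reasoning
    0<M = <-≤-trans 0<1 1≤M

  ⟶-entropyTerm : (∀ m → 0# ≤ f m) → (∀ m → f m ≤ 1#) → 0# ≤ l → l ≤ 1# → f ⟶ l → (λ m → entropyTerm (f m)) ⟶
      entropyTerm l
  ⟶-entropyTerm {f} {l} 0≤f f≤1 0≤l l≤1 f⟶l with zero-or-pos 0≤l
  ... | inj₁ l≈0 = ⟶-by (log₂e + 1#) (+-nonneg log₂e-nonneg 0≤1) at-zero
    where
    at-zero : ∀ ε → 0# < ε → ∃ λ N → ∀ m → N ℕ.≤ m → Near (entropyTerm (f m)) (entropyTerm l) ((log₂e + 1#) * ε)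
    at-zero ε 0<ε = map-eventually bound (f⟶l δ 0<δ)
      where
      K = proj₁ (archimedean (ε ⁻¹))
      M = fromℕ (suc K)
      0<M = fromℕ-pos K
      1≤M : 1# ≤ M
      1≤M = x≤x+y 1# (fromℕ-nonneg K)
      M⁻¹≤ε : M ⁻¹ ≤ ε
      M⁻¹≤ε = proj₂ (η-small 0<ε) K ℕ.≤-refl
      L = log₂ M
      0≤L = log-nonneg 1≤M
      0<1+L = +-pos 0<1 0≤L
      δ = (1# + L) ⁻¹ * ε
      0<δ : 0# < δ
      0<δ = *-pos (⁻¹-pos 0<1+L) 0<ε
      δL≤ε : δ * L ≤ ε
      δL≤ε = begin
        δ * L                        ≤⟨ ≤-via (solve 2 (λ L δ → (:1 :+ L) :* δ :+ :0 := δ :* L :+ δ) refl L δ)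
            (<⇒≤ 0<δ) ⟩
        (1# + L) * δ                 ≈⟨ *-assoc _ _ _ ⟨
        (1# + L) * (1# + L) ⁻¹ * ε   ≈⟨ trans (*-congʳ (*-inverseʳ (<⇒≉ 0<1+L))) (*-identityˡ ε) ⟩
        ε                            ∎
        where open ≤-Reasoning
      bound : ∀ m → Near (f m) l δ → Near (entropyTerm (f m)) (entropyTerm l) ((log₂e + 1#) * ε)
      bound m (f-l≤δ , _) = Near-cong refl (sym (entropyTerm-zero l≈0))
        (≤.trans (≤.reflexive (solve 1 (λ x → x :- :0 := x) refl _)) (≤.trans (entropyTerm-near-zero (0≤f m) 1≤M)
           (≤.trans ((log₂e-nonneg ⟨*⟩ M⁻¹≤ε) ⟨+⟩ ≤.trans (*-mono-≤ (0≤f m) 0≤L f≤δ ≤.refl) δL≤ε)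
             (≤.reflexive (solve 2 (λ e x → e :* x :+ x := (e :+ :1) :* x) refl log₂e ε)))) ,
         ≤.trans (≤-via (solve 1 (λ x → :0 :+ :0 := (:0 :- x) :+ x) refl _) (entropyTerm-nonneg (0≤f m) (f≤1 m)))
           (*-nonneg (+-nonneg log₂e-nonneg 0≤1) (<⇒≤ 0<ε)))
        where
        f≤δ : f m ≤ δ
        f≤δ = ≤.trans (≤.reflexive (trans (solve 1 (λ x → x := x :- :0) refl _) (+-congˡ (-‿cong (sym l≈0))))) f-l≤δ
  ... | inj₂ 0<l = ⟶-by (log₂e * l ⁻¹ + log₂e + ℓ) 0≤C λ ε 0<ε →
      map-eventually (λ m (near , near′) → bound ε (<⇒≤ 0<ε) m near (positive m near′))
          (both (f⟶l ε 0<ε) (f⟶l (½ * l) (*-pos (⁻¹-pos 0<2) 0<l)))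
    where
    ℓ = - log₂ l
    0≤ℓ : 0# ≤ ℓ
    0≤ℓ = neg-log-nonneg 0<l l≤1
    C = log₂e * l ⁻¹ + log₂e + ℓ
    0≤e/l : 0# ≤ log₂e * l ⁻¹
    0≤e/l = *-nonneg log₂e-nonneg (⁻¹-nonneg′ 0<l)
    0≤C : 0# ≤ C
    0≤C = +-nonneg (+-nonneg 0≤e/l log₂e-nonneg) 0≤ℓ
    positive : ∀ m → Near (f m) l (½ * l) → 0# < f m
    positive m (_ , l-f≤) f≤0 = *-pos (⁻¹-pos 0<2) 0<l (≤-via
      (trans (solve 4 (λ h f l z → z :+ ((l :- f) :+ f :+ (:1 :+ (:1 :+ :0)) :* h :* l) := h :* l :+
          (h :* l :+ z :+ l)) refl ½ (f m) l 0#)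
        (+-congˡ (+-congˡ (sym (trans (*-congʳ (*-inverseʳ (<⇒≉ 0<2))) (*-identityˡ l))))))
      (l-f≤ ⟨+⟩ f≤0 ⟨+⟩ ≤.refl))
    bound : ∀ ε → 0# ≤ ε → ∀ m → Near (f m) l ε → 0# < f m → Near (entropyTerm (f m)) (entropyTerm l) (C * ε)
    bound ε 0≤ε m (f-l≤ε , l-f≤ε) 0<f = Near-cong (sym (entropyTerm-pos 0<f)) (sym (entropyTerm-pos 0<l))
      ( ≤-via (solve 7 (λ x l L k e ε C′ → (C′ :+ e :+ :- k) :* ε :+
          (x :* (:- :- k :- L) :+ e :* (l :- x) :+ :- k :* (x :- l) :+ :0)
           := (:- (x :* L) :- :- (l :* k)) :+ (e :* (l :- x) :+ e :* ε :+ :- k :* ε :+ C′ :* ε)) refl x l L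
               (log₂ l) log₂e ε (log₂e * l ⁻¹))
          (lower ⟨+⟩ (log₂e-nonneg ⟨*⟩ l-f≤ε) ⟨+⟩ (0≤ℓ ⟨*⟩ f-l≤ε) ⟨+⟩ *-nonneg 0≤e/l 0≤ε)
      , ≤-via (solve 7 (λ x l L k e ε C′ → (C′ :+ e :+ :- k) :* ε :+
          (x :* (L :- :- :- k) :+ C′ :* (x :* (x :- l)) :+ :- k :* (l :- x) :+ :0)
           := (:- (l :* k) :- :- (x :* L)) :+ (C′ :* (x :* (x :- l)) :+ C′ :* ε :+ :- k :* ε :+ e :* ε)) refl
               x l L (log₂ l) log₂e ε (log₂e * l ⁻¹))
          (upper ⟨+⟩ (0≤e/l ⟨*⟩ shrink 0≤ε (0≤f m) (f≤1 m) f-l≤ε) ⟨+⟩ (0≤ℓ ⟨*⟩ l-f≤ε) ⟨+⟩ *-nonneg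
              log₂e-nonneg 0≤ε) )
      where
      open ≤-Reasoning
      x = f m
      L = log₂ x
      lower : x * (- ℓ - L) ≤ log₂e * (l - x)
      lower = begin
        x * (- ℓ - L)                      ≈⟨ *-congˡ
            (trans (solve 2 (λ k L → :- :- k :- L := k :+ :- L) refl (log₂ l) L)
                                                (sym (trans (log-* 0<l (⁻¹-pos 0<f)) (+-congˡ (log-⁻¹ 0<f))))) ⟩
        x * log₂ (l * x ⁻¹)                ≤⟨ 0≤f m ⟨*⟩ log-tangent (*-pos 0<l (⁻¹-pos 0<f)) ⟩
        x * (log₂e * (l * x ⁻¹ - 1#))      ≈⟨ solve 4
            (λ x y l e → x :* (e :* (l :* y :- :1)) := e :* (l :* (x :* y) :- x)) refl x (x ⁻¹) l log₂e ⟩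
        log₂e * (l * (x * x ⁻¹) - x)       ≈⟨ *-congˡ
            (+-congʳ (trans (*-congˡ (*-inverseʳ (<⇒≉ 0<f))) (*-identityʳ l))) ⟩
        log₂e * (l - x)                    ∎
      upper : x * (L - - ℓ) ≤ (log₂e * l ⁻¹) * (x * (x - l))
      upper = begin
        x * (L - - ℓ)                      ≈⟨ *-congˡ
            (trans (solve 2 (λ k L → L :- :- :- k := L :+ :- k) refl (log₂ l) L)
                                                (sym (trans (log-* 0<f (⁻¹-pos 0<l)) (+-congˡ (log-⁻¹ 0<l))))) ⟩
        x * log₂ (x * l ⁻¹)                ≤⟨ 0≤f m ⟨*⟩ log-tangent (*-pos 0<f (⁻¹-pos 0<l)) ⟩
        x * (log₂e * (x * l ⁻¹ - 1#))      ≈⟨ *-congˡ (*-congˡ (+-congˡ (-‿cong (sym (*-inverseʳ (<⇒≉ 0<l)))))) ⟩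
        x * (log₂e * (x * l ⁻¹ - l * l ⁻¹)) ≈⟨ solve 4
            (λ x y l e → x :* (e :* (x :* y :- l :* y)) := (e :* y) :* (x :* (x :- l))) refl x (l ⁻¹) l log₂e
            ⟩
        (log₂e * l ⁻¹) * (x * (x - l))     ∎

  ⟶-*ˡ : ∀ c → 0# ≤ c → f ⟶ l → (λ m → c * f m) ⟶ c * l
  ⟶-*ˡ c 0≤c f⟶l = ⟶-by c 0≤c λ ε 0<ε → map-eventually (λ m (p , q) → scale p , scale q) (f⟶l ε 0<ε)
    where
    scale : ∀ {a b ε} → a - b ≤ ε → c * a - c * b ≤ c * ε
    scale le = ≤.trans (≤.reflexive (solve 3 (λ c a b → c :* a :- c :* b := c :* (a :- b)) refl _ _ _)) (0≤c ⟨*⟩ le)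

  Pr≤1 : ∀ {n} (X : RandomVariable n) v → Pr X v ≤ 1#
  Pr≤1 {n} X v = ≤.trans (Finite.term≤sum (vectors n) (Pr-nonneg X) v) (≤.reflexive (Pr-total X))

  infix 4 _⟶ᴿ_
  _⟶ᴿ_ : ∀ {n} → (ℕ → RandomVariable n) → RandomVariable n → Set
  Xs ⟶ᴿ X = ∀ v → (λ m → Pr (Xs m) v) ⟶ Pr X v

  module _ {n : ℕ} where

    private
      variable
        Xs Ys : ℕ → RandomVariable n

    ⟶-H : ∀ (X : RandomVariable n) → Xs ⟶ᴿ X → (λ m → Ent.H (Xs m)) ⟶ Ent.H X
    ⟶-H {Xs} X Xs⟶X = ⟶-∑ n λ v → ⟶-entropyTerm (λ m → Pr-nonneg (Xs m) v) (λ m → Pr≤1 (Xs m) v)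
        (Pr-nonneg X v) (Pr≤1 X v) (Xs⟶X v)

    ⟶-⊟ : ∀ (X Y : RandomVariable n) → Xs ⟶ᴿ X → Ys ⟶ᴿ Y → (λ m → Xs m ⊟ Ys m) ⟶ᴿ X ⊟ Y
    ⟶-⊟ {Xs} {Ys} X Y Xs⟶X Ys⟶Y z = ⟶-∑ n λ x → ⟶-∑ n λ y → ⟶-*
      (λ _ → 𝟙-nonneg (x ⊖ y ≟ᵛ z)) (λ _ → ≤.trans (≤.reflexive (sym (𝟏≈𝟙 (x ⊖ y ≟ᵛ z)))) (𝟏≤1 {x ⊖ y ≡ z}))
      (*-nonneg (Pr-nonneg X x) (Pr-nonneg Y y)) (≤.trans (*-mono-≤ (Pr-nonneg X x) 0≤1 (Pr≤1 X x) (Pr≤1 Y y))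
          (≤.reflexive (*-identityˡ 1#)))
      (⟶-* (λ m → Pr-nonneg (Ys m) y) (λ m → Pr≤1 (Ys m) y) (Pr-nonneg X x) (Pr≤1 X x) (Xs⟶X x) (Ys⟶Y y))
      ⟶-const

    ⟶-D : ∀ (X Y : RandomVariable n) → Xs ⟶ᴿ X → Ys ⟶ᴿ Y → (λ m → D (Xs m) (Ys m)) ⟶ D X Y
    ⟶-D {Xs} {Ys} X Y Xs⟶X Ys⟶Y = ⟶-+ (⟶-+ H⟶ H⟶) (⟶-neg (⟶-+ (⟶-H {Xs} X Xs⟶X) (⟶-H {Ys} Y Ys⟶Y)))
      where H⟶ = ⟶-H {λ m → Xs m ⊟ Ys m} (X ⊟ Y) (⟶-⊟ {Xs} {Ys} X Y Xs⟶X Ys⟶Y)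

  -- Bolzano–Weierstrass: y is the limit superior of the points satisfying P.
  cluster-point : (P : Carrier → Carrier → Set) → (∀ {ε δ x} → ε ≤ δ → P ε x → P δ x) →
                  (∀ ε → 0# < ε → ∃ λ x → P ε x × 0# ≤ x × x ≤ 1#) →
                  ∃ λ y → ∀ ε → 0# < ε → ∃ λ x → P ε x × Near x y ε
  cluster-point P P-mono inhabited = y , near
    where
    S : Carrier → Set
    S s = ∀ ε → 0# < ε → ∃ λ x → P ε x × s ≤ x × x ≤ 1#
    y = sup S
    y-sup : IsSup S y
    y-sup = completeness S (0# , λ ε 0<ε → inhabited ε 0<ε)
      (1# , λ s s∈ → let x , _ , s≤x , x≤1 = s∈ 1# 0<1 in ≤.trans s≤x x≤1)
    near : ∀ ε → 0# < ε → ∃ λ x → P ε x × Near x y ε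
    near ε 0<ε with proj₂ y-sup (y - ε) (λ le → 0<ε
        (≤-via (solve 2 (λ y ε → :0 :+ y := ε :+ (y :- ε)) refl _ _) le))
                  | excludedMiddle {∃ λ δ → 0# < δ × ¬ ∃ λ x → P δ x × y + ε ≤ x × x ≤ 1#}
    ... | s , s∈ , y-ε<s | no ¬bounded = ⊥-elim (0<ε
        (≤-via (solve 2 (λ y ε → :0 :+ (y :+ ε) := ε :+ y) refl _ _) (proj₁ y-sup (y + ε) λ δ 0<δ →
            case δ 0<δ (excludedMiddle))))
      where
      case : ∀ δ → 0# < δ → Dec (∃ λ x → P δ x × y + ε ≤ x × x ≤ 1#) → ∃ λ x → P δ x × y + ε ≤ x × x ≤ 1#
      case δ 0<δ (yes p) = p
      case δ 0<δ (no ¬p) = ⊥-elim (¬bounded (δ , 0<δ , ¬p))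
    ... | s , s∈ , y-ε<s | yes (δ , 0<δ , empty) = result (≤.total ε δ)
      where
      at : ∀ ζ → 0# < ζ → ζ ≤ ε → ζ ≤ δ → ∃ λ x → P ε x × Near x y ε
      at ζ 0<ζ ζ≤ε ζ≤δ = let x , Px , s≤x , x≤1 = s∈ ζ 0<ζ in x , P-mono ζ≤ε Px ,
        ≤-via (solve 3 (λ x y ε → ε :+ x := (x :- y) :+ (y :+ ε)) refl _ _ _)
            (<⇒≤ λ y+ε≤x → empty (x , P-mono ζ≤δ Px , y+ε≤x , x≤1)) ,
        ≤-via (solve 4 (λ x y ε s → ε :+ ((y :- ε) :+ s) := (y :- x) :+ (s :+ x)) refl _ _ _ _) (<⇒≤ y-ε<s ⟨+⟩ s≤x)
      result : ε ≤ δ ⊎ δ ≤ ε → ∃ λ x → P ε x × Near x y ε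
      result (inj₁ ε≤δ) = at ε 0<ε ≤.refl ε≤δ
      result (inj₂ δ≤ε) = at δ 0<δ δ≤ε ≤.refl

  cluster-function : ∀ n (P : Carrier → (F₂^ n → Carrier) → Set) → (∀ {ε δ f} → ε ≤ δ → P ε f → P δ f) →
                     (∀ ε → 0# < ε → ∃ λ f → P ε f × (∀ v → 0# ≤ f v × f v ≤ 1#)) →
                     ∃ λ (g : F₂^ n → Carrier) → ∀ ε → 0# < ε → ∃ λ f → P ε f × (∀ v → Near (f v) (g v) ε)
  cluster-function zero P P-mono inhabited =
    let y , near = cluster-point (λ ε x → ∃ λ f → P ε f × f [] ≈ x) (λ ε≤δ (f , Pf , eq) → f , P-mono ε≤δ Pf , eq)
                     (λ ε 0<ε → let f , Pf , bounds = inhabited ε 0<ε in f [] , (f , Pf , refl) , bounds [])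
    in (λ _ → y) , λ ε 0<ε → let x , (f , Pf , eq) , x~y = near ε 0<ε in f , Pf , λ { [] → Near-cong (sym eq) refl x~y }
  cluster-function (suc n) P P-mono inhabited =
    let g₀ , near₀ = cluster-function n
          (λ ε f₀ → ∃ λ f → P ε f × (∀ v → 0# ≤ f v × f v ≤ 1#) × (∀ v → f (false ∷ v) ≈ f₀ v))
          (λ ε≤δ (f , Pf , rest) → f , P-mono ε≤δ Pf , rest)
          (λ ε 0<ε → let f , Pf , bounds = inhabited ε 0<ε in
            (λ v → f (false ∷ v)) , (f , Pf , bounds , λ _ → refl) , λ v → bounds (false ∷ v))
        g₁ , near₁ = cluster-function n
          (λ ε f₁ → ∃ λ f → P ε f × (∀ v → Near (f (false ∷ v)) (g₀ v) ε) × (∀ v → f (true ∷ v) ≈ f₁ v))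
          (λ ε≤δ (f , Pf , close , eq) → f , P-mono ε≤δ Pf , (λ v → Near-mono ε≤δ (close v)) , eq)
          (λ ε 0<ε → let f₀ , (f , Pf , bounds , eq) , close = near₀ ε 0<ε in
            (λ v → f (true ∷ v)) , (f , Pf , (λ v → Near-cong (sym (eq v)) refl (close v)) , λ _ → refl) , λ v
                → bounds (true ∷ v))
    in (λ { (false ∷ v) → g₀ v ; (true ∷ v) → g₁ v }) ,
       λ ε 0<ε → let f₁ , (f , Pf , close₀ , eq) , close₁ = near₁ ε 0<ε in
         f , Pf , λ { (false ∷ v) → close₀ v ; (true ∷ v) → Near-cong (sym (eq v)) refl (close₁ v) }

module Extremal (ℝ : RealField) where

  open RealField ℝ
  open OrderedField ℝ
  open Logarithm ℝ
  open FiniteProbability ℝ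
  open Conditioning ℝ
  open RandomVariables ℝ
  open NearMinimisers ℝ
  open Limits ℝ
  open LinearCombinations
  open Finite using (Element)
  private module Ent = Entropy ℝ
  open Ent using (RandomVariable; Pr; Pr-nonneg; Pr-total; _⊟_; ∑; 𝟙; U; card)

  limit-of-near-minimisers : ∀ {n} (A B : RandomVariable n) →
    ∃ λ X → ∃ λ Y → (D X Y ≤ 0#) × (D A X + D B Y ≤ # 10 * D A B)
  limit-of-near-minimisers {n} A B = X , Y ,
    ≤.trans (⟶-≤ (λ m → proj₁ (proj₂ (bounds m))) (⟶-D {Xs = Ps} {Qs} X Y Ps⟶X Qs⟶Y)
        (⟶-*ˡ (# 21) (#-nonneg 21) η⟶0)) (≤.reflexive (zeroʳ _)) ,
    ≤.trans (⟶-≤ (λ m → ≤.trans (proj₂ (proj₂ (bounds m))) (simplify m))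
        (⟶-+ (⟶-D {Xs = λ _ → A} {Ps} A X (λ _ → ⟶-const) Ps⟶X) (⟶-D {Xs = λ _ → B} {Qs} B Y (λ _ → ⟶-const) Qs⟶Y))
        (⟶-+ ⟶-const (⟶-*ˡ (D A B + 1#) (+-nonneg (D-nonneg A B) 0≤1) η⟶0)))
      (≤.reflexive (trans (+-congˡ (zeroʳ _)) (+-identityʳ _)))
    where
    Bounds : Carrier → RandomVariable n → RandomVariable n → Set
    Bounds ε P Q = 0# ≤ ε × (D P Q ≤ # 21 * ε) × (D A P + D B Q ≤ (# 10 + ε) * D A B + ε * ε)
    Good : Carrier → (F₂^ (suc n) → Carrier) → Set
    Good ε f = ∃ λ P → ∃ λ Q → (∀ v → f (false ∷ v) ≈ Pr P v) × (∀ v → f (true ∷ v) ≈ Pr Q v) × Bounds ε P Q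
    Good-mono : ∀ {ε δ f} → ε ≤ δ → Good ε f → Good δ f
    Good-mono ε≤δ (P , Q , f₀ , f₁ , 0≤ε , PQ , APBQ) = let 0≤δ = ≤.trans 0≤ε ε≤δ in P , Q , f₀ , f₁ , 0≤δ ,
      ≤.trans PQ (#-nonneg 21 ⟨*⟩ ε≤δ) ,
      ≤.trans APBQ (*-mono-≤ (+-nonneg (#-nonneg 10) 0≤ε) (D-nonneg A B) (≤.refl ⟨+⟩ ε≤δ) ≤.refl ⟨+⟩ *-mono-≤
          0≤ε 0≤δ ε≤δ ε≤δ)
    inhabited : ∀ ε → 0# < ε → ∃ λ f → Good ε f × (∀ v → 0# ≤ f v × f v ≤ 1#)
    inhabited ε 0<ε = let P , Q , PQ , APBQ = near-minimisers A B (<⇒≤ 0<ε) (*-pos 0<ε 0<ε) in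
      (λ { (false ∷ v) → Pr P v ; (true ∷ v) → Pr Q v }) ,
      (P , Q , (λ _ → refl) , (λ _ → refl) , <⇒≤ 0<ε ,
        *-cancelˡ-≤ 0<ε (≤.trans PQ (≤.reflexive (solve 2 (λ c ε → c :* (ε :* ε) := ε :* (c :* ε)) refl _ _)))
            , APBQ) ,
      λ { (false ∷ v) → Pr-nonneg P v , Pr≤1 P v ; (true ∷ v) → Pr-nonneg Q v , Pr≤1 Q v }
    cluster = cluster-function (suc n) Good (λ {ε} {δ} {f} → Good-mono {ε} {δ} {f}) inhabited
    g = proj₁ cluster
    sequence = λ m → proj₂ cluster (η m) (η-pos m)
    Ps Qs : ℕ → RandomVariable n
    Ps m = proj₁ (proj₁ (proj₂ (sequence m)))
    Qs m = proj₁ (proj₂ (proj₁ (proj₂ (sequence m))))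
    bounds : ∀ m → Bounds (η m) (Ps m) (Qs m)
    bounds m = proj₂ (proj₂ (proj₂ (proj₂ (proj₁ (proj₂ (sequence m))))))
    Ps⟶ : ∀ v → (λ m → Pr (Ps m) v) ⟶ g (false ∷ v)
    Ps⟶ v = ⟶-η λ m → Near-cong (proj₁ (proj₂ (proj₂ (proj₁ (proj₂ (sequence m))))) v) refl
        (proj₂ (proj₂ (sequence m)) (false ∷ v))
    Qs⟶ : ∀ v → (λ m → Pr (Qs m) v) ⟶ g (true ∷ v)
    Qs⟶ v = ⟶-η λ m → Near-cong (proj₁ (proj₂ (proj₂ (proj₂ (proj₁ (proj₂ (sequence m)))))) v) refl
        (proj₂ (proj₂ (sequence m)) (true ∷ v))
    limit : ∀ (Xs : ℕ → RandomVariable n) l → (∀ v → (λ m → Pr (Xs m) v) ⟶ l v) → RandomVariable n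
    limit Xs l Xs⟶l = record
      { Pr        = l
      ; Pr-nonneg = λ v → ⟶-≤ (λ m → Pr-nonneg (Xs m) v) ⟶-const (Xs⟶l v)
      ; Pr-total  = ⟶-unique (⟶-∑ n Xs⟶l) (⟶-cong (λ m → sym (Pr-total (Xs m))) ⟶-const)
      }
    X Y : RandomVariable n
    X = limit Ps _ Ps⟶
    Y = limit Qs _ Qs⟶
    Ps⟶X : Ps ⟶ᴿ X
    Ps⟶X = Ps⟶
    Qs⟶Y : Qs ⟶ᴿ Y
    Qs⟶Y = Qs⟶
    η≤1 : ∀ m → η m ≤ 1#
    η≤1 m = *-cancelˡ-≤ (fromℕ-pos m) (≤.trans (≤.reflexive (*-inverseʳ (<⇒≉ (fromℕ-pos m))))
      (≤.trans (x≤x+y 1# (fromℕ-nonneg m)) (≤.reflexive (sym (*-identityʳ _)))))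
    η⟶0 : η ⟶ 0#
    η⟶0 = ⟶-η λ m → ≤.reflexive (solve 1 (λ x → x :- :0 := x) refl _) ,
      ≤-via (solve 1 (λ x → x :+ :0 := (:0 :- x) :+ (x :+ x)) refl _) (+-nonneg (<⇒≤ (η-pos m)) (<⇒≤ (η-pos m)))
    simplify : ∀ m → (# 10 + η m) * D A B + η m * η m ≤ # 10 * D A B + (D A B + 1#) * η m
    simplify m = ≤-via (solve 2 (λ d e → (:# 10 :* d :+ (d :+ :1) :* e) :+ e :* e :=
        ((:# 10 :+ e) :* d :+ e :* e) :+ e :* :1) refl _ _)
      (<⇒≤ (η-pos m) ⟨*⟩ η≤1 m)

  ∑-translate : ∀ n (f : F₂^ n → Carrier) w → ∑ n (λ z → f (z ⊕ w)) ≈ ∑ n f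
  ∑-translate zero    f []          = refl
  ∑-translate (suc n) f (false ∷ w) = +-cong (∑-translate n _ w) (∑-translate n _ w)
  ∑-translate (suc n) f (true ∷ w)  = trans (+-comm _ _) (+-cong (∑-translate n _ w) (∑-translate n _ w))

  D-translate : ∀ {n} (A X U : RandomVariable n) u → (∀ w → Pr X (u ⊕ w) ≈ Pr U w) → D A X ≈ D A U
  D-translate {n} A X U u shift = +-cong (+-cong H-diff H-diff) (-‿cong (+-congˡ H-law≈))
    where
    p = pairLaw A X
    V = vectors n
    x′ : Element (V ⊗ V) → F₂^ n
    x′ (a , x) = x ⊕ u
    x′~U : HasLaw p x′ U
    x′~U w = trans (ℙ-cong p (λ { (a , x) _ ≡.refl → ≡.trans (≡.sym (⊕-cancelʳ x u)) (⊕-comm (x ⊕ u) u) })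
                             (λ { (a , x) _ ≡.refl → ≡.trans (≡.cong (_⊕ u) (⊕-comm u w)) (⊕-cancelʳ w u) }))
      (trans (snd~Y A X (u ⊕ w)) (shift w))
    H-law≈ : Ent.H X ≈ Ent.H U
    H-law≈ = trans (H-Y A X) (trans (H-cong p (λ (a , x) (a′ , x′) _ _ eq → ⊕-injectiveʳ {u = x} {x′} eq
        ≡.refl) (λ _ _ _ _ → ≡.cong (_⊕ u)))
      (sym (H-hasLaw p x′ U x′~U)))
    independent : H p proj₁ + H p x′ ≤ H p (proj₁ ▵ x′)
    independent = ≤.trans (≤.refl ⟨+⟩ H-mono p (λ _ _ _ _ → ≡.cong (_⊕ u))) (≤.trans (pair-independent A X)
      (H-mono p λ (a , x) (a′ , x″) _ _ eq → ≡.cong₂ _,_ (≡.cong proj₁ eq)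
          (⊕-injectiveʳ {u = x} {x″} (≡.cong proj₂ eq) ≡.refl)))
    H-diff : Ent.H (A ⊟ X) ≈ Ent.H (A ⊟ U)
    H-diff = trans (H-difference A X) (trans
      (H-cong p (λ (a , x) (a′ , x″) _ _ eq → ⊕-injectiveʳ {v = u}
          (≡.trans (⊕-assoc a x u) (≡.trans eq (≡.sym (⊕-assoc a′ x″ u)))) ≡.refl)
                (λ (a , x) (a′ , x″) _ _ eq → ≡.trans (≡.sym (⊕-assoc a x u))
                    (≡.trans (≡.cong (_⊕ u) eq) (⊕-assoc a′ x″ u))))
      (sym (H-hasLaw p (λ ω → proj₁ ω ⊖ x′ ω) (A ⊟ U)
          (difference-hasLaw p proj₁ x′ A U (fst~X A X) x′~U
          (entropic-independence p proj₁ x′ independent)))))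

  module ZeroDistance {n} (X Y : RandomVariable n) (D≤0 : D X Y ≤ 0#) where

    private
      p = pairLaw X Y
      S = X ⊟ Y
      module V = Finite (vectors n)

    HS≤HX : Ent.H S ≤ Ent.H X
    HS≤HX = ≤-via (solve 3 (λ s x y → x :+ (((s :+ s) :- (x :+ y)) :+ y) := s :+ (:0 :+ s)) refl _ _ _)
        (D≤0 ⟨+⟩ H-right≤ X Y)

    HS≤HY : Ent.H S ≤ Ent.H Y
    HS≤HY = ≤-via (solve 3 (λ s x y → y :+ (((s :+ s) :- (x :+ y)) :+ x) := s :+ (:0 :+ s)) refl _ _ _)
        (D≤0 ⟨+⟩ H-left≤ X Y)

    private
      cancel : ∀ {a b c} → 0# < c → a * c ≈ b * c → a ≈ b
      cancel 0<c eq = ≤.antisym (*-cancelˡ-≤ 0<c (≤.reflexive (trans (*-comm _ _) (trans eq (*-comm _ _)))))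
                                (*-cancelˡ-≤ 0<c (≤.reflexive (trans (*-comm _ _) (trans (sym eq) (*-comm _ _)))))

    S≈X : ∀ {u v} → 0# < Pr X u → 0# < Pr Y v → Pr S (u ⊖ v) ≈ Pr X u
    S≈X {u} {v} 0<X 0<Y = cancel 0<Y (begin
      Pr S (u ⊖ v) * Pr Y v
        ≈⟨ *-cong (difference~ X Y (u ⊖ v)) (snd~Y X Y v) ⟨
      ℙ p (difference X Y) (u ⊖ v) * ℙ p proj₂ v
        ≈⟨ entropic-independence p (difference X Y) proj₂ (≤.trans
             (≤.reflexive (sym (+-cong (H-difference X Y) (H-Y X Y))) )
                 (≤.trans (HS≤HX ⟨+⟩ ≤.refl) (HX+HY≤difference,snd X Y))) (u , v) (*-pos 0<X 0<Y) ⟨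
      ℙ p (difference X Y ▵ proj₂) (u ⊖ v , v)
        ≈⟨ ℙ-cong p {g = id} {u = u , v} (λ (x , y) _ eq → ≡.cong₂ _,_
            (⊕-injectiveʳ {u = x} {u} (≡.cong proj₁ eq) (≡.cong proj₂ eq)) (≡.cong proj₂ eq))
             (λ { _ _ ≡.refl → ≡.refl }) ⟩
      ℙ p id (u , v)
        ≈⟨ ℙ-id p (u , v) ⟩
      Pr X u * Pr Y v ∎)
      where open ≈-Reasoning

    S≈Y : ∀ {u v} → 0# < Pr X u → 0# < Pr Y v → Pr S (u ⊖ v) ≈ Pr Y v
    S≈Y {u} {v} 0<X 0<Y = cancel 0<X (begin
      Pr S (u ⊖ v) * Pr X u
        ≈⟨ *-cong (difference~ X Y (u ⊖ v)) (fst~X X Y u) ⟨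
      ℙ p (difference X Y) (u ⊖ v) * ℙ p proj₁ u
        ≈⟨ entropic-independence p (difference X Y) proj₁ (≤.trans
             (≤.reflexive (sym (+-cong (H-difference X Y) (H-X X Y))) )
                 (≤.trans (HS≤HY ⟨+⟩ ≤.refl) (≤.trans (≤.reflexive (+-comm _ _)) (HX+HY≤difference,fst X Y))))
                 (u , v) (*-pos 0<X 0<Y) ⟨
      ℙ p (difference X Y ▵ proj₁) (u ⊖ v , u)
        ≈⟨ ℙ-cong p {g = id} {u = u , v} (λ (x , y) _ eq → ≡.cong₂ _,_ (≡.cong proj₂ eq)
               (⊕-injectiveʳ {u = y} {v} (≡.trans (⊕-comm y x) (≡.trans (≡.cong proj₁ eq) (⊕-comm u v)))
                   (≡.cong proj₂ eq)))
             (λ { _ _ ≡.refl → ≡.refl }) ⟩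
      ℙ p id (u , v)
        ≈⟨ ℙ-id p (u , v) ⟩
      Pr X u * Pr Y v
        ≈⟨ *-comm _ _ ⟩
      Pr Y v * Pr X u ∎)
      where open ≈-Reasoning

    X-shift : ∀ {v} → 0# < Pr Y v → ∀ z → Pr X (z ⊕ v) ≈ Pr S z
    X-shift {v} 0<Y = sum-≤⇒≈ (vectors n) (λ z → le z (Pr X (z ⊕ v) ≤? 0#))
      (trans (∑-translate n (Pr X) v) (trans (Pr-total X) (sym (Pr-total S))))
      where
      le : ∀ z → Dec (Pr X (z ⊕ v) ≤ 0#) → Pr X (z ⊕ v) ≤ Pr S z
      le z (yes ≤0) = ≤.trans ≤0 (Pr-nonneg S z)
      le z (no 0<X) = ≤.reflexive (trans (sym (S≈X 0<X 0<Y)) (reflexive (≡.cong (Pr S) (⊕-cancelʳ z v))))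

    Y-shift : ∀ {u} → 0# < Pr X u → ∀ z → Pr Y (z ⊕ u) ≈ Pr S z
    Y-shift {u} 0<X = sum-≤⇒≈ (vectors n) (λ z → le z (Pr Y (z ⊕ u) ≤? 0#))
      (trans (∑-translate n (Pr Y) u) (trans (Pr-total Y) (sym (Pr-total S))))
      where
      le : ∀ z → Dec (Pr Y (z ⊕ u) ≤ 0#) → Pr Y (z ⊕ u) ≤ Pr S z
      le z (yes ≤0) = ≤.trans ≤0 (Pr-nonneg S z)
      le z (no 0<Y) = ≤.reflexive (trans (sym (S≈Y 0<X 0<Y)) (reflexive (≡.cong (Pr S)
        (≡.trans (⊕-comm u (z ⊕ u)) (⊕-cancelʳ z u)))))

    stabiliser : Subspace n
    stabiliser = record
      { Member   = λ w → ∀ z → Pr X (z ⊕ w) ≈ Pr X z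
      ; member?  = λ w → excludedMiddle
      ; 𝟎-mem    = λ z → reflexive (≡.cong (Pr X) (⊕-identityʳ z))
      ; ⊕-closed = λ {u} {v} u∈ v∈ z → trans (reflexive (≡.cong (Pr X) (≡.sym (⊕-assoc z u v))))
          (trans (v∈ (z ⊕ u)) (u∈ z))
      ; •-closed = λ { false {v} v∈ z → reflexive (≡.cong (Pr X)
          (≡.trans (≡.cong (z ⊕_) (false• v)) (⊕-identityʳ z)))
                     ; true  {v} v∈ z → trans (reflexive (≡.cong (λ w → Pr X (z ⊕ w)) (Vec.map-id v))) (v∈ z) }
      }
      where
      false• : ∀ {m} (v : F₂^ m) → false • v ≡ 𝟎
      false• []      = ≡.refl
      false• (_ ∷ v) = ≡.cong (false ∷_) (false• v)

    open Subspace stabiliser using (Member; member?)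

    support : ∀ (Z : RandomVariable n) → ∃ λ v → 0# < Pr Z v
    support Z = V.sum-pos⇒∃ (Pr-nonneg Z) (<-≤-trans 0<1 (≤.reflexive (sym (Pr-total Z))))

    u₀ = proj₁ (support X)
    0<Xu₀ = proj₂ (support X)
    v₀ = proj₁ (support Y)
    0<Yv₀ = proj₂ (support Y)

    support⊆coset : ∀ w → 0# < Pr X (u₀ ⊕ w) → Member w
    support⊆coset w 0<X z = begin
      Pr X (z ⊕ w)                              ≡⟨ ≡.cong (Pr X) (⊕-cancelʳ (z ⊕ w) v₀) ⟨
      Pr X (((z ⊕ w) ⊕ v₀) ⊕ v₀)                ≈⟨ X-shift 0<Yv₀ ((z ⊕ w) ⊕ v₀) ⟩
      Pr S ((z ⊕ w) ⊕ v₀)                       ≈⟨ Y-shift 0<Xu₀ ((z ⊕ w) ⊕ v₀) ⟨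
      Pr Y (((z ⊕ w) ⊕ v₀) ⊕ u₀)                ≡⟨ ≡.cong (Pr Y) rearrange ⟩
      Pr Y ((z ⊕ v₀) ⊕ (u₀ ⊕ w))                ≈⟨ Y-shift 0<X (z ⊕ v₀) ⟩
      Pr S (z ⊕ v₀)                             ≈⟨ X-shift 0<Yv₀ (z ⊕ v₀) ⟨
      Pr X ((z ⊕ v₀) ⊕ v₀)                      ≡⟨ ≡.cong (Pr X) (⊕-cancelʳ z v₀) ⟩
      Pr X z                                    ∎
      where
      open ≈-Reasoning
      rearrange : ((z ⊕ w) ⊕ v₀) ⊕ u₀ ≡ (z ⊕ v₀) ⊕ (u₀ ⊕ w)
      rearrange = ≡.trans (⊕-assoc (z ⊕ w) v₀ u₀) (≡.trans (⊕-interchange z w v₀ u₀)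
          (≡.cong ((z ⊕ v₀) ⊕_) (⊕-comm w u₀)))

    X-value : ∀ w → Pr X (u₀ ⊕ w) ≈ Pr X u₀ * 𝟙 (member? w)
    X-value w = value (member? w)
      where
      value : (w∈? : Dec (Member w)) → Pr X (u₀ ⊕ w) ≈ Pr X u₀ * 𝟙 w∈?
      value (yes w∈) = trans (w∈ u₀) (sym (*-identityʳ _))
      value (no w∉)  = trans (≤.antisym (≮⇒≥ (λ 0<X → w∉ (support⊆coset w 0<X))) (Pr-nonneg X _)) (sym (zeroʳ _))

    X-uniform : ∀ w → Pr X (u₀ ⊕ w) ≈ Pr (U stabiliser) w
    X-uniform w = trans (X-value w) (*-congʳ (begin
      Pr X u₀                  ≈⟨ trans (*-congˡ (*-inverseʳ (Ent.card≉0 stabiliser))) (*-identityʳ _) ⟨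
      Pr X u₀ * (c * c ⁻¹)     ≈⟨ *-assoc _ _ _ ⟨
      Pr X u₀ * c * c ⁻¹       ≈⟨ *-congʳ (V.sum-*ˡ (Pr X u₀) _) ⟨
      V.sum (λ w → Pr X u₀ * 𝟙 (member? w)) * c ⁻¹
        ≈⟨ *-congʳ (V.sum-cong (λ w → trans (sym (X-value w)) (reflexive (≡.cong (Pr X) (⊕-comm u₀ w))))) ⟩
      V.sum (λ w → Pr X (w ⊕ u₀)) * c ⁻¹ ≈⟨ *-congʳ (trans (∑-translate n (Pr X) u₀) (Pr-total X)) ⟩
      1# * c ⁻¹                ≈⟨ *-identityˡ _ ⟩
      c ⁻¹                     ∎))
      where
      open ≈-Reasoning
      c = card stabiliser

    Y-uniform : ∀ w → Pr Y (v₀ ⊕ w) ≈ Pr (U stabiliser) w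
    Y-uniform w = begin
      Pr Y (v₀ ⊕ w)                        ≡⟨ ≡.cong (Pr Y) (⊕-cancelʳ (v₀ ⊕ w) u₀) ⟨
      Pr Y (((v₀ ⊕ w) ⊕ u₀) ⊕ u₀)          ≈⟨ Y-shift 0<Xu₀ ((v₀ ⊕ w) ⊕ u₀) ⟩
      Pr S ((v₀ ⊕ w) ⊕ u₀)                 ≈⟨ X-shift 0<Yv₀ ((v₀ ⊕ w) ⊕ u₀) ⟨
      Pr X (((v₀ ⊕ w) ⊕ u₀) ⊕ v₀)          ≡⟨ ≡.cong (Pr X) rearrange ⟩
      Pr X (u₀ ⊕ w)                        ≈⟨ X-uniform w ⟩
      Pr (U stabiliser) w                  ∎
      where
      open ≈-Reasoning
      rearrange : ((v₀ ⊕ w) ⊕ u₀) ⊕ v₀ ≡ u₀ ⊕ w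
      rearrange = ≡.trans (≡.cong (λ t → (t ⊕ u₀) ⊕ v₀) (⊕-comm v₀ w)) (≡.trans (⊕-assoc (w ⊕ v₀) u₀ v₀)
        (≡.trans (⊕-interchange w v₀ u₀ v₀) (≡.trans (≡.cong ((w ⊕ u₀) ⊕_) (⊕-self v₀))
            (≡.trans (⊕-identityʳ (w ⊕ u₀)) (⊕-comm w u₀)))))

  d≈½D : ∀ {n} (X Y : RandomVariable n) → Ent.d[ X ⨾ Y ] ≈ ½ * D X Y
  d≈½D X Y = begin
    s - ½ * e                             ≈⟨ +-congʳ (trans (*-congʳ (*-inverseʳ (<⇒≉ 0<2))) (*-identityˡ s)) ⟨
    2# * ½ * s - ½ * e                    ≈⟨ solve 3
        (λ h s e → (:1 :+ (:1 :+ :0)) :* h :* s :- h :* e := h :* ((s :+ s) :- e)) refl ½ s e ⟩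
    ½ * ((s + s) - e)                     ∎
    where
    open ≈-Reasoning
    s = Ent.H (X ⊟ Y)
    e = Ent.H X + Ent.H Y

theorem1p4 : (ℝ : RealField) → let open RealField ℝ in let open Entropy ℝ in
    (n : ℕ) → .{{_ : NonZero n}} →
    (A B : RandomVariable n) →
    ∃ λ (V : Subspace n) →
    d[ A ⨾ U V ] + d[ B ⨾ U V ] ≤ fromℕ 10 * d[ A ⨾ B ]
theorem1p4 ℝ n A B = V , (begin
    d[ A ⨾ U V ] + d[ B ⨾ U V ]           ≈⟨ +-cong (d≈½D A (U V)) (d≈½D B (U V)) ⟩
    ½ * D A (U V) + ½ * D B (U V)         ≈⟨ distribˡ ½ _ _ ⟨
    ½ * (D A (U V) + D B (U V))           ≈⟨ *-congˡ
        (+-cong (D-translate A X (U V) u₀ X-uniform) (D-translate B Y (U V) v₀ Y-uniform)) ⟨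
    ½ * (D A X + D B Y)                   ≤⟨ ⁻¹-nonneg′ 0<2 ⟨*⟩ bound ⟩
    ½ * (# 10 * D A B)                    ≈⟨ solve 3 (λ h t d → h :* (t :* d) := t :* (h :* d)) refl ½ (# 10)
        (D A B) ⟩
    # 10 * (½ * D A B)                    ≈⟨ *-cong (Solver.embedℕ-× 10) (sym (d≈½D A B)) ⟩
    fromℕ 10 * d[ A ⨾ B ]                 ∎)
  where
  open RealField ℝ
  open Entropy ℝ
  open OrderedField ℝ
  open ≤-Reasoning
  open RandomVariables ℝ using (D)
  open Logarithm ℝ using (0<2)
  open Extremal ℝ
  limits = limit-of-near-minimisers A B
  X = proj₁ limits
  Y = proj₁ (proj₂ limits)
  bound = proj₂ (proj₂ (proj₂ limits))
  open ZeroDistance X Y (proj₁ (proj₂ (proj₂ limits))) using (u₀; v₀; X-uniform; Y-uniform)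
    renaming (stabiliser to V)
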